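{- Let $\mathcal{A}$ be an arrangement in $V$ and $H\in\mathcal{A}$. Then: (1) $\mathrm{Min}(\overline S/J_{\mathcal{A}}^H)=\{P_X\mid X\in\Xi^{\max}(\mathcal{A},H)\}$. (2) $\mathrm{Ass}(\overline S/J_{\mathcal{A}}^H)\subset\{P_X\mid X\in\Xi(\mathcal{A},H)\}$. (3) If $X\in\Xi^{\max}(\mathcal{A},H)$ and $\mathcal{A}_X$ is free, then $J_{\mathcal{A}_X}^H$ is a complete intersection.
   Context: Let $\mathbb{K}$ be a field, $V$ an $\ell$-dimensional $\mathbb{K}$-vector space, $x_1,\dots,x_\ell$ a basis of $V^*$ and $S=\mathrm{Sym}(V^*)=\mathbb{K}[x_1,\dots,x_\ell]$. An arrangement in $V$ is a finite set $\mathcal{A}$ of linear hyperplanes (through the origin) of $V$. For a hyperplane $H$, $\alpha_H\in V^*$ denotes a fixed defining linear form, and $Q(\mathcal{A})=\prod_{H\in\mathcal{A}}\alpha_H$. Let $\Omega_V^1=\bigoplus_i S\,dx_i$, $\Omega_V^2=\bigwedge^2\Omega_V^1$, and for $\alpha=\sum c_ix_i$ let $d\alpha=\sum c_i\,dx_i$. Define $$\Omega^1(\mathcal{A})=\{\omega\in \tfrac{1}{Q(\mathcal{A})}\Omega^1_V \mid Q(\mathcal{A})\,\omega\wedge d\alpha_L\in\alpha_L\Omega_V^2\ \text{for all } L\in\mathcal{A}\}.$$ $\mathcal{A}$ is free if $\Omega^1(\mathcal{A})$ is a free $S$-module (equivalently, if $D(\mathcal{A})=\{\theta\in\bigoplus_i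 S\,\partial_{x_i}\mid \theta(\alpha_L)\in(\alpha_L)\ \forall L\in\mathcal{A}\}$ is free). For $H\in\mathcal{A}$, the restriction is $\mathcal{A}^H=\{H\cap L\mid L\in\mathcal{A},L\ne H\}$, an arrangement in $H$ with coordinate ring $\overline S=S/(\alpha_H)=\mathrm{Sym}(H^*)$; $\overline g$ is the image in $\overline S$ of $g\in S$. The residue map $\mathrm{res}^H_{\mathcal{A}}:\Omega^1(\mathcal{A})\to\overline S$ is $$\mathrm{res}^H_{\mathcal{A}}\big(f\,d\alpha_H+f_2\,d\alpha_2+\cdots+f_\ell\,d\alpha_\ell\big)=\frac{1}{Q(\mathcal{A}^H)}\,\overline{Q(\mathcal{A})f},$$ where $\alpha_H,\alpha_2,\dots,\alpha_\ell$ is any basis of $V^*$ (well defined, independent of the choice of $\alpha_2,\dots,\alpha_\ell$, with values in $\overline S$). The residue ideal $J_{\mathcal{A}}^H\subset\overline S$ is the image of $\mathrm{res}^H_{\mathcal{A}}$. $L(\mathcal{A}^H)$ is the set of all subspaces of $H$ that are intersections of hyperplanes of $\mathcal{A}^H$ (including $H$ as the empty intersection). For a subspace $X$, $\mathcal{A}_X=\{L\in\mathcal{A}\mid X\subseteq L\}$. Define $\Xi(\mathcal{A},H)=\{X\in L(\mathcal{A}^H)\mid J_{\mathcal{A}_X}^H\ne\overline S\}$, and let $\Xi^{\max}(\mathcal{A},H)$ be the set of its maximal elements with respect to inclusion of subspaces. $P_X\subset\overline S$ is the defining ideal of a subspace $X\subset H$. $\mathrm{Ass}(\overline S/J)$ is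 the set of associated primes and $\mathrm{Min}(\overline S/J)$ the set of minimal primes containing $J$. An ideal $J\subset\overline S$ is a complete intersection if, for some $k$, it is generated by $k$ elements and $\overline S/J$ has Krull dimension $\ell-1-k$. -}

module Defs where

open import Algebra.Apartness.Bundles using (HeytingField; HeytingCommutativeRing)
open import Algebra.Bundles using (CommutativeRing)
open import Algebra.Definitions.RawMonoid using (sum)
import Algebra.Properties.CommutativeSemigroup as CommSemigroupProperties
open import Axiom.ExcludedMiddle using (ExcludedMiddle)
open import Data.Fin.Base using (Fin; zero; suc; inject₁) renaming (_<_ to _<ᶠ_)
open import Data.List.Base using (List; []; _∷_; map; foldr; filter; deduplicate)
open import Data.List.Relation.Binary.Subset.Propositional using ()
  renaming (_⊆_ to _⊆ˡ_)
open import Data.List.Relation.Unary.All using (All)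
import Data.List.Relation.Unary.All.Properties as All
open import Data.List.Relation.Unary.AllPairs using (AllPairs)
import Data.List.Relation.Unary.AllPairs.Properties as AllPairs
open import Data.Nat.Base as ℕ using (ℕ; zero; suc)
open import Data.Product.Base using (Σ; ∃; _×_; _,_)
open import Data.Sum.Base using (_⊎_)
open import Data.Vec.Functional using (Vector)
open import Function.Definitions using (Injective)
open import Level using (_⊔_) renaming (suc to lsuc)
open import Relation.Binary.PropositionalEquality.Core using (_≡_)
open import Relation.Nullary.Decidable.Core using (¬?)
open import Relation.Nullary.Negation.Core using (¬_)
open import Relation.Unary using (Pred; _∈_; _∉_; _⊆_; _⊂_; _≐_; _∩_; U)

module Polynomial {c ℓ} (R : CommutativeRing c ℓ) where

  open CommutativeRing R
  open CommSemigroupProperties +-commutativeSemigroup using (interchange)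
  open import Algebra.Properties.Ring ring using (-0#≈0#)

  -- Lowest-degree coefficient first; trailing zeros are allowed and are
  -- identified by _≋_.
  Poly : Set c
  Poly = List Carrier

  coeff : Poly → ℕ → Carrier
  coeff []      _       = 0#
  coeff (a ∷ p) zero    = a
  coeff (a ∷ p) (suc n) = coeff p n

  infix 4 _≋_
  record _≋_ (p q : Poly) : Set ℓ where
    constructor eq
    field at : ∀ n → coeff p n ≈ coeff q n
  open _≋_ public

  infixl 6 _⊕_
  infixl 7 _⊗_

  _⊕_ : Poly → Poly → Poly
  []      ⊕ q       = q
  (a ∷ p) ⊕ []      = a ∷ p
  (a ∷ p) ⊕ (b ∷ q) = (a + b) ∷ (p ⊕ q)

  ⊖_ : Poly → Poly
  ⊖_ = map (-_)

  scale : Carrier → Poly → Poly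
  scale a = map (a *_)

  _⊗_ : Poly → Poly → Poly
  []      ⊗ q = []
  (a ∷ p) ⊗ q = scale a q ⊕ (0# ∷ (p ⊗ q))

  C : Carrier → Poly
  C a = a ∷ []

  X : Poly
  X = 0# ∷ 1# ∷ []

  coeff-⊕ : ∀ p q n → coeff (p ⊕ q) n ≈ coeff p n + coeff q n
  coeff-⊕ []      q       n       = sym (+-identityˡ _)
  coeff-⊕ (a ∷ p) []      n       = sym (+-identityʳ _)
  coeff-⊕ (a ∷ p) (b ∷ q) zero    = refl
  coeff-⊕ (a ∷ p) (b ∷ q) (suc n) = coeff-⊕ p q n

  coeff-⊖ : ∀ p n → coeff (⊖ p) n ≈ - coeff p n
  coeff-⊖ []      n       = sym -0#≈0#
  coeff-⊖ (a ∷ p) zero    = refl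
  coeff-⊖ (a ∷ p) (suc n) = coeff-⊖ p n

  coeff-scale : ∀ a p n → coeff (scale a p) n ≈ a * coeff p n
  coeff-scale a []      n       = sym (zeroʳ a)
  coeff-scale a (b ∷ p) zero    = refl
  coeff-scale a (b ∷ p) (suc n) = coeff-scale a p n

  ≋-refl : ∀ {p} → p ≋ p
  ≋-refl = eq λ _ → refl

  ≋-sym : ∀ {p q} → p ≋ q → q ≋ p
  ≋-sym e = eq λ n → sym (at e n)

  ≋-trans : ∀ {p q r} → p ≋ q → q ≋ r → p ≋ r
  ≋-trans e f = eq λ n → trans (at e n) (at f n)

  ⊕-cong : ∀ {p p′ q q′} → p ≋ p′ → q ≋ q′ → p ⊕ q ≋ p′ ⊕ q′
  ⊕-cong {p} {p′} {q} {q′} e f = eq λ n →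
    trans (coeff-⊕ p q n) (trans (+-cong (at e n) (at f n)) (sym (coeff-⊕ p′ q′ n)))

  ⊕-comm : ∀ p q → p ⊕ q ≋ q ⊕ p
  ⊕-comm p q = eq λ n →
    trans (coeff-⊕ p q n) (trans (+-comm _ _) (sym (coeff-⊕ q p n)))

  ⊕-assoc : ∀ p q r → (p ⊕ q) ⊕ r ≋ p ⊕ (q ⊕ r)
  ⊕-assoc p q r = eq λ n →
    trans (coeff-⊕ (p ⊕ q) r n) (trans (+-congʳ (coeff-⊕ p q n))
      (trans (+-assoc _ _ _)
        (sym (trans (coeff-⊕ p (q ⊕ r) n) (+-congˡ (coeff-⊕ q r n))))))

  ⊕-identityʳ : ∀ p → p ⊕ [] ≋ p
  ⊕-identityʳ p = ⊕-comm p []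

  ⊖-cong : ∀ {p q} → p ≋ q → ⊖ p ≋ ⊖ q
  ⊖-cong {p} {q} e = eq λ n →
    trans (coeff-⊖ p n) (trans (-‿cong (at e n)) (sym (coeff-⊖ q n)))

  ⊖-inverseˡ : ∀ p → (⊖ p) ⊕ p ≋ []
  ⊖-inverseˡ p = eq λ n →
    trans (coeff-⊕ (⊖ p) p n) (trans (+-congʳ (coeff-⊖ p n)) (-‿inverseˡ _))

  ⊖-inverseʳ : ∀ p → p ⊕ (⊖ p) ≋ []
  ⊖-inverseʳ p = ≋-trans (⊕-comm p (⊖ p)) (⊖-inverseˡ p)

  ⊕-interchange : ∀ p q r s → (p ⊕ q) ⊕ (r ⊕ s) ≋ (p ⊕ r) ⊕ (q ⊕ s)
  ⊕-interchange p q r s = eq λ n →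
    trans (coeff-⊕ (p ⊕ q) (r ⊕ s) n)
      (trans (+-cong (coeff-⊕ p q n) (coeff-⊕ r s n))
        (trans (interchange _ _ _ _)
          (sym (trans (coeff-⊕ (p ⊕ r) (q ⊕ s) n)
                      (+-cong (coeff-⊕ p r n) (coeff-⊕ q s n))))))

  ∷-cong : ∀ {a b p q} → a ≈ b → p ≋ q → (a ∷ p) ≋ (b ∷ q)
  ∷-cong d e = eq λ { zero → d ; (suc n) → at e n }

  0∷[] : (0# ∷ []) ≋ []
  0∷[] = eq λ { zero → refl ; (suc n) → refl }

  scale-cong : ∀ {a b p q} → a ≈ b → p ≋ q → scale a p ≋ scale b q
  scale-cong {a} {b} {p} {q} d e = eq λ n →
    trans (coeff-scale a p n) (trans (*-cong d (at e n)) (sym (coeff-scale b q n)))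

  scale-⊕ : ∀ a p q → scale a (p ⊕ q) ≋ scale a p ⊕ scale a q
  scale-⊕ a p q = eq λ n →
    trans (coeff-scale a (p ⊕ q) n) (trans (*-congˡ (coeff-⊕ p q n))
      (trans (distribˡ _ _ _)
        (sym (trans (coeff-⊕ (scale a p) (scale a q) n)
                    (+-cong (coeff-scale a p n) (coeff-scale a q n))))))

  scale-scale : ∀ a b p → scale (a * b) p ≋ scale a (scale b p)
  scale-scale a b p = eq λ n →
    trans (coeff-scale (a * b) p n) (trans (*-assoc a b _)
      (sym (trans (coeff-scale a (scale b p) n) (*-congˡ (coeff-scale b p n)))))

  scale-0 : ∀ p → scale 0# p ≋ []
  scale-0 p = eq λ n → trans (coeff-scale 0# p n) (zeroˡ _)

  scale-1 : ∀ p → scale 1# p ≋ p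
  scale-1 p = eq λ n → trans (coeff-scale 1# p n) (*-identityˡ _)

  ⊗-congˡ : ∀ p {q q′} → q ≋ q′ → p ⊗ q ≋ p ⊗ q′
  ⊗-congˡ []      e = ≋-refl
  ⊗-congˡ (a ∷ p) e = ⊕-cong (scale-cong refl e) (∷-cong refl (⊗-congˡ p e))

  ⊗-zeroʳ : ∀ p → p ⊗ [] ≋ []
  ⊗-zeroʳ []      = ≋-refl
  ⊗-zeroʳ (a ∷ p) = ≋-trans (∷-cong refl (⊗-zeroʳ p)) 0∷[]

  ⊗-∷ : ∀ p b q → p ⊗ (b ∷ q) ≋ scale b p ⊕ (0# ∷ (p ⊗ q))
  ⊗-∷ []      b q = ≋-sym 0∷[]
  ⊗-∷ (a ∷ p) b q = ∷-cong
    (+-congʳ (*-comm a b))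
    (≋-trans (⊕-cong (≋-refl {scale a q}) (⊗-∷ p b q))
      (≋-trans (≋-sym (⊕-assoc (scale a q) (scale b p) _))
        (≋-trans (⊕-cong (⊕-comm (scale a q) (scale b p)) ≋-refl)
          (⊕-assoc (scale b p) (scale a q) _))))

  ⊗-comm : ∀ p q → p ⊗ q ≋ q ⊗ p
  ⊗-comm []      q = ≋-sym (⊗-zeroʳ q)
  ⊗-comm (a ∷ p) q =
    ≋-trans (⊕-cong (≋-refl {scale a q}) (∷-cong refl (⊗-comm p q))) (≋-sym (⊗-∷ q a p))

  ⊗-cong : ∀ {p p′ q q′} → p ≋ p′ → q ≋ q′ → p ⊗ q ≋ p′ ⊗ q′
  ⊗-cong {p} {p′} {q} {q′} e f =
    ≋-trans (⊗-congˡ p f)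
      (≋-trans (⊗-comm p q′) (≋-trans (⊗-congˡ q′ e) (⊗-comm q′ p′)))

  ⊗-distribˡ : ∀ p q r → p ⊗ (q ⊕ r) ≋ (p ⊗ q) ⊕ (p ⊗ r)
  ⊗-distribˡ []      q r = ≋-refl
  ⊗-distribˡ (a ∷ p) q r =
    ≋-trans (⊕-cong (scale-⊕ a q r)
                    (∷-cong (sym (+-identityˡ 0#)) (⊗-distribˡ p q r)))
            (⊕-interchange (scale a q) (scale a r) (0# ∷ (p ⊗ q)) (0# ∷ (p ⊗ r)))

  ⊗-distribʳ : ∀ p q r → (q ⊕ r) ⊗ p ≋ (q ⊗ p) ⊕ (r ⊗ p)
  ⊗-distribʳ p q r =
    ≋-trans (⊗-comm (q ⊕ r) p)
      (≋-trans (⊗-distribˡ p q r) (⊕-cong (⊗-comm p q) (⊗-comm p r)))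

  scale-⊗ : ∀ a p q → scale a p ⊗ q ≋ scale a (p ⊗ q)
  scale-⊗ a []      q = ≋-refl
  scale-⊗ a (b ∷ p) q =
    ≋-trans (⊕-cong (scale-scale a b q) (∷-cong (sym (zeroʳ a)) (scale-⊗ a p q)))
            (≋-sym (scale-⊕ a (scale b q) (0# ∷ (p ⊗ q))))

  shift-⊗ : ∀ p q → (0# ∷ p) ⊗ q ≋ 0# ∷ (p ⊗ q)
  shift-⊗ p q = ⊕-cong (scale-0 q) ≋-refl

  ⊗-assoc : ∀ p q r → (p ⊗ q) ⊗ r ≋ p ⊗ (q ⊗ r)
  ⊗-assoc []      q r = ≋-refl
  ⊗-assoc (a ∷ p) q r =
    ≋-trans (⊗-distribʳ r (scale a q) (0# ∷ (p ⊗ q)))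
      (⊕-cong (scale-⊗ a q r)
        (≋-trans (shift-⊗ (p ⊗ q) r) (∷-cong refl (⊗-assoc p q r))))

  ⊗-identityˡ : ∀ p → C 1# ⊗ p ≋ p
  ⊗-identityˡ p =
    ≋-trans (⊕-cong (scale-1 p) 0∷[]) (⊕-identityʳ p)

  ⊗-identityʳ : ∀ p → p ⊗ C 1# ≋ p
  ⊗-identityʳ p = ≋-trans (⊗-comm p (C 1#)) (⊗-identityˡ p)

  polynomialRing : CommutativeRing c ℓ
  polynomialRing = record
    { Carrier = Poly ; _≈_ = _≋_ ; _+_ = _⊕_ ; _*_ = _⊗_
    ; -_ = ⊖_ ; 0# = [] ; 1# = C 1#
    ; isCommutativeRing = record
      { isRing = record
        { +-isAbelianGroup = record
          { isGroup = record
            { isMonoid = record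
              { isSemigroup = record
                { isMagma = record
                  { isEquivalence = record
                    { refl = ≋-refl ; sym = ≋-sym ; trans = ≋-trans }
                  ; ∙-cong = ⊕-cong }
                ; assoc = ⊕-assoc }
              ; identity = (λ _ → ≋-refl) , ⊕-identityʳ }
            ; inverse = ⊖-inverseˡ , ⊖-inverseʳ
            ; ⁻¹-cong = ⊖-cong }
          ; comm = ⊕-comm }
        ; *-cong = ⊗-cong
        ; *-assoc = ⊗-assoc
        ; *-identity = ⊗-identityˡ , ⊗-identityʳ
        ; distrib = ⊗-distribˡ , ⊗-distribʳ }
      ; *-comm = ⊗-comm }
    }

-- R[x₁,…,xₙ] as R[x₂,…,xₙ][x₁].
module _ {c ℓ} (R : CommutativeRing c ℓ) where

  MvPoly : ℕ → CommutativeRing c ℓ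
  MvPoly zero    = R
  MvPoly (suc n) = Polynomial.polynomialRing (MvPoly n)

  const : ∀ {n} → CommutativeRing.Carrier R → CommutativeRing.Carrier (MvPoly n)
  const {zero}  a = a
  const {suc n} a = Polynomial.C (MvPoly n) (const {n} a)

  var : ∀ {n} → Fin n → CommutativeRing.Carrier (MvPoly n)
  var {suc n} zero    = Polynomial.X (MvPoly n)
  var {suc n} (suc i) = Polynomial.C (MvPoly n) (var i)

module Ideals {c ℓ} (R : CommutativeRing c ℓ) where

  open CommutativeRing R
  open import Algebra.Properties.Ring ring
    using (-1*x≈-x; -‿+-comm; -‿involutive; x[y-z]≈xy-xz; [y-z]x≈yx-zx)
  open CommSemigroupProperties +-commutativeSemigroup using (interchange)

  data ⟨_⟩ {g} (G : Pred Carrier g) : Pred Carrier (c ⊔ ℓ ⊔ g) where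
    gen  : ∀ {x} → x ∈ G → x ∈ ⟨ G ⟩
    zer  : 0# ∈ ⟨ G ⟩
    add  : ∀ {x y} → x ∈ ⟨ G ⟩ → y ∈ ⟨ G ⟩ → x + y ∈ ⟨ G ⟩
    mul  : ∀ r {x} → x ∈ ⟨ G ⟩ → r * x ∈ ⟨ G ⟩
    resp : ∀ {x y} → x ≈ y → x ∈ ⟨ G ⟩ → y ∈ ⟨ G ⟩

  record IsIdeal {p} (I : Pred Carrier p) : Set (c ⊔ ℓ ⊔ p) where
    field
      I-resp : ∀ {x y} → x ≈ y → x ∈ I → y ∈ I
      I-zero : 0# ∈ I
      I-add  : ∀ {x y} → x ∈ I → y ∈ I → x + y ∈ I
      I-mul  : ∀ r {x} → x ∈ I → r * x ∈ I

  record IsPrime {p} (P : Pred Carrier p) : Set (c ⊔ ℓ ⊔ p) where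
    field
      isIdeal : IsIdeal P
      proper  : 1# ∉ P
      prime   : ∀ {x y} → x * y ∈ P → x ∈ P ⊎ y ∈ P

  record IsMinimalPrimeOver {i p} (I : Pred Carrier i) (P : Pred Carrier p)
         : Set (c ⊔ ℓ ⊔ i ⊔ lsuc p) where
    field
      isPrime  : IsPrime P
      contains : I ⊆ P
      minimal  : ∀ (P′ : Pred Carrier p) → IsPrime P′ → I ⊆ P′ → P′ ⊆ P → P ⊆ P′

  module _ {g} (G : Pred Carrier g) where

    record _≈/_ (x y : Carrier) : Set (c ⊔ ℓ ⊔ g) where
      constructor mod
      field difference : x - y ∈ ⟨ G ⟩

    private

      e-neg : ∀ x y → - 1# * (x - y) ≈ (- x) - (- y)
      e-neg x y = trans (-1*x≈-x _) (sym (-‿+-comm x (- y)))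
      e-sym : ∀ x y → - 1# * (x - y) ≈ y - x
      e-sym x y = trans (e-neg x y) (trans (+-congˡ (-‿involutive y)) (+-comm _ _))
      e-trans : ∀ x y z → (x - y) + (y - z) ≈ x - z
      e-trans x y z = trans (+-assoc x (- y) (y - z)) (+-congˡ
        (trans (sym (+-assoc (- y) y (- z))) (trans (+-congʳ (-‿inverseˡ y)) (+-identityˡ _))))
      e-+ : ∀ x y u v → (x - y) + (u - v) ≈ (x + u) - (y + v)
      e-+ x y u v = trans (interchange x (- y) u (- v)) (+-congˡ (-‿+-comm y v))
      e-* : ∀ x y u v → u * (x - y) + y * (u - v) ≈ x * u - y * v
      e-* x y u v = trans
        (+-cong (trans (*-comm u _) ([y-z]x≈yx-zx u x y)) (x[y-z]≈xy-xz y u v))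
        (e-trans (x * u) (y * u) (y * v))

      lift : ∀ {x y} → x ≈ y → x ≈/ y
      lift {x} {y} e =
        mod (resp (sym (trans (+-congʳ e) (-‿inverseʳ y))) zer)

    -- R/(G), for an arbitrary subset G (not required to be an ideal).
    _/⟨_⟩ : CommutativeRing c (c ⊔ ℓ ⊔ g)
    _/⟨_⟩ = record
      { Carrier = Carrier ; _≈_ = _≈/_ ; _+_ = _+_ ; _*_ = _*_
      ; -_ = -_ ; 0# = 0# ; 1# = 1#
      ; isCommutativeRing = record
        { isRing = record
          { +-isAbelianGroup = record
            { isGroup = record
              { isMonoid = record
                { isSemigroup = record
                  { isMagma = record
                    { isEquivalence = record
                      { refl  = lift refl
                      ; sym   = λ { (mod d) → mod (resp (e-sym _ _) (mul (- 1#) d)) }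
                      ; trans = λ { (mod d) (mod e) → mod (resp (e-trans _ _ _) (add d e)) } }
                    ; ∙-cong = λ { (mod d) (mod e) → mod (resp (e-+ _ _ _ _) (add d e)) } }
                  ; assoc = λ x y z → lift (+-assoc x y z) }
                ; identity = (λ x → lift (+-identityˡ x)) , (λ x → lift (+-identityʳ x)) }
              ; inverse = (λ x → lift (-‿inverseˡ x)) , (λ x → lift (-‿inverseʳ x))
              ; ⁻¹-cong = λ { (mod d) → mod (resp (e-neg _ _) (mul (- 1#) d)) } }
            ; comm = λ x y → lift (+-comm x y) }
          ; *-cong = λ { {x} {y} {u} {v} (mod d) (mod e) →
                           mod (resp (e-* x y u v) (add (mul u d) (mul y e))) }
          ; *-assoc = λ x y z → lift (*-assoc x y z)
          ; *-identity = (λ x → lift (*-identityˡ x)) , (λ x → lift (*-identityʳ x))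
          ; distrib = (λ x y z → lift (distribˡ x y z)) , (λ x y z → lift (distribʳ x y z)) }
        ; *-comm = λ x y → lift (*-comm x y) }
      }

  -- P is the annihilator of the class of some f in R/(I).
  IsAssociatedPrime : ∀ {i p} (I : Pred Carrier i) (P : Pred Carrier p) → Set _
  IsAssociatedPrime I P =
    IsPrime P × ∃ λ f → P ≐ (λ r → CommutativeRing._≈_ (_/⟨_⟩ I) (r * f) 0#)

PrimeChain : ∀ {c ℓ} → CommutativeRing c ℓ → ℕ → Set (lsuc (c ⊔ ℓ))
PrimeChain {c} {ℓ} R d =
  ∃ λ (P : Fin (suc d) → Pred (CommutativeRing.Carrier R) (c ⊔ ℓ)) →
    (∀ i → Ideals.IsPrime R (P i)) × (∀ (i : Fin d) → P (inject₁ i) ⊂ P (suc i))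

HasKrullDim : ∀ {c ℓ} → CommutativeRing c ℓ → ℕ → Set (lsuc (c ⊔ ℓ))
HasKrullDim R d = PrimeChain R d × ¬ PrimeChain R (suc d)

module _ {c ℓ} (R : CommutativeRing c ℓ) where

  open CommutativeRing R

  private
    combination : ∀ {n m} → Vector Carrier m → (Fin m → Vector Carrier n) → Vector Carrier n
    combination s b k = sum +-rawMonoid (λ j → s j * b j k)

  -- Freeness of a submodule N of Rⁿ; the set I indexing a basis is not
  -- assumed finite.
  IsFree : ∀ {n p} → Pred (Vector Carrier n) p → Set (lsuc (c ⊔ ℓ) ⊔ p)
  IsFree {n} N =
    Σ (Set (c ⊔ ℓ)) λ I → Σ (I → Vector Carrier n) λ b →
      (∀ i → b i ∈ N)
    × (∀ x → x ∈ N → ∃ λ m → Σ (Fin m → I) λ e → Σ (Vector Carrier m) λ s →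
         ∀ k → x k ≈ combination s (λ j → b (e j)) k)
    × (∀ m (e : Fin m → I) → Injective _≡_ _≡_ e → (s : Vector Carrier m) →
         (∀ k → combination s (λ j → b (e j)) k ≈ 0#) → ∀ j → s j ≈ 0#)

-- V is taken to be K^ℓ, with x₁,…,x_ℓ the coordinate functions.
module Arrangements {c ℓ₁ ℓ₂} (K : HeytingField c ℓ₁ ℓ₂) (ℓ : ℕ) where

  scalars : CommutativeRing c ℓ₁
  scalars = HeytingCommutativeRing.commutativeRing
              (HeytingField.heytingCommutativeRing K)

  private
    module K = CommutativeRing scalars

  S : CommutativeRing c ℓ₁
  S = MvPoly scalars ℓ

  private
    module S = CommutativeRing S

  V : Set c
  V = Vector K.Carrier ℓ

  -- Elements of V*, by their coefficients in x₁,…,x_ℓ.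
  Form : Set c
  Form = Vector K.Carrier ℓ

  ker : Form → Pred V ℓ₁
  ker α v = sum K.+-rawMonoid (λ i → α i K.* v i) K.≈ K.0#

  toPoly : Form → S.Carrier
  toPoly α = sum S.+-rawMonoid (λ i → const scalars {ℓ} (α i) S.* var scalars i)

  IsBasis : (Fin ℓ → Form) → Set (c ⊔ ℓ₁)
  IsBasis β =
      (∀ (γ : Form) → ∃ λ (a : Vector K.Carrier ℓ) → ∀ j → γ j K.≈ combine a j)
    × (∀ (a : Vector K.Carrier ℓ) → (∀ j → combine a j K.≈ K.0#) → ∀ i → a i K.≈ K.0#)
    where
    combine : Vector K.Carrier ℓ → Form
    combine a j = sum K.+-rawMonoid (λ i → a i K.* β i j)

  -- A finite set of hyperplanes, listed without repetition and each given
  -- by its fixed defining form.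
  record Arrangement : Set (c ⊔ ℓ₁) where
    field
      forms    : List Form
      nonzero  : All (λ α → ¬ (∀ i → α i K.≈ K.0#)) forms
      distinct : AllPairs (λ α β → ¬ (ker α ≐ ker β)) forms
  open Arrangement public

  product : List Form → S.Carrier
  product = foldr (λ α q → toPoly α S.* q) S.1#

  Q : Arrangement → S.Carrier
  Q A = product (forms A)

  -- Ω¹_V in the basis dxᵢ, and Ω²_V in the basis dxᵢ ∧ dxⱼ (i < j).
  Ω¹ : Set c
  Ω¹ = Vector S.Carrier ℓ

  Ω² : Set c
  Ω² = ∀ (i j : Fin ℓ) → i <ᶠ j → S.Carrier

  d : Form → Ω¹
  d α i = const scalars {ℓ} (α i)

  _∧_ : Ω¹ → Ω¹ → Ω²
  (η ∧ θ) i j _ = η i S.* θ j S.- η j S.* θ i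

  -- The module Ω¹(A), where η ∈ Ω¹_V stands for the rational form
  -- ω = η / Q(A); this identifies (1/Q(A)) Ω¹_V with Ω¹_V as S-modules.
  Log : Arrangement → Pred Ω¹ (c ⊔ ℓ₁)
  Log A η = All (λ L → ∃ λ (ξ : Ω²) →
                   ∀ i j i<j → (η ∧ d L) i j i<j S.≈ toPoly L S.* ξ i j i<j)
                (forms A)

  -- S̄ = S/(α_H).
  S̄ : Form → CommutativeRing c (c ⊔ ℓ₁)
  S̄ H = Ideals._/⟨_⟩ S (λ s → s S.≈ toPoly H)

  -- The defining ideal P_X ⊂ S̄ of a subspace X ⊆ H, generated by the linear
  -- forms vanishing on X (over a finite field, polynomials vanishing at the
  -- points of X would give a larger ideal).
  definingIdeal : (H : Form) → Pred V (c ⊔ ℓ₁) → Pred S.Carrier (c ⊔ ℓ₁)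
  definingIdeal H X =
    Ideals.⟨_⟩ (S̄ H) (λ s → ∃ λ α → X ⊆ ker α × CommutativeRing._≈_ (S̄ H) s (toPoly α))

  IsCompleteIntersection : (H : Form) → Pred S.Carrier (c ⊔ ℓ₁) → Set (lsuc (c ⊔ ℓ₁))
  IsCompleteIntersection H J = ∃ λ k →
      (∃ λ (a : Fin k → S.Carrier) →
         J ≐ Ideals.⟨_⟩ (S̄ H) (λ s → ∃ λ i → CommutativeRing._≈_ (S̄ H) s (a i)))
    × (∃ λ e → HasKrullDim (Ideals._/⟨_⟩ (S̄ H) J) e × ℓ ≡ suc (k ℕ.+ e))

  -- Excluded middle is used to decide equality and inclusion of subspaces
  -- when listing the hyperplanes of A^H and A_X.
  module Residues (em : ∀ {a} → ExcludedMiddle a) where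

    -- Defining forms, one for each hyperplane of A^H; each is the restriction
    -- to H of the listed form in V*.
    restriction : Arrangement → Form → List Form
    restriction A H =
      deduplicate (λ L L′ → em {P = (ker H ∩ ker L) ≐ (ker H ∩ ker L′)})
        (filter (λ L → ¬? (em {P = ker L ≐ ker H})) (forms A))

    localization : Arrangement → Pred V (c ⊔ ℓ₁) → Arrangement
    localization A X = record
      { forms    = filter X⊆? (forms A)
      ; nonzero  = All.filter⁺ X⊆? (nonzero A)
      ; distinct = AllPairs.filter⁺ X⊆? (distinct A)
      }
      where X⊆? = λ L → em {P = X ⊆ ker L}

    -- The graph of the residue map. Here η = Q(A) ω = ∑ᵢ gᵢ dβᵢ with β
    -- a basis containing α_H = β i₀, so that g i₀ = Q(A) f; division by
    -- Q(A^H) takes place in the domain S̄.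
    IsResidue : Arrangement → Form → Ω¹ → S.Carrier → Set (c ⊔ ℓ₁)
    IsResidue A H η r =
      Σ (Fin ℓ → Form) λ β → ∃ λ (i₀ : Fin ℓ) → Σ (Vector S.Carrier ℓ) λ g →
          IsBasis β
        × (∀ j → β i₀ j K.≈ H j)
        × (∀ j → η j S.≈ sum S.+-rawMonoid (λ i → g i S.* d (β i) j))
        × CommutativeRing._≈_ (S̄ H) (product (restriction A H) S.* r) (g i₀)

    residueIdeal : Arrangement → Form → Pred S.Carrier (c ⊔ ℓ₁)
    residueIdeal A H r = ∃ λ η → η ∈ Log A × IsResidue A H η r

    IsFlat : Arrangement → Form → Pred V (c ⊔ ℓ₁) → Set (c ⊔ ℓ₁)
    IsFlat A H X = ∃ λ (B : List Form) →
      B ⊆ˡ restriction A H × X ≐ (ker H ∩ λ v → All (λ L → v ∈ ker L) B)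

    Ξ : Arrangement → Form → Pred (Pred V (c ⊔ ℓ₁)) (c ⊔ ℓ₁)
    Ξ A H X = IsFlat A H X × ¬ (residueIdeal (localization A X) H ≐ U)

    Ξmax : Arrangement → Form → Pred (Pred V (c ⊔ ℓ₁)) (lsuc (c ⊔ ℓ₁))
    Ξmax A H X = X ∈ Ξ A H × (∀ Y → Y ∈ Ξ A H → X ⊆ Y → Y ⊆ X)

{-# OPTIONS --safe #-}
module Submission where

open import Defs
open import Algebra.Apartness.Bundles using (HeytingField)
open import Algebra.Bundles using (CommutativeRing; RawRing)
import Algebra.Properties.Ring
import Algebra.Properties.Semiring.Exp
import Algebra.Properties.Semiring.Mult
import Algebra.Properties.Semiring.Sum
import Algebra.Solver.Ring
open import Algebra.Solver.Ring.AlmostCommutativeRing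
  using (fromCommutativeRing; _-Raw-AlmostCommutative⟶_; Induced-equivalence)
open import Axiom.ExcludedMiddle using (ExcludedMiddle)
open import Data.Empty using (⊥-elim)
open import Data.Fin.Base as Fin using (Fin; zero; suc; inject₁)
import Data.Fin.Properties as Fin
open import Data.List.Base as List using (List; []; _∷_; _++_; filter; deduplicate)
open import Data.List.Membership.Propositional using () renaming (_∈_ to _∈ˡ_)
import Data.List.Membership.Propositional.Properties as ∈ˡ
import Data.List.Properties as List
open import Data.List.Relation.Binary.Sublist.Propositional as Sublist using ([]; _∷ʳ_; _∷_)
import Data.List.Relation.Binary.Sublist.Propositional.Properties as Sublist
open import Data.List.Relation.Unary.All as All using (All; []; _∷_)
import Data.List.Relation.Unary.All.Properties as All
open import Data.List.Relation.Unary.AllPairs as AllPairs using (AllPairs; []; _∷_)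
import Data.List.Relation.Unary.AllPairs.Properties as AllPairs
open import Data.List.Relation.Unary.Any as Any using (here; there)
import Data.List.Relation.Unary.Any.Properties as Any
open import Data.Maybe.Base using (just; nothing)
open import Data.Nat.Base as ℕ using (ℕ; zero; suc)
import Data.Nat.Properties as ℕ
open import Data.Product.Base using (Σ; ∃; _×_; _,_; proj₁; proj₂)
open import Data.Sum.Base using (_⊎_; inj₁; inj₂; [_,_]′)
open import Data.Unit.Polymorphic.Base using (⊤; tt)
open import Data.Vec.Base using (Vec; []; _∷_)
open import Data.Vec.Functional using (Vector)
import Data.Vec.Properties as Vec
open import Function.Base using (_∘_; id; case_of_)
open import Function.Bundles using (_⇔_; mk⇔)
open import Function.Definitions using (Injective)
open import Level using (_⊔_; Lift; lift; lower)
open import Relation.Binary.Definitions using (Decidable; WeaklyDecidable; tri<; tri≈; tri>)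
open import Relation.Binary.PropositionalEquality.Core as ≡ using (_≡_)
import Relation.Binary.Reasoning.Setoid
open import Relation.Nullary.Decidable.Core using (Dec; yes; no; ¬?)
open import Relation.Nullary.Negation.Core using (¬_; contradiction)
open import Relation.Unary using (Pred; _∈_; _∉_; _⊆_; _⊂_; _≐_; _∩_; U) renaming (Decidable to Decidable₁)

-- Scaling transversally to a flat X and translating along X multiplies every
-- α_L with X ⊆ L by one common parameter.  Hence J_{A_X} is stable under these
-- substitutions, and every element outside P_X is a nonzerodivisor modulo
-- J_{A_X}.  Up to factors outside P_X (products of forms not vanishing on X),
-- J_A and J_{A_X} contain each other.  Given a prime P ⊇ J_A, applying this to
-- the flat X cut out by the α_L ∈ P yields (1) and (2).
-- For (3), maximality of X shows that all primes over J = J_{A_X} contain P_X,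
-- so S̄/J has the dimension of S̄/P_X = K[y₁,…,y_e]; that this is e follows
-- because e + 1 polynomials in e variables are algebraically dependent.  By the
-- graded Nakayama lemma, J needs dim J/𝔪J generators.  A basis of Ω¹(A_X) has
-- at most ℓ elements and its residues generate J; for L ≠ H in A_X the forms
-- dα_L/α_L, dy₁, …, dy_e have residue zero and are independent modulo 𝔪, as
-- their pairings with the Euler derivation and the ∂/∂y_j show.  So
-- ℓ - 1 - e generators suffice.

-- Coefficients are differences of natural numbers, so that cancellation is
-- decided without assuming decidable equality in R.
module RingSolver {c ℓ} (R : CommutativeRing c ℓ) where

  open CommutativeRing R hiding (zero)
  open Algebra.Properties.Ring ring using (-‿+-comm; -0#≈0#; [y-z]x≈yx-zx; x[y-z]≈xy-xz; -‿involutive)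
  open Algebra.Properties.Semiring.Mult semiring using (×-homo-+; ×1-homo-*) renaming (_×_ to _·_)
  open import Algebra.Properties.CommutativeSemigroup +-commutativeSemigroup using (interchange)

  private
    num : ℕ → Carrier
    num n = n · 1#

    -- Chosen so that (0 , 0) and (1 , 0) denote 0# and 1# on the nose.
    value : ℕ × ℕ → Carrier
    value (0 , 0) = 0#
    value (1 , 0) = 1#
    value (a , b) = num a - num b

    reduce : ℕ × ℕ → ℕ × ℕ
    reduce (a     , 0)     = a , 0
    reduce (0     , b)     = 0 , b
    reduce (suc a , suc b) = reduce (a , b)

    coefficients : RawRing _ _
    coefficients = record
      { Carrier = ℕ × ℕ
      ; _≈_ = _≡_
      ; _+_ = λ { (a , b) (c , d) → reduce (a ℕ.+ c , b ℕ.+ d) }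
      ; _*_ = λ { (a , b) (c , d) → reduce (a ℕ.* c ℕ.+ b ℕ.* d , a ℕ.* d ℕ.+ b ℕ.* c) }
      ; -_  = λ { (a , b) → b , a }
      ; 0#  = 0 , 0
      ; 1#  = 1 , 0
      }

    open Relation.Binary.Reasoning.Setoid setoid

    sub-+ : ∀ a b c d → (a - b) + (c - d) ≈ (a + c) - (b + d)
    sub-+ a b c d = trans (interchange a (- b) c (- d)) (+-congˡ (-‿+-comm b d))

    neg-sub : ∀ a b → - (a - b) ≈ b - a
    neg-sub a b = begin
      - (a - b)     ≈⟨ -‿+-comm a (- b) ⟨
      - a + - - b   ≈⟨ +-congˡ (-‿involutive b) ⟩
      - a + b       ≈⟨ +-comm _ _ ⟩
      b - a         ∎

    sub-* : ∀ a b c d → (a - b) * (c - d) ≈ (a * c + b * d) - (a * d + b * c)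
    sub-* a b c d = begin
      (a - b) * (c - d)                      ≈⟨ [y-z]x≈yx-zx (c - d) a b ⟩
      a * (c - d) - b * (c - d)              ≈⟨ +-cong (x[y-z]≈xy-xz a c d) (-‿cong (x[y-z]≈xy-xz b c d)) ⟩
      (a * c - a * d) - (b * c - b * d)      ≈⟨ +-congˡ (neg-sub _ _) ⟩
      (a * c - a * d) + (b * d - b * c)      ≈⟨ sub-+ _ _ _ _ ⟩
      (a * c + b * d) - (a * d + b * c)      ∎

    cancel : ∀ {a b c d} → a + d ≈ c + b → a - b ≈ c - d
    cancel {a} {b} {c} {d} e = begin
      a - b                    ≈⟨ +-identityʳ _ ⟨
      (a - b) + 0#             ≈⟨ +-congˡ (-‿inverseʳ d) ⟨
      (a - b) + (d - d)        ≈⟨ sub-+ _ _ _ _ ⟩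
      (a + d) - (b + d)        ≈⟨ +-cong e (-‿cong (+-comm b d)) ⟩
      (c + b) - (d + b)        ≈⟨ sub-+ _ _ _ _ ⟨
      (c - d) + (b - b)        ≈⟨ +-congˡ (-‿inverseʳ b) ⟩
      (c - d) + 0#             ≈⟨ +-identityʳ _ ⟩
      c - d                    ∎

    num-+* : ∀ a b c d → num (a ℕ.* b ℕ.+ c ℕ.* d) ≈ num a * num b + num c * num d
    num-+* a b c d = trans (×-homo-+ 1# (a ℕ.* b) (c ℕ.* d)) (+-cong (×1-homo-* a b) (×1-homo-* c d))

    value-sub : ∀ a b → value (a , b) ≈ num a - num b
    value-sub 0             0       = sym (-‿inverseʳ 0#)
    value-sub 1             0       = sym (trans (+-cong (+-identityʳ 1#) -0#≈0#) (+-identityʳ 1#))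
    value-sub (suc (suc a)) 0       = refl
    value-sub 0             (suc b) = refl
    value-sub 1             (suc b) = refl
    value-sub (suc (suc a)) (suc b) = refl

    reduce-sub : ∀ a b → value (reduce (a , b)) ≈ num a - num b
    reduce-sub a       0       = value-sub a 0
    reduce-sub 0       (suc b) = value-sub 0 (suc b)
    reduce-sub (suc a) (suc b) = trans (reduce-sub a b) (cancel (begin
      num a + (1# + num b)  ≈⟨ +-assoc _ _ _ ⟨
      (num a + 1#) + num b  ≈⟨ +-congʳ (+-comm _ _) ⟩
      (1# + num a) + num b  ∎))

    morphism : coefficients -Raw-AlmostCommutative⟶ fromCommutativeRing R
    morphism = record
      { ⟦_⟧    = value
      ; +-homo = λ { (a , b) (c , d) → trans (reduce-sub (a ℕ.+ c) (b ℕ.+ d))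
          (trans (+-cong (×-homo-+ 1# a c) (-‿cong (×-homo-+ 1# b d)))
            (trans (sym (sub-+ _ _ _ _)) (sym (+-cong (value-sub a b) (value-sub c d))))) }
      ; *-homo = λ { (a , b) (c , d) →
          trans (reduce-sub (a ℕ.* c ℕ.+ b ℕ.* d) (a ℕ.* d ℕ.+ b ℕ.* c))
          (trans (+-cong (num-+* a c b d) (-‿cong (num-+* a d b c)))
            (trans (sym (sub-* _ _ _ _)) (sym (*-cong (value-sub a b) (value-sub c d))))) }
      ; -‿homo = λ { (a , b) → trans (value-sub b a) (trans (sym (neg-sub _ _)) (sym (-‿cong (value-sub a b)))) }
      ; 0-homo = refl
      ; 1-homo = refl
      }

    _≟ᶜ_ : WeaklyDecidable (Induced-equivalence morphism)
    (a , b) ≟ᶜ (c , d) with (a ℕ.+ d) ℕ.≟ (c ℕ.+ b)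
    ... | yes e = just (trans (value-sub a b) (trans (cancel (trans (sym (×-homo-+ 1# a d))
                    (trans (reflexive (≡.cong num e)) (×-homo-+ 1# c b)))) (sym (value-sub c d))))
    ... | no _  = nothing

  open Algebra.Solver.Ring coefficients (fromCommutativeRing R) morphism _≟ᶜ_
    public using (solve; _:=_; _:+_; _:*_; _:-_; :-_; con) renaming (Polynomial to Expr)

  :0 :1 : ∀ {n} → Expr n
  :0 = con (0 , 0)
  :1 = con (1 , 0)

module RingKit {c ℓ} (R : CommutativeRing c ℓ) where

  open CommutativeRing R hiding (zero)
  open Algebra.Properties.Ring ring using (-0#≈0#; -‿+-comm; -‿distribˡ-*)
  open Algebra.Properties.Semiring.Sum semiring public
    using (sum-cong-≋; ∑-distrib-+; ∑-comm; *-distribˡ-sum; *-distribʳ-sum; sum-remove; sum-replicate-zero)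
    renaming (sum to ∑)
  open RingSolver R public

  ∑-zero : ∀ {n} {f : Vector Carrier n} → (∀ i → f i ≈ 0#) → ∑ f ≈ 0#
  ∑-zero {n} z = trans (sum-cong-≋ z) (sum-replicate-zero n)

  ∑-neg : ∀ {n} (f : Vector Carrier n) → ∑ (λ i → - f i) ≈ - ∑ f
  ∑-neg {zero}  f = sym -0#≈0#
  ∑-neg {suc n} f = trans (+-congˡ (∑-neg (f ∘ suc))) (-‿+-comm _ _)

  δ : ∀ {n} → Fin n → Fin n → Carrier
  δ zero    zero    = 1#
  δ zero    (suc j) = 0#
  δ (suc i) zero    = 0#
  δ (suc i) (suc j) = δ i j

  δ-diag : ∀ {n} (i : Fin n) → δ i i ≈ 1#
  δ-diag zero    = refl
  δ-diag (suc i) = δ-diag i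

  δ-off : ∀ {n} {i j : Fin n} → ¬ i ≡ j → δ i j ≈ 0#
  δ-off {i = zero}  {zero}  i≢j = contradiction ≡.refl i≢j
  δ-off {i = zero}  {suc j} i≢j = refl
  δ-off {i = suc i} {zero}  i≢j = refl
  δ-off {i = suc i} {suc j} i≢j = δ-off {i = i} (i≢j ∘ ≡.cong suc)

  δ-sym : ∀ {n} (i j : Fin n) → δ i j ≈ δ j i
  δ-sym zero    zero    = refl
  δ-sym zero    (suc j) = refl
  δ-sym (suc i) zero    = refl
  δ-sym (suc i) (suc j) = δ-sym i j

  ∑-δ : ∀ {n} (i : Fin n) (f : Vector Carrier n) → ∑ (λ j → δ i j * f j) ≈ f i
  ∑-δ zero    f = trans (+-cong (*-identityˡ _) (∑-zero (λ j → zeroˡ (f (suc j))))) (+-identityʳ _)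
  ∑-δ (suc i) f = trans (+-cong (zeroˡ _) (∑-δ i (f ∘ suc))) (+-identityˡ _)

  infix 9 _∙_
  _∙_ : ∀ {n} → Vector Carrier n → Vector Carrier n → Carrier
  u ∙ v = ∑ (λ i → u i * v i)

  ∙-cong : ∀ {n} {u u′ v v′ : Vector Carrier n} → (∀ i → u i ≈ u′ i) → (∀ i → v i ≈ v′ i) → u ∙ v ≈ u′ ∙ v′
  ∙-cong e f = sum-cong-≋ (λ i → *-cong (e i) (f i))

  ∙-comm : ∀ {n} (u v : Vector Carrier n) → u ∙ v ≈ v ∙ u
  ∙-comm u v = sum-cong-≋ (λ i → *-comm (u i) (v i))

  ∙-δ : ∀ {n} (u : Vector Carrier n) i → u ∙ δ i ≈ u i
  ∙-δ u i = trans (∙-comm u (δ i)) (∑-δ i u)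

  ∙-+ˡ : ∀ {n} (u u′ v : Vector Carrier n) → (λ i → u i + u′ i) ∙ v ≈ u ∙ v + u′ ∙ v
  ∙-+ˡ u u′ v = trans (sum-cong-≋ (λ i → distribʳ (v i) (u i) (u′ i))) (∑-distrib-+ (λ i → u i * v i) (λ i → u′ i * v i))

  ∙-*ˡ : ∀ {n} a (u v : Vector Carrier n) → (λ i → a * u i) ∙ v ≈ a * u ∙ v
  ∙-*ˡ a u v = trans (sum-cong-≋ (λ i → *-assoc a (u i) (v i))) (sym (*-distribˡ-sum a (λ i → u i * v i)))

  ∙-negˡ : ∀ {n} (u v : Vector Carrier n) → (λ i → - u i) ∙ v ≈ - u ∙ v
  ∙-negˡ u v = trans (sum-cong-≋ (λ i → sym (-‿distribˡ-* (u i) (v i)))) (∑-neg (λ i → u i * v i))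

  ∙-zeroˡ : ∀ {n} {u : Vector Carrier n} (v : Vector Carrier n) → (∀ i → u i ≈ 0#) → u ∙ v ≈ 0#
  ∙-zeroˡ v z = ∑-zero (λ i → trans (*-congʳ (z i)) (zeroˡ (v i)))

  ∙-+ʳ : ∀ {n} (u v v′ : Vector Carrier n) → u ∙ (λ i → v i + v′ i) ≈ u ∙ v + u ∙ v′
  ∙-+ʳ u v v′ = trans (∙-comm u _) (trans (∙-+ˡ v v′ u) (+-cong (∙-comm v u) (∙-comm v′ u)))

  ∙-*ʳ : ∀ {n} a (u v : Vector Carrier n) → u ∙ (λ i → a * v i) ≈ a * u ∙ v
  ∙-*ʳ a u v = trans (∙-comm u _) (trans (∙-*ˡ a v u) (*-congˡ (∙-comm v u)))

  ∙-negʳ : ∀ {n} (u v : Vector Carrier n) → u ∙ (λ i → - v i) ≈ - u ∙ v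
  ∙-negʳ u v = trans (∙-comm u _) (trans (∙-negˡ v u) (-‿cong (∙-comm v u)))

  ∙-∑ : ∀ {m n} (a : Vector Carrier m) (B : Fin m → Vector Carrier n) (v : Vector Carrier n) →
        (λ j → ∑ (λ i → a i * B i j)) ∙ v ≈ a ∙ (λ i → B i ∙ v)
  ∙-∑ a B v = trans (sum-cong-≋ (λ j → *-distribʳ-sum (v j) (λ i → a i * B i j)))
    (trans (∑-comm (λ j i → (a i * B i j) * v j))
      (sum-cong-≋ (λ i → ∙-*ˡ (a i) (B i) v)))

  x-0≈x : ∀ x → x - 0# ≈ x
  x-0≈x = solve 1 (λ x → x :- :0 := x) refl

  x-y≈0⇒x≈y : ∀ {x y} → x - y ≈ 0# → x ≈ y
  x-y≈0⇒x≈y {x} {y} e = trans (solve 2 (λ x y → x := (x :- y) :+ y) refl x y) (trans (+-congʳ e) (+-identityˡ y))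

  x≈y⇒x-y≈0 : ∀ {x y} → x ≈ y → x - y ≈ 0#
  x≈y⇒x-y≈0 {x} {y} e = trans (+-congʳ e) (-‿inverseʳ y)

record Hom {a ℓa b ℓb} (A : CommutativeRing a ℓa) (B : CommutativeRing b ℓb) : Set (a ⊔ ℓa ⊔ b ⊔ ℓb) where
  private
    module A = CommutativeRing A
    module B = CommutativeRing B
  field
    ⟦_⟧    : A.Carrier → B.Carrier
    cong   : ∀ {x y} → x A.≈ y → ⟦ x ⟧ B.≈ ⟦ y ⟧
    +-homo : ∀ x y → ⟦ x A.+ y ⟧ B.≈ ⟦ x ⟧ B.+ ⟦ y ⟧
    *-homo : ∀ x y → ⟦ x A.* y ⟧ B.≈ ⟦ x ⟧ B.* ⟦ y ⟧
    0-homo : ⟦ A.0# ⟧ B.≈ B.0#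
    1-homo : ⟦ A.1# ⟧ B.≈ B.1#

  neg-homo : ∀ x → ⟦ A.- x ⟧ B.≈ B.- ⟦ x ⟧
  neg-homo x = B.trans (solve 2 (λ u v → u := (u :+ v) :- v) B.refl ⟦ A.- x ⟧ ⟦ x ⟧)
    (B.trans (B.+-congʳ (B.trans (B.sym (+-homo _ _)) (B.trans (cong (A.-‿inverseˡ x)) 0-homo)))
      (B.+-identityˡ _))
    where open RingSolver B

  sub-homo : ∀ x y → ⟦ x A.- y ⟧ B.≈ ⟦ x ⟧ B.- ⟦ y ⟧
  sub-homo x y = B.trans (+-homo _ _) (B.+-congˡ (neg-homo y))

  ∑-homo : ∀ {n} (f : Vector A.Carrier n) → ⟦ RingKit.∑ A f ⟧ B.≈ RingKit.∑ B (λ i → ⟦ f i ⟧)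
  ∑-homo {zero}  f = 0-homo
  ∑-homo {suc n} f = B.trans (+-homo _ _) (B.+-congˡ (∑-homo (f ∘ suc)))

  ∙-homo : ∀ {n} (u v : Vector A.Carrier n) →
           ⟦ RingKit._∙_ A u v ⟧ B.≈ RingKit._∙_ B (λ i → ⟦ u i ⟧) (λ i → ⟦ v i ⟧)
  ∙-homo u v = B.trans (∑-homo (λ i → u i A.* v i)) (RingKit.sum-cong-≋ B (λ i → *-homo (u i) (v i)))

  δ-homo : ∀ {n} (i j : Fin n) → ⟦ RingKit.δ A i j ⟧ B.≈ RingKit.δ B i j
  δ-homo zero    zero    = 1-homo
  δ-homo zero    (suc j) = 0-homo
  δ-homo (suc i) zero    = 0-homo
  δ-homo (suc i) (suc j) = δ-homo i j

idHom : ∀ {a ℓa} {A : CommutativeRing a ℓa} → Hom A A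
idHom {A = A} = record
  { ⟦_⟧ = id ; cong = id ; +-homo = λ _ _ → refl ; *-homo = λ _ _ → refl ; 0-homo = refl ; 1-homo = refl }
  where open CommutativeRing A

infixr 9 _∘ᴴ_
_∘ᴴ_ : ∀ {a ℓa b ℓb c ℓc} {A : CommutativeRing a ℓa} {B : CommutativeRing b ℓb} {C : CommutativeRing c ℓc} →
       Hom B C → Hom A B → Hom A C
_∘ᴴ_ {C = C} g f = record
  { ⟦_⟧    = λ x → g.⟦ f.⟦ x ⟧ ⟧
  ; cong   = λ e → g.cong (f.cong e)
  ; +-homo = λ x y → trans (g.cong (f.+-homo x y)) (g.+-homo _ _)
  ; *-homo = λ x y → trans (g.cong (f.*-homo x y)) (g.*-homo _ _)
  ; 0-homo = trans (g.cong f.0-homo) g.0-homo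
  ; 1-homo = trans (g.cong f.1-homo) g.1-homo
  }
  where
  open CommutativeRing C
  module g = Hom g
  module f = Hom f

module PolyKit {c ℓ} (R : CommutativeRing c ℓ) where

  open CommutativeRing R hiding (zero)
  open Polynomial R public

  C-* : ∀ a p → C a ⊗ p ≋ scale a p
  C-* a p = ≋-trans (⊕-cong (≋-refl {scale a p}) 0∷[]) (⊕-identityʳ (scale a p))

  X-* : ∀ p → X ⊗ p ≋ 0# ∷ p
  X-* p = ≋-trans (shift-⊗ (C 1#) p) (∷-cong refl (⊗-identityˡ p))

  C+0∷ : ∀ a p → C a ⊕ (0# ∷ p) ≋ a ∷ p
  C+0∷ a p = ∷-cong (+-identityʳ a) ≋-refl

  C+X* : ∀ a p → C a ⊕ X ⊗ p ≋ a ∷ p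
  C+X* a p = ≋-trans (⊕-cong (≋-refl {C a}) (X-* p)) (C+0∷ a p)

  tail-≋ : ∀ {a b p q} → (a ∷ p) ≋ (b ∷ q) → p ≋ q
  tail-≋ e = eq λ n → at e (suc n)

  CHom : Hom R polynomialRing
  CHom = record
    { ⟦_⟧    = C
    ; cong   = λ e → ∷-cong e ≋-refl
    ; +-homo = λ _ _ → ≋-refl
    ; *-homo = λ a b → ≋-sym (C-* a (C b))
    ; 0-homo = 0∷[]
    ; 1-homo = ≋-refl
    }

  coeff-C* : ∀ a p n → coeff (C a ⊗ p) n ≈ a * coeff p n
  coeff-C* a p n = trans (at (C-* a p) n) (coeff-scale a p n)

  coeff-X* : ∀ p n → coeff (X ⊗ p) (suc n) ≈ coeff p n
  coeff-X* p n = at (X-* p) (suc n)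

  shift : ℕ → Poly → Poly
  shift zero    p = p
  shift (suc k) p = 0# ∷ shift k p

  coeff-shift : ∀ k a → coeff (shift k (C a)) k ≡ a
  coeff-shift zero    a = ≡.refl
  coeff-shift (suc k) a = coeff-shift k a

  coeff-shift-off : ∀ k j a → ¬ j ≡ k → coeff (shift k (C a)) j ≡ 0#
  coeff-shift-off zero    zero    a j≢k = contradiction ≡.refl j≢k
  coeff-shift-off zero    (suc j) a j≢k = ≡.refl
  coeff-shift-off (suc k) zero    a j≢k = ≡.refl
  coeff-shift-off (suc k) (suc j) a j≢k = coeff-shift-off k j a (j≢k ∘ ≡.cong suc)

  head-tail : ∀ p → p ≋ coeff p 0 ∷ List.drop 1 p
  head-tail []      = ≋-sym 0∷[]
  head-tail (a ∷ p) = ≋-refl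

  coeff-∈ : ∀ p n → coeff p n ∈ˡ p ⊎ coeff p n ≡ 0#
  coeff-∈ []      n       = inj₂ ≡.refl
  coeff-∈ (a ∷ p) zero    = inj₁ (here ≡.refl)
  coeff-∈ (a ∷ p) (suc n) = [ inj₁ ∘ there , inj₂ ]′ (coeff-∈ p n)

  ∈-coeff : ∀ {a p} → a ∈ˡ p → ∃ λ n → a ≡ coeff p n
  ∈-coeff (here e)  = 0 , e
  ∈-coeff (there i) = let n , e = ∈-coeff i in suc n , e

  coeff-⊗ : ∀ {i} (I : Pred Carrier i) → (∀ {x y} → x ≈ y → x ∈ I → y ∈ I) → 0# ∈ I →
            (∀ {x y} → x ∈ I → y ∈ I → x + y ∈ I) →
            ∀ p q n → (∀ i j → i ℕ.+ j ≡ n → coeff p i * coeff q j ∈ I) → coeff (p ⊗ q) n ∈ I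
  coeff-⊗ I r z a []      q n       t = z
  coeff-⊗ I r z a (b ∷ p) q zero    t =
    r (sym (trans (coeff-⊕ (scale b q) (0# ∷ (p ⊗ q)) 0) (trans (+-identityʳ _) (coeff-scale b q 0)))) (t 0 0 ≡.refl)
  coeff-⊗ I r z a (b ∷ p) q (suc n) t =
    r (sym (coeff-⊕ (scale b q) (0# ∷ (p ⊗ q)) (suc n)))
      (a (r (sym (coeff-scale b q (suc n))) (t 0 (suc n) ≡.refl))
         (coeff-⊗ I r z a p q n (λ i j e → t (suc i) j (≡.cong suc e))))

  coeff₀Hom : Hom polynomialRing R
  coeff₀Hom = record
    { ⟦_⟧    = λ p → coeff p 0
    ; cong   = λ e → at e 0
    ; +-homo = λ p q → coeff-⊕ p q 0
    ; *-homo = λ { [] q → sym (zeroˡ _)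
                 ; (a ∷ p) q → trans (coeff-⊕ (scale a q) (0# ∷ (p ⊗ q)) 0)
                                 (trans (+-identityʳ _) (coeff-scale a q 0)) }
    ; 0-homo = refl
    ; 1-homo = refl
    }

  module _ {m ℓm} {M : CommutativeRing m ℓm} (h : Hom R M) (x : CommutativeRing.Carrier M) where
    private
      module M = CommutativeRing M
      module h = Hom h
    open RingSolver M
    open Relation.Binary.Reasoning.Setoid M.setoid

    eval : Poly → M.Carrier
    eval []      = M.0#
    eval (a ∷ p) = h.⟦ a ⟧ M.+ x M.* eval p

    eval-zero : ∀ p → p ≋ [] → eval p M.≈ M.0#
    eval-zero []      e = M.refl
    eval-zero (a ∷ p) e = M.trans
      (M.+-cong (M.trans (h.cong (at e 0)) h.0-homo) (M.trans (M.*-congˡ (eval-zero p (eq λ n → at e (suc n)))) (M.zeroʳ x)))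
      (M.+-identityˡ _)

    eval-cong : ∀ {p q} → p ≋ q → eval p M.≈ eval q
    eval-cong {[]}    {q}     e = M.sym (eval-zero q (≋-sym e))
    eval-cong {a ∷ p} {[]}    e = eval-zero (a ∷ p) e
    eval-cong {a ∷ p} {b ∷ q} e = M.+-cong (h.cong (at e 0)) (M.*-congˡ (eval-cong {p} {q} (tail-≋ e)))

    eval-⊕ : ∀ p q → eval (p ⊕ q) M.≈ eval p M.+ eval q
    eval-⊕ []      q       = M.sym (M.+-identityˡ _)
    eval-⊕ (a ∷ p) []      = M.sym (M.+-identityʳ _)
    eval-⊕ (a ∷ p) (b ∷ q) = begin
      h.⟦ a + b ⟧ M.+ x M.* eval (p ⊕ q)  ≈⟨ M.+-cong (h.+-homo a b) (M.*-congˡ (eval-⊕ p q)) ⟩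
      (h.⟦ a ⟧ M.+ h.⟦ b ⟧) M.+ x M.* (eval p M.+ eval q)
        ≈⟨ solve 5 (λ a b x p q → (a :+ b) :+ x :* (p :+ q) := (a :+ x :* p) :+ (b :+ x :* q)) M.refl
             h.⟦ a ⟧ h.⟦ b ⟧ x (eval p) (eval q) ⟩
      (h.⟦ a ⟧ M.+ x M.* eval p) M.+ (h.⟦ b ⟧ M.+ x M.* eval q) ∎

    eval-scale : ∀ a p → eval (scale a p) M.≈ h.⟦ a ⟧ M.* eval p
    eval-scale a []      = M.sym (M.zeroʳ _)
    eval-scale a (b ∷ p) = begin
      h.⟦ a * b ⟧ M.+ x M.* eval (scale a p) ≈⟨ M.+-cong (h.*-homo a b) (M.*-congˡ (eval-scale a p)) ⟩
      h.⟦ a ⟧ M.* h.⟦ b ⟧ M.+ x M.* (h.⟦ a ⟧ M.* eval p)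
        ≈⟨ solve 4 (λ a b x p → a :* b :+ x :* (a :* p) := a :* (b :+ x :* p)) M.refl h.⟦ a ⟧ h.⟦ b ⟧ x (eval p) ⟩
      h.⟦ a ⟧ M.* (h.⟦ b ⟧ M.+ x M.* eval p) ∎

    eval-0∷ : ∀ p → eval (0# ∷ p) M.≈ x M.* eval p
    eval-0∷ p = M.trans (M.+-congʳ h.0-homo) (M.+-identityˡ _)

    eval-⊗ : ∀ p q → eval (p ⊗ q) M.≈ eval p M.* eval q
    eval-⊗ []      q = M.sym (M.zeroˡ _)
    eval-⊗ (a ∷ p) q = begin
      eval (scale a q ⊕ (0# ∷ (p ⊗ q)))               ≈⟨ eval-⊕ (scale a q) (0# ∷ (p ⊗ q)) ⟩
      eval (scale a q) M.+ eval (0# ∷ (p ⊗ q))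
        ≈⟨ M.+-cong (eval-scale a q) (M.trans (eval-0∷ (p ⊗ q)) (M.*-congˡ (eval-⊗ p q))) ⟩
      h.⟦ a ⟧ M.* eval q M.+ x M.* (eval p M.* eval q)
        ≈⟨ solve 4 (λ a q x p → a :* q :+ x :* (p :* q) := (a :+ x :* p) :* q) M.refl h.⟦ a ⟧ (eval q) x (eval p) ⟩
      (h.⟦ a ⟧ M.+ x M.* eval p) M.* eval q            ∎

    eval-C : ∀ a → eval (C a) M.≈ h.⟦ a ⟧
    eval-C a = M.trans (M.+-congˡ (M.zeroʳ x)) (M.+-identityʳ _)

    eval-X : eval X M.≈ x
    eval-X = M.trans (eval-0∷ (C 1#)) (M.trans (M.*-congˡ (M.trans (eval-C 1#) h.1-homo)) (M.*-identityʳ x))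

    evalHom : Hom polynomialRing M
    evalHom = record
      { ⟦_⟧ = eval ; cong = λ {p} {q} → eval-cong {p} {q} ; +-homo = eval-⊕ ; *-homo = eval-⊗
      ; 0-homo = M.refl ; 1-homo = M.trans (eval-C 1#) h.1-homo }

module MvPolyKit {c ℓ} (R : CommutativeRing c ℓ) where

  open CommutativeRing R hiding (zero)
  open PolyKit using (C+X*; CHom; C-*; eval-C; eval-X; evalHom)

  constHom : ∀ n → Hom R (MvPoly R n)
  constHom n = record
    { ⟦_⟧ = const R {n} ; cong = cong n ; +-homo = add n ; *-homo = mul n ; 0-homo = null n ; 1-homo = one n }
    where
    cong : ∀ n {x y} → x ≈ y → CommutativeRing._≈_ (MvPoly R n) (const R {n} x) (const R {n} y)
    cong zero    e = e
    cong (suc n) e = Hom.cong (CHom (MvPoly R n)) (cong n e)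
    add : ∀ n x y → CommutativeRing._≈_ (MvPoly R n) (const R {n} (x + y)) (CommutativeRing._+_ (MvPoly R n) (const R {n} x) (const R {n} y))
    add zero    x y = refl
    add (suc n) x y = Hom.cong (CHom (MvPoly R n)) (add n x y)
    mul : ∀ n x y → CommutativeRing._≈_ (MvPoly R n) (const R {n} (x * y)) (CommutativeRing._*_ (MvPoly R n) (const R {n} x) (const R {n} y))
    mul zero    x y = refl
    mul (suc n) x y = P.≋-trans (Hom.cong (CHom (MvPoly R n)) (mul n x y)) (Hom.*-homo (CHom (MvPoly R n)) (const R {n} x) (const R {n} y))
      where module P = Polynomial (MvPoly R n)
    null : ∀ n → CommutativeRing._≈_ (MvPoly R n) (const R {n} 0#) (CommutativeRing.0# (MvPoly R n))
    null zero    = refl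
    null (suc n) = P.≋-trans (Hom.cong (CHom (MvPoly R n)) (null n)) (Hom.0-homo (CHom (MvPoly R n)))
      where module P = Polynomial (MvPoly R n)
    one : ∀ n → CommutativeRing._≈_ (MvPoly R n) (const R {n} 1#) (CommutativeRing.1# (MvPoly R n))
    one zero    = refl
    one (suc n) = Hom.cong (CHom (MvPoly R n)) (one n)

  generation : ∀ {p} n (Q : Pred (CommutativeRing.Carrier (MvPoly R n)) p) →
    let open CommutativeRing (MvPoly R n) renaming (_≈_ to _≈ₙ_; _+_ to _+ₙ_; _*_ to _*ₙ_) using () in
    (∀ {x y} → x ≈ₙ y → x ∈ Q → y ∈ Q) →
    (∀ {x y} → x ∈ Q → y ∈ Q → x +ₙ y ∈ Q) →
    (∀ {x y} → x ∈ Q → y ∈ Q → x *ₙ y ∈ Q) →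
    (∀ a → const R {n} a ∈ Q) → (∀ i → var R {n} i ∈ Q) → ∀ x → x ∈ Q
  generation zero    Q r a m k v x       = k x
  generation (suc n) Q r a m k v = all
    where
    module N = CommutativeRing (MvPoly R n)
    module P = Polynomial (MvPoly R n)

    constant : ∀ s → P.C s ∈ Q
    constant = generation n (Q ∘ P.C) (λ e → r (P.∷-cong e P.≋-refl)) a
      (λ {x} {y} p q → r (C-* (MvPoly R n) x (P.C y)) (m p q)) k (v ∘ suc)

    all : ∀ x → x ∈ Q
    all []      = r P.0∷[] (constant N.0#)
    all (s ∷ p) = r (C+X* (MvPoly R n) s p) (a (constant s) (m (v zero) (all p)))

  module _ {m ℓm} {M : CommutativeRing m ℓm} where
    private module M = CommutativeRing M

    evaluate : Hom R M → ∀ {n} → Vector M.Carrier n → Hom (MvPoly R n) M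
    evaluate h {zero}  x = h
    evaluate h {suc n} x = evalHom (MvPoly R n) (evaluate h (x ∘ suc)) (x zero)

    evaluate-const : ∀ h {n} (x : Vector M.Carrier n) a → Hom.⟦_⟧ (evaluate h x) (const R {n} a) M.≈ Hom.⟦_⟧ h a
    evaluate-const h {zero}  x a = M.refl
    evaluate-const h {suc n} x a = M.trans (eval-C (MvPoly R n) (evaluate h (x ∘ suc)) (x zero) _) (evaluate-const h (x ∘ suc) a)

    evaluate-var : ∀ h {n} (x : Vector M.Carrier n) i → Hom.⟦_⟧ (evaluate h x) (var R {n} i) M.≈ x i
    evaluate-var h {suc n} x zero    = eval-X (MvPoly R n) (evaluate h (x ∘ suc)) (x zero)
    evaluate-var h {suc n} x (suc i) = M.trans (eval-C (MvPoly R n) (evaluate h (x ∘ suc)) (x zero) _) (evaluate-var h (x ∘ suc) i)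

    hom-unique : ∀ {n} (f g : Hom (MvPoly R n) M) →
      (∀ a → Hom.⟦_⟧ f (const R {n} a) M.≈ Hom.⟦_⟧ g (const R {n} a)) →
      (∀ i → Hom.⟦_⟧ f (var R {n} i) M.≈ Hom.⟦_⟧ g (var R {n} i)) →
      ∀ x → Hom.⟦_⟧ f x M.≈ Hom.⟦_⟧ g x
    hom-unique {n} f g = generation n (λ x → f.⟦ x ⟧ M.≈ g.⟦ x ⟧)
      (λ e p → M.trans (f.cong (CommutativeRing.sym (MvPoly R n) e)) (M.trans p (g.cong e)))
      (λ p q → M.trans (f.+-homo _ _) (M.trans (M.+-cong p q) (M.sym (g.+-homo _ _))))
      (λ p q → M.trans (f.*-homo _ _) (M.trans (M.*-cong p q) (M.sym (g.*-homo _ _))))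
      where
      module f = Hom f
      module g = Hom g

-- Stated as a disjunction so that it passes to polynomial rings without
-- decidable equality.
Integral : ∀ {c ℓ} → CommutativeRing c ℓ → Set (c ⊔ ℓ)
Integral R = ∀ a → a ≈ 0# ⊎ (∀ b → a * b ≈ 0# → b ≈ 0#)
  where open CommutativeRing R

∀⊎∃ : ∀ {p q n} {P : Pred (Fin n) p} {Q : Pred (Fin n) q} → (∀ i → P i ⊎ Q i) → (∀ i → P i) ⊎ ∃ Q
∀⊎∃ {n = zero}  f = inj₁ λ ()
∀⊎∃ {n = suc n} f with f zero | ∀⊎∃ (f ∘ suc)
... | inj₂ q | _            = inj₂ (zero , q)
... | inj₁ p | inj₂ (i , q) = inj₂ (suc i , q)
... | inj₁ p | inj₁ ps      = inj₁ λ { zero → p ; (suc i) → ps i }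

module LinearDependence {c ℓ} (R : CommutativeRing c ℓ) (integral : Integral R)
  (1≉0 : ¬ CommutativeRing._≈_ R (CommutativeRing.1# R) (CommutativeRing.0# R)) where

  open CommutativeRing R hiding (zero)
  open RingKit R
  open import Data.Fin.Base using (punchIn)
  open import Data.Vec.Functional using (insertAt; removeAt)
  open import Data.Vec.Functional.Properties using (insertAt-lookup; insertAt-punchIn)
  open Relation.Binary.Reasoning.Setoid setoid

  dependent : ∀ n m → n ℕ.< m → (v : Fin m → Vector Carrier n) →
    ∃ λ (s : Vector Carrier m) → (∃ λ i → ¬ s i ≈ 0#) × (∀ k → s ∙ (λ i → v i k) ≈ 0#)
  dependent zero    (suc m) _             v = (λ _ → 1#) , (zero , 1≉0) , λ ()
  dependent (suc n) (suc m) (ℕ.s≤s n<m) v with ∀⊎∃ (λ i → integral (v i zero))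
  ... | inj₁ zeros with dependent n (suc m) (ℕ.m≤n⇒m≤1+n n<m) (λ i → v i ∘ suc)
  ...   | s , nonzero , relation = s , nonzero , λ
          { zero    → ∑-zero (λ i → trans (*-congˡ (zeros i)) (zeroʳ (s i)))
          ; (suc k) → relation k }
  dependent (suc n) (suc m) (ℕ.s≤s n<m) v | inj₂ (p , regular)
    with dependent n m n<m (λ i k → v p zero * v (punchIn p i) (suc k) - v (punchIn p i) zero * v p (suc k))
  ... | s , (i₀ , s≉0) , relation = t , (punchIn p i₀ , t≉0) , λ { zero → first ; (suc k) → rest k }
    where
    a = v p zero
    w = λ i → v (punchIn p i)
    b = s ∙ (λ i → w i zero)
    t = insertAt (λ i → a * s i) p (- b)

    t≉0 : ¬ t (punchIn p i₀) ≈ 0#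
    t≉0 e = s≉0 (regular (s i₀) (trans (reflexive (≡.sym (insertAt-punchIn (λ i → a * s i) p (- b) i₀))) e))

    expand : ∀ k → t ∙ (λ i → v i k) ≈ - b * v p k + a * s ∙ (λ i → w i k)
    expand k = begin
      t ∙ (λ i → v i k)
        ≈⟨ sum-remove {i = p} (λ i → t i * v i k) ⟩
      t p * v p k + ∑ (removeAt (λ i → t i * v i k) p)
        ≈⟨ +-cong (*-congʳ (reflexive (insertAt-lookup (λ i → a * s i) p (- b))))
                  (sum-cong-≋ (λ i → *-congʳ (reflexive (insertAt-punchIn (λ i → a * s i) p (- b) i)))) ⟩
      - b * v p k + (λ i → a * s i) ∙ (λ i → w i k)
        ≈⟨ +-congˡ (∙-*ˡ a s (λ i → w i k)) ⟩
      - b * v p k + a * s ∙ (λ i → w i k) ∎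

    first : t ∙ (λ i → v i zero) ≈ 0#
    first = trans (expand zero) (solve 2 (λ a b → :- b :* a :+ a :* b := :0) refl a b)

    rest : ∀ k → t ∙ (λ i → v i (suc k)) ≈ 0#
    rest k = begin
      t ∙ (λ i → v i (suc k))
        ≈⟨ expand (suc k) ⟩
      - b * v p (suc k) + a * s ∙ (λ i → w i (suc k))
        ≈⟨ solve 4 (λ b x a y → :- b :* x :+ a :* y := a :* y :+ :- (x :* b)) refl b (v p (suc k)) a _ ⟩
      a * s ∙ (λ i → w i (suc k)) + - (v p (suc k) * b)
        ≈⟨ +-cong (∙-*ʳ a s (λ i → w i (suc k))) (-‿cong (∙-*ʳ (v p (suc k)) s (λ i → w i zero))) ⟨
      s ∙ (λ i → a * w i (suc k)) + - s ∙ (λ i → v p (suc k) * w i zero)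
        ≈⟨ +-congˡ (∙-negʳ s (λ i → v p (suc k) * w i zero)) ⟨
      s ∙ (λ i → a * w i (suc k)) + s ∙ (λ i → - (v p (suc k) * w i zero))
        ≈⟨ ∙-+ʳ s (λ i → a * w i (suc k)) (λ i → - (v p (suc k) * w i zero)) ⟨
      s ∙ (λ i → a * w i (suc k) + - (v p (suc k) * w i zero))
        ≈⟨ ∙-cong (λ _ → refl) (λ i → +-congˡ (-‿cong (*-comm (v p (suc k)) (w i zero)))) ⟩
      s ∙ (λ i → a * w i (suc k) - w i zero * v p (suc k))
        ≈⟨ relation k ⟩
      0# ∎

module IdealKit {c ℓ} (R : CommutativeRing c ℓ) where

  open CommutativeRing R hiding (zero)
  open Ideals R using (IsIdeal)
  open RingKit R
  open Algebra.Properties.Ring ring using (-1*x≈-x)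

  Regular : ∀ {i} → Pred Carrier i → Pred Carrier _
  Regular I a = ∀ s → a * s ∈ I → s ∈ I

  module _ {i} {I : Pred Carrier i} (ideal : IsIdeal I) where

    open IsIdeal ideal

    I-mulʳ : ∀ {x} r → x ∈ I → x * r ∈ I
    I-mulʳ r p = I-resp (*-comm r _) (I-mul r p)

    I-neg : ∀ {x} → x ∈ I → - x ∈ I
    I-neg p = I-resp (-1*x≈-x _) (I-mul (- 1#) p)

    I-sub : ∀ {x y} → x ∈ I → y ∈ I → x - y ∈ I
    I-sub p q = I-add p (I-neg q)

    I-∑ : ∀ {n} {f : Vector Carrier n} → (∀ i → f i ∈ I) → ∑ f ∈ I
    I-∑ {zero}  p = I-zero
    I-∑ {suc n} p = I-add (p zero) (I-∑ (p ∘ suc))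

    I-cancel : ∀ {x y} → x + y ∈ I → x ∈ I → y ∈ I
    I-cancel {x} {y} p q = I-resp (solve 2 (λ x y → (x :+ y) :- x := y) refl x y) (I-sub p q)

    I-shift : ∀ {x y} → x - y ∈ I → y ∈ I → x ∈ I
    I-shift {x} {y} p q = I-resp (solve 2 (λ x y → (x :- y) :+ y := x) refl x y) (I-add p q)

    I-shift′ : ∀ {x y} → x - y ∈ I → x ∈ I → y ∈ I
    I-shift′ {x} {y} p q = I-resp (solve 2 (λ x y → x :- (x :- y) := y) refl x y) (I-sub q p)

  ≈0-isIdeal : IsIdeal (_≈ 0#)
  ≈0-isIdeal = record
    { I-resp = λ e p → trans (sym e) p
    ; I-zero = refl
    ; I-add  = λ p q → trans (+-cong p q) (+-identityˡ _)
    ; I-mul  = λ r p → trans (*-congˡ p) (zeroʳ r)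
    }

module PolyIdeal {c ℓ} (R : CommutativeRing c ℓ) where

  open CommutativeRing R hiding (zero)
  open Ideals R using (IsIdeal)
  open IdealKit R
  open PolyKit R
  private module 𝐑 = Ideals polynomialRing
  private module 𝐊 = IdealKit polynomialRing

  Coeffs : ∀ {i} → Pred Carrier i → Pred Poly i
  Coeffs I p = ∀ n → coeff p n ∈ I

  module _ {i} {I : Pred Carrier i} (ideal : IsIdeal I) where

    open IsIdeal ideal

    Coeffs-isIdeal : 𝐑.IsIdeal (Coeffs I)
    Coeffs-isIdeal = record
      { I-resp = λ e p n → I-resp (at e n) (p n)
      ; I-zero = λ n → I-zero
      ; I-add  = λ {x} {y} p q n → I-resp (sym (coeff-⊕ x y n)) (I-add (p n) (q n))
      ; I-mul  = λ r {x} p n → coeff-⊗ I I-resp I-zero I-add r x n (λ i j _ → I-mul _ (p j))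
      }

    regular-∷ : ∀ {a} p → Regular I a → 𝐊.Regular (Coeffs I) (a ∷ p)
    regular-∷         p reg []      _ = λ n → I-zero
    regular-∷ {a} p reg (b ∷ q) h = λ { zero → b∈I ; (suc n) → regular-∷ p reg q rest n }
      where
      b∈I : b ∈ I
      b∈I = reg b (I-resp (+-identityʳ _) (h 0))

      rest : Coeffs I ((a ∷ p) ⊗ q)
      rest n = I-cancel ideal
        (I-resp (trans (at (⊗-∷ (a ∷ p) b q) (suc n)) (coeff-⊕ (scale b (a ∷ p)) (0# ∷ ((a ∷ p) ⊗ q)) (suc n))) (h (suc n)))
        (I-resp (sym (coeff-scale b (a ∷ p) (suc n))) (I-mulʳ ideal _ b∈I))

    regular-0∷ : ∀ {a} p → a ≈ 0# → 𝐊.Regular (Coeffs I) p → 𝐊.Regular (Coeffs I) (a ∷ p)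
    regular-0∷ {a} p a≈0 reg q h = reg q λ n →
      I-resp (at (≋-trans (⊗-cong (∷-cong a≈0 (≋-refl {p})) (≋-refl {q})) (shift-⊗ p q)) (suc n)) (h (suc n))

    regular-cong : ∀ p q → p ≋ q → 𝐊.Regular (Coeffs I) p → 𝐊.Regular (Coeffs I) q
    regular-cong p q e reg s h = reg s λ n → I-resp (sym (at (⊗-cong e (≋-refl {s})) n)) (h n)

  integral-poly : Integral R → Integral polynomialRing
  integral-poly int []      = inj₁ ≋-refl
  integral-poly int (a ∷ p) with int a
  ... | inj₂ reg = inj₂ λ q e → eq (regular-∷ ≈0-isIdeal p reg q (at e))
  ... | inj₁ a≈0 with integral-poly int p
  ...   | inj₁ p≋[] = inj₁ (≋-trans (∷-cong a≈0 p≋[]) 0∷[])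
  ...   | inj₂ reg  = inj₂ λ q e → eq (regular-0∷ ≈0-isIdeal p a≈0 (λ s z → at (reg s (eq z))) q (at e))

integral-MvPoly : ∀ {c ℓ} {R : CommutativeRing c ℓ} → Integral R → ∀ n → Integral (MvPoly R n)
integral-MvPoly int zero    = int
integral-MvPoly int (suc n) = PolyIdeal.integral-poly (MvPoly _ n) (integral-MvPoly int n)

module _ {b ℓb} {B : CommutativeRing b ℓb} {i} {I : Pred (CommutativeRing.Carrier B) i} (ideal : Ideals.IsIdeal B I) where

  Extension : ∀ n → Pred (CommutativeRing.Carrier (MvPoly B n)) i
  Extension zero    = I
  Extension (suc n) = PolyIdeal.Coeffs (MvPoly B n) (Extension n)

  Extension-isIdeal : ∀ n → Ideals.IsIdeal (MvPoly B n) (Extension n)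
  Extension-isIdeal zero    = ideal
  Extension-isIdeal (suc n) = PolyIdeal.Coeffs-isIdeal (MvPoly B n) (Extension-isIdeal n)

module _ {a ℓa b ℓb} {A : CommutativeRing a ℓa} {B : CommutativeRing b ℓb} (h : Hom A B) where

  private
    module h = Hom h

  mapMv : ∀ n → Hom (MvPoly A n) (MvPoly B n)
  mapMv zero    = h
  mapMv (suc n) = PolyKit.evalHom (MvPoly A n) (PolyKit.CHom (MvPoly B n) ∘ᴴ mapMv n) (Polynomial.X (MvPoly B n))

  mapMv-const : ∀ n a → CommutativeRing._≈_ (MvPoly B n) (Hom.⟦_⟧ (mapMv n) (const A {n} a)) (const B {n} h.⟦ a ⟧)
  mapMv-const zero    a = CommutativeRing.refl B
  mapMv-const (suc n) a = ≋-trans (PolyKit.eval-C (MvPoly A n) (CHom ∘ᴴ mapMv n) X (const A {n} a))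
    (∷-cong (mapMv-const n a) ≋-refl)
    where open PolyKit (MvPoly B n)

  mapMv-var : ∀ n i → CommutativeRing._≈_ (MvPoly B n) (Hom.⟦_⟧ (mapMv n) (var A {n} i)) (var B {n} i)
  mapMv-var (suc n) zero    = PolyKit.eval-X (MvPoly A n) (PolyKit.CHom (MvPoly B n) ∘ᴴ mapMv n) _
  mapMv-var (suc n) (suc i) = ≋-trans (PolyKit.eval-C (MvPoly A n) (CHom ∘ᴴ mapMv n) X (var A i))
    (∷-cong (mapMv-var n i) ≋-refl)
    where open PolyKit (MvPoly B n)

  module _ {i} {I : Pred (CommutativeRing.Carrier B) i} (ideal : Ideals.IsIdeal B I) where

    regular-mapMv : (∀ a → CommutativeRing._≈_ A a (CommutativeRing.0# A) ⊎ IdealKit.Regular B I h.⟦ a ⟧) →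
      ∀ n z → CommutativeRing._≈_ (MvPoly A n) z (CommutativeRing.0# (MvPoly A n)) ⊎
              IdealKit.Regular (MvPoly B n) (Extension ideal n) (Hom.⟦_⟧ (mapMv n) z)
    regular-mapMv reg zero    z = reg z
    regular-mapMv reg (suc n) = go
      where
      module 𝐀 = Polynomial (MvPoly A n)
      open PolyKit (MvPoly B n)
      open PolyIdeal (MvPoly B n)

      go : ∀ z → z 𝐀.≋ [] ⊎ IdealKit.Regular polynomialRing (Extension ideal (suc n)) (Hom.⟦_⟧ (mapMv (suc n)) z)
      go []      = inj₁ 𝐀.≋-refl
      go (c ∷ z) with regular-mapMv reg n c
      ... | inj₂ r = inj₂ (regular-cong (Extension-isIdeal ideal n) _ _ (≋-sym (C+X* φc φz)) (regular-∷ (Extension-isIdeal ideal n) φz r))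
        where
        φc = Hom.⟦_⟧ (mapMv n) c
        φz = Hom.⟦_⟧ (mapMv (suc n)) z
      ... | inj₁ c≈0 with go z
      ...   | inj₁ z≋[] = inj₁ (𝐀.≋-trans (𝐀.∷-cong c≈0 z≋[]) 𝐀.0∷[])
      ...   | inj₂ r    = inj₂ (regular-cong (Extension-isIdeal ideal n) _ _ (≋-sym (C+X* φc φz))
                (regular-0∷ (Extension-isIdeal ideal n) φz
                  (CommutativeRing.trans (MvPoly B n) (Hom.cong (mapMv n) c≈0) (Hom.0-homo (mapMv n))) r))
        where
        φc = Hom.⟦_⟧ (mapMv n) c
        φz = Hom.⟦_⟧ (mapMv (suc n)) z

module MvCoeff {c ℓ} (R : CommutativeRing c ℓ) where

  open CommutativeRing R hiding (zero)
  open RingKit R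
  open PolyKit using (coeff-C*; coeff-⊗; eval-0∷; eval-C)
  open Polynomial using (at; eq; coeff-⊕)
  open MvPolyKit R
  private
    module 𝐏 n = CommutativeRing (MvPoly R n)
    module ♯ n = Hom (constHom n)

  mcoeff : ∀ {n} → Vec ℕ n → 𝐏.Carrier n → Carrier
  mcoeff []              a = a
  mcoeff {suc n} (k ∷ m) p = mcoeff m (Polynomial.coeff (MvPoly R n) p k)

  mcoeff-cong : ∀ {n} (m : Vec ℕ n) {p q} → 𝐏._≈_ n p q → mcoeff m p ≈ mcoeff m q
  mcoeff-cong []      e = e
  mcoeff-cong (k ∷ m) e = mcoeff-cong m (at e k)

  mcoeff-0 : ∀ {n} (m : Vec ℕ n) → mcoeff m (𝐏.0# n) ≈ 0#
  mcoeff-0 []      = refl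
  mcoeff-0 (k ∷ m) = mcoeff-0 m

  mcoeff-+ : ∀ {n} (m : Vec ℕ n) p q → mcoeff m (𝐏._+_ n p q) ≈ mcoeff m p + mcoeff m q
  mcoeff-+ []              p q = refl
  mcoeff-+ {suc n} (k ∷ m) p q = trans (mcoeff-cong m (coeff-⊕ (MvPoly R n) p q k)) (mcoeff-+ m _ _)

  mcoeff-const* : ∀ {n} (m : Vec ℕ n) a p → mcoeff m (𝐏._*_ n (♯.⟦_⟧ n a) p) ≈ a * mcoeff m p
  mcoeff-const* []              a p = refl
  mcoeff-const* {suc n} (k ∷ m) a p =
    trans (mcoeff-cong m (coeff-C* (MvPoly R n) (♯.⟦_⟧ n a) p k)) (mcoeff-const* m a _)

  mcoeff-∑ : ∀ {n} (m : Vec ℕ n) {k} (f : Vector (𝐏.Carrier n) k) →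
             mcoeff m (RingKit.∑ (MvPoly R n) f) ≈ ∑ (λ i → mcoeff m (f i))
  mcoeff-∑ m {zero}  f = mcoeff-0 m
  mcoeff-∑ m {suc k} f = trans (mcoeff-+ m _ _) (+-congˡ (mcoeff-∑ m (f ∘ suc)))

  mcoeff-∙ : ∀ {n} (m : Vec ℕ n) {k} (s : Vector Carrier k) (f : Vector (𝐏.Carrier n) k) →
             mcoeff m (RingKit._∙_ (MvPoly R n) (λ i → ♯.⟦_⟧ n (s i)) f) ≈ s ∙ (λ i → mcoeff m (f i))
  mcoeff-∙ {n} m s f = trans (mcoeff-∑ m (λ i → 𝐏._*_ n (♯.⟦_⟧ n (s i)) (f i)))
    (sum-cong-≋ (λ i → mcoeff-const* m (s i) (f i)))

  module _ {i} {I : Pred Carrier i} (ideal : Ideals.IsIdeal R I) where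


    mcoeffs⇒Extension : ∀ n {p} → (∀ m → mcoeff {n} m p ∈ I) → p ∈ Extension ideal n
    mcoeffs⇒Extension zero    h = h []
    mcoeffs⇒Extension (suc n) h = λ k → mcoeffs⇒Extension n (λ m → h (k ∷ m))

  monomial : ∀ {n} → Vec ℕ n → 𝐏.Carrier n
  monomial []      = 1#
  monomial {suc n} (k ∷ m) = PolyKit.shift (MvPoly R n) k (Polynomial.C (MvPoly R n) (monomial m))

  private
    coeff : ∀ {n} → 𝐏.Carrier (suc n) → ℕ → 𝐏.Carrier n
    coeff {n} = Polynomial.coeff (MvPoly R n)

  mcoeff-monomial : ∀ {n} (m : Vec ℕ n) → mcoeff m (monomial m) ≈ 1#
  mcoeff-monomial                 []      = refl
  mcoeff-monomial {suc n} (k ∷ m) =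
    trans (reflexive (≡.cong (mcoeff m) (PolyKit.coeff-shift (MvPoly R n) k (monomial m)))) (mcoeff-monomial m)

  mcoeff-monomial-off : ∀ {n} (m m′ : Vec ℕ n) → ¬ m ≡ m′ → mcoeff m (monomial m′) ≈ 0#
  mcoeff-monomial-off         []      []        m≢m′ = contradiction ≡.refl m≢m′
  mcoeff-monomial-off {suc n} (k ∷ m) (k′ ∷ m′) m≢m′ with k ℕ.≟ k′
  ... | no k≢k′    = trans (reflexive (≡.cong (mcoeff m) (PolyKit.coeff-shift-off (MvPoly R n) k′ k (monomial m′) k≢k′))) (mcoeff-0 m)
  ... | yes ≡.refl = trans (reflexive (≡.cong (mcoeff m) (PolyKit.coeff-shift (MvPoly R n) k (monomial m′))))
                       (mcoeff-monomial-off m m′ (m≢m′ ∘ ≡.cong (k ∷_)))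

  module _ {m ℓm} {M : CommutativeRing m ℓm} (h : Hom R M) where
    private module M = CommutativeRing M
    open Algebra.Properties.Semiring.Exp M.semiring using (_^_)

    power : ∀ {n} → Vector M.Carrier n → Vec ℕ n → M.Carrier
    power x []      = M.1#
    power x (k ∷ m) = x zero ^ k M.* power (x ∘ suc) m

    evaluate-monomial : ∀ {n} (x : Vector M.Carrier n) m → Hom.⟦_⟧ (evaluate h x) (monomial m) M.≈ power x m
    evaluate-monomial         x []      = Hom.1-homo h
    evaluate-monomial {suc n} x (k ∷ m) = M.trans (shifted k) (M.*-congˡ (evaluate-monomial (x ∘ suc) m))
      where
      ev = evaluate h (x ∘ suc)
      open PolyKit (MvPoly R n) using (shift; C)
      shifted : ∀ k → PolyKit.eval (MvPoly R n) ev (x zero) (shift k (C (monomial m))) M.≈ x zero ^ k M.* Hom.⟦_⟧ ev (monomial m)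
      shifted zero    = M.trans (eval-C (MvPoly R n) ev (x zero) (monomial m)) (M.sym (M.*-identityˡ _))
      shifted (suc k) = M.trans (eval-0∷ (MvPoly R n) ev (x zero) (shift k (C (monomial m))))
        (M.trans (M.*-congˡ (shifted k)) (M.sym (M.*-assoc _ _ _)))

  evaluate-Extension : ∀ {i} {I : Pred Carrier i} (ideal : Ideals.IsIdeal R I) → ∀ n (x : Vector Carrier n) {p} →
                       p ∈ Extension ideal n → Hom.⟦_⟧ (evaluate idHom x) p ∈ I
  evaluate-Extension ideal zero    x h = h
  evaluate-Extension ideal (suc n) x {[]}    h = Ideals.IsIdeal.I-zero ideal
  evaluate-Extension ideal (suc n) x {a ∷ p} h =
    I-add (evaluate-Extension ideal n (x ∘ suc) (h 0)) (I-mul (x zero) (evaluate-Extension ideal (suc n) x {p} (h ∘ suc)))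
    where open Ideals.IsIdeal ideal

  -- Bounds the degree in each variable separately.
  Deg≤ : ∀ n → ℕ → 𝐏.Carrier n → Set ℓ
  Deg≤ zero    b p = ⊤
  Deg≤ (suc n) b p = (∀ k → Deg≤ n b (coeff {n} p k)) × (∀ k → b ℕ.< k → 𝐏._≈_ n (coeff {n} p k) (𝐏.0# n))

  Deg≤-resp : ∀ n {b p q} → 𝐏._≈_ n p q → Deg≤ n b p → Deg≤ n b q
  Deg≤-resp zero    e d       = tt
  Deg≤-resp (suc n) e (d , z) =
    (λ k → Deg≤-resp n (at e k) (d k)) , λ k lt → 𝐏.trans n (𝐏.sym n (at e k)) (z k lt)

  Deg≤-0 : ∀ n {b} → Deg≤ n b (𝐏.0# n)
  Deg≤-0 zero    = tt
  Deg≤-0 (suc n) = (λ k → Deg≤-0 n) , λ k _ → 𝐏.refl n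

  Deg≤-+ : ∀ n {b} p q → Deg≤ n b p → Deg≤ n b q → Deg≤ n b (𝐏._+_ n p q)
  Deg≤-+ zero    p q d e = tt
  Deg≤-+ (suc n) p q (d , z) (e , w) =
    (λ k → Deg≤-resp n (𝐏.sym n (coeff-⊕ (MvPoly R n) p q k)) (Deg≤-+ n _ _ (d k) (e k))) ,
    λ k lt → 𝐏.trans n (coeff-⊕ (MvPoly R n) p q k) (𝐏.trans n (𝐏.+-cong n (z k lt) (w k lt)) (𝐏.+-identityˡ n _))

  Deg≤-* : ∀ n {a b} p q → Deg≤ n a p → Deg≤ n b q → Deg≤ n (a ℕ.+ b) (𝐏._*_ n p q)
  Deg≤-* zero            p q d       e       = tt
  Deg≤-* (suc n) {a} {b} p q (d , z) (e , w) =
    (λ k → coeff-⊗ (MvPoly R n) (Deg≤ n (a ℕ.+ b)) (Deg≤-resp n) (Deg≤-0 n) (λ {x} {y} → Deg≤-+ n x y) p q k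
             (λ i j _ → Deg≤-* n _ _ (d i) (e j))) ,
    λ k lt → coeff-⊗ (MvPoly R n) (λ x → 𝐏._≈_ n x (𝐏.0# n)) (λ e f → 𝐏.trans n (𝐏.sym n e) f) (𝐏.refl n)
             (λ e f → 𝐏.trans n (𝐏.+-cong n e f) (𝐏.+-identityˡ n _)) p q k
             (λ i j i+j≡k → vanish i j (≡.subst (a ℕ.+ b ℕ.<_) (≡.sym i+j≡k) lt))
    where
    vanish : ∀ i j → a ℕ.+ b ℕ.< i ℕ.+ j → 𝐏._≈_ n (𝐏._*_ n (coeff {n} p i) (coeff {n} q j)) (𝐏.0# n)
    vanish i j lt with i ℕ.≤? a
    ... | no i≰a = 𝐏.trans n (𝐏.*-congʳ n (z i (ℕ.≰⇒> i≰a))) (𝐏.zeroˡ n _)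
    ... | yes i≤a = 𝐏.trans n (𝐏.*-congˡ n (w j (ℕ.≰⇒> λ j≤b → ℕ.<⇒≱ lt (ℕ.+-mono-≤ i≤a j≤b)))) (𝐏.zeroʳ n _)

  Deg≤-mono : ∀ n {a b p} → a ℕ.≤ b → Deg≤ n a p → Deg≤ n b p
  Deg≤-mono zero    a≤b d       = tt
  Deg≤-mono (suc n) a≤b (d , z) = (λ k → Deg≤-mono n a≤b (d k)) , λ k lt → z k (ℕ.≤-<-trans a≤b lt)

  Deg≤-const : ∀ n a → Deg≤ n 0 (♯.⟦_⟧ n a)
  Deg≤-const zero    a = tt
  Deg≤-const (suc n) a = (λ { zero → Deg≤-const n a ; (suc k) → Deg≤-0 n }) , λ { (suc k) _ → 𝐏.refl n }

  Deg≤-1 : ∀ n → Deg≤ n 0 (𝐏.1# n)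
  Deg≤-1 n = Deg≤-resp n (♯.1-homo n) (Deg≤-const n 1#)

  Deg≤-∑ : ∀ n {b k} (f : Vector (𝐏.Carrier n) k) → (∀ i → Deg≤ n b (f i)) → Deg≤ n b (RingKit.∑ (MvPoly R n) f)
  Deg≤-∑ n {k = zero}  f d = Deg≤-0 n
  Deg≤-∑ n {k = suc k} f d = Deg≤-+ n (f zero) _ (d zero) (Deg≤-∑ n (f ∘ suc) (d ∘ suc))

  degree : ∀ n p → ∃ λ b → Deg≤ n b p
  degree zero    p       = 0 , tt
  degree (suc n) []      = 0 , Deg≤-0 (suc n)
  degree (suc n) (a ∷ p) with degree n a | degree (suc n) p
  ... | b , d | b′ , (e , z) = b ℕ.⊔ suc b′ ,
        (λ { zero → Deg≤-mono n (ℕ.m≤m⊔n b (suc b′)) d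
           ; (suc k) → Deg≤-mono n (ℕ.≤-trans (ℕ.n≤1+n b′) (ℕ.m≤n⊔m b (suc b′))) (e k) }) ,
        λ { (suc k) lt → z k (ℕ.s≤s⁻¹ (ℕ.≤-<-trans (ℕ.m≤n⊔m b (suc b′)) lt)) }

  degrees : ∀ n {k} (f : Vector (𝐏.Carrier n) k) → ∃ λ b → ∀ i → Deg≤ n b (f i)
  degrees n {zero}  f = 0 , λ ()
  degrees n {suc k} f with degree n (f zero) | degrees n (f ∘ suc)
  ... | b , d | b′ , e = b ℕ.⊔ b′ , λ { zero → Deg≤-mono n (ℕ.m≤m⊔n b b′) d ; (suc i) → Deg≤-mono n (ℕ.m≤n⊔m b b′) (e i) }

  index : ∀ D n → Fin (D ℕ.^ n) → Vec ℕ n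
  index D zero    _ = []
  index D (suc n) k = Fin.toℕ (proj₁ (Fin.remQuot {D} (D ℕ.^ n) k)) ∷ index D n (proj₂ (Fin.remQuot {D} (D ℕ.^ n) k))

  index-injective : ∀ D n i j → index D n i ≡ index D n j → i ≡ j
  index-injective D zero    zero zero _ = ≡.refl
  index-injective D (suc n) i    j    e =
    ≡.trans (≡.sym (Fin.combine-remQuot {D} (D ℕ.^ n) i))
      (≡.trans (≡.cong₂ Fin.combine (Fin.toℕ-injective (Vec.∷-injectiveˡ e))
                                    (index-injective D n _ _ (Vec.∷-injectiveʳ e)))
        (Fin.combine-remQuot {D} (D ℕ.^ n) j))

  vanishing-box : ∀ n b p → Deg≤ n b p → (∀ k → mcoeff (index (suc b) n k) p ≈ 0#) → 𝐏._≈_ n p (𝐏.0# n)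
  vanishing-box zero    b p d       h = h zero
  vanishing-box (suc n) b p (d , z) h = eq vanish
    where
    vanish : ∀ k → 𝐏._≈_ n (coeff {n} p k) (𝐏.0# n)
    vanish k with suc b ℕ.≤? k
    ... | yes b<k = z k b<k
    ... | no b≮k  = vanishing-box n b (coeff {n} p k) (d k) λ j →
      ≡.subst (λ m → mcoeff m p ≈ 0#)
        (≡.cong₂ _∷_ (≡.trans (≡.cong (Fin.toℕ ∘ proj₁) (Fin.remQuot-combine i j)) (Fin.toℕ-fromℕ< k<D))
                     (≡.cong (index (suc b) n ∘ proj₂) (Fin.remQuot-combine i j)))
        (h (Fin.combine i j))
      where
      k<D = ℕ.≰⇒> b≮k
      i = Fin.fromℕ< k<D

module AlgebraicDependence {c ℓ} (R : CommutativeRing c ℓ) (integral : Integral R)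
  (1≉0 : ¬ CommutativeRing._≈_ R (CommutativeRing.1# R) (CommutativeRing.0# R)) where

  open CommutativeRing R hiding (zero)
  open MvCoeff R
  open MvPolyKit R
  open RingKit R using (sum-cong-≋)
  open LinearDependence R integral 1≉0

  -- The (N+1)ⁿ⁺¹ monomials in f with exponents at most N lie in a space of
  -- dimension (1 + (n+1)Nd)ⁿ, which is smaller once N is large enough.
  algebraicallyDependent : ∀ n (f : Vector (CommutativeRing.Carrier (MvPoly R n)) (suc n)) →
    ∃ λ F → ¬ CommutativeRing._≈_ (MvPoly R (suc n)) F [] ×
            CommutativeRing._≈_ (MvPoly R n) (Hom.⟦_⟧ (evaluate (constHom n) f) F) (CommutativeRing.0# (MvPoly R n))
  algebraicallyDependent n f = F , F≉0 , relation
    where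
    module 𝐏 = CommutativeRing (MvPoly R n)
    module 𝐐 = CommutativeRing (MvPoly R (suc n))
    open Algebra.Properties.Semiring.Exp 𝐏.semiring using (_^_)
    d = proj₁ (degrees n f)
    D′ = suc (suc n ℕ.* d)
    N = D′ ℕ.^ n
    M = suc N
    b = suc n ℕ.* (N ℕ.* d)

    ^-distrib-* : ∀ k → (M ℕ.* D′) ℕ.^ k ≡ M ℕ.^ k ℕ.* D′ ℕ.^ k
    ^-distrib-* zero    = ≡.refl
    ^-distrib-* (suc k) = ≡.trans (≡.cong (M ℕ.* D′ ℕ.*_) (^-distrib-* k))
      (ℕ.[m*n]*[o*p]≡[m*o]*[n*p] M D′ (M ℕ.^ k) (D′ ℕ.^ k))

    count : suc b ℕ.^ n ℕ.< M ℕ.^ suc n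
    count = ℕ.≤-<-trans (ℕ.^-monoˡ-≤ n D≤) (≡.subst (ℕ._< M ℕ.^ suc n) (≡.sym (^-distrib-* n)) strict)
      where
      D≤ : suc b ℕ.≤ M ℕ.* D′
      D≤ = begin
        suc (suc n ℕ.* (N ℕ.* d))   ≡⟨ ≡.cong suc (≡.trans (≡.sym (ℕ.*-assoc (suc n) N d)) (≡.trans (≡.cong (ℕ._* d) (ℕ.*-comm (suc n) N)) (ℕ.*-assoc N (suc n) d))) ⟩
        suc (N ℕ.* (suc n ℕ.* d))   ≤⟨ ℕ.+-mono-≤ (ℕ.s≤s ℕ.z≤n) (ℕ.*-monoʳ-≤ N (ℕ.n≤1+n (suc n ℕ.* d))) ⟩
        D′ ℕ.+ N ℕ.* D′             ∎
        where open ℕ.≤-Reasoning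
      strict : M ℕ.^ n ℕ.* D′ ℕ.^ n ℕ.< M ℕ.* M ℕ.^ n
      strict = ≡.subst (M ℕ.^ n ℕ.* N ℕ.<_) (ℕ.*-comm (M ℕ.^ n) M)
        (ℕ.*-monoʳ-< (M ℕ.^ n) {{ℕ.m^n≢0 M n}} (ℕ.n<1+n N))

    monomials : Fin (M ℕ.^ suc n) → 𝐏.Carrier
    monomials i = power (constHom n) f (index M (suc n) i)

    dep = dependent (suc b ℕ.^ n) (M ℕ.^ suc n) count (λ i k → mcoeff (index (suc b) n k) (monomials i))
    s = proj₁ dep
    i₀ = proj₁ (proj₁ (proj₂ dep))

    terms : Fin (M ℕ.^ suc n) → 𝐐.Carrier
    terms i = 𝐐._*_ (Hom.⟦_⟧ (constHom (suc n)) (s i)) (monomial (index M (suc n) i))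

    F : 𝐐.Carrier
    F = RingKit.∑ (MvPoly R (suc n)) terms

    value : 𝐏.Carrier
    value = RingKit._∙_ (MvPoly R n) (λ i → Hom.⟦_⟧ (constHom n) (s i)) monomials

    F≉0 : ¬ 𝐐._≈_ F []
    F≉0 F≈0 = proj₂ (proj₁ (proj₂ dep)) (trans (sym extract) (trans (mcoeff-cong m₀ F≈0) (mcoeff-0 m₀)))
      where
      m₀ = index M (suc n) i₀
      open RingKit R using (δ; ∑-δ; δ-diag; δ-off)
      extract : mcoeff m₀ F ≈ s i₀
      extract = trans (mcoeff-∙ m₀ s (λ i → monomial (index M (suc n) i)))
        (trans (sum-cong-≋ (λ i → trans (*-comm _ _) (*-congʳ (kronecker i)))) (∑-δ i₀ s))
        where
        kronecker : ∀ i → mcoeff m₀ (monomial (index M (suc n) i)) ≈ δ i₀ i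
        kronecker i with i₀ Fin.≟ i
        ... | yes ≡.refl = trans (mcoeff-monomial m₀) (sym (δ-diag i₀))
        ... | no i₀≢i    = trans (mcoeff-monomial-off m₀ (index M (suc n) i) (i₀≢i ∘ index-injective M (suc n) i₀ i))
                             (sym (δ-off i₀≢i))

    evaluated : 𝐏._≈_ (Hom.⟦_⟧ (evaluate (constHom n) f) F) value
    evaluated = 𝐏.trans (Hom.∑-homo (evaluate (constHom n) f) terms) (RingKit.sum-cong-≋ (MvPoly R n) λ i →
      𝐏.trans (Hom.*-homo (evaluate (constHom n) f) (Hom.⟦_⟧ (constHom (suc n)) (s i)) (monomial (index M (suc n) i)))
        (𝐏.*-cong (evaluate-const (constHom n) f (s i))
                  (evaluate-monomial (constHom n) f (index M (suc n) i))))

    Deg≤-^ : ∀ p k → Deg≤ n d p → Deg≤ n (k ℕ.* d) (p ^ k)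
    Deg≤-^ p zero    h = Deg≤-1 n
    Deg≤-^ p (suc k) h = Deg≤-* n _ _ h (Deg≤-^ p k h)

    Deg≤-power : ∀ k (g : Vector 𝐏.Carrier k) → (∀ i → Deg≤ n d (g i)) → ∀ i →
                 Deg≤ n (k ℕ.* (N ℕ.* d)) (power (constHom n) g (index M k i))
    Deg≤-power zero    g h i = Deg≤-1 n
    Deg≤-power (suc k) g h i = Deg≤-* n _ _
      (Deg≤-mono n (ℕ.*-monoˡ-≤ d (ℕ.s≤s⁻¹ (Fin.toℕ<n e))) (Deg≤-^ (g zero) (Fin.toℕ e) (h zero)))
      (Deg≤-power k (g ∘ suc) (h ∘ suc) (proj₂ (Fin.remQuot {M} (M ℕ.^ k) i)))
      where e = proj₁ (Fin.remQuot {M} (M ℕ.^ k) i)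

    relation : 𝐏._≈_ (Hom.⟦_⟧ (evaluate (constHom n) f) F) 𝐏.0#
    relation = 𝐏.trans evaluated (vanishing-box n b value
      (Deg≤-∑ n _ (λ i → Deg≤-* n _ _ (Deg≤-const n (s i)) (Deg≤-power (suc n) f (proj₂ (degrees n f)) i)))
      (λ k → trans (mcoeff-∙ (index (suc b) n k) s monomials) (proj₂ (proj₂ dep) k)))

HasInverses : ∀ {c ℓ} → CommutativeRing c ℓ → Set (c ⊔ ℓ)
HasInverses R = ∀ a → a ≈ 0# ⊎ ∃ λ b → b * a ≈ 1#
  where open CommutativeRing R

hasInverses⇒integral : ∀ {c ℓ} (R : CommutativeRing c ℓ) → HasInverses R → Integral R
hasInverses⇒integral R inv a with inv a
... | inj₁ a≈0       = inj₁ a≈0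
... | inj₂ (b , e) = inj₂ λ x a*x≈0 →
  trans (sym (trans (*-congʳ e) (*-identityˡ x))) (trans (*-assoc b a x) (trans (*-congˡ a*x≈0) (zeroʳ b)))
  where open CommutativeRing R

module KrullDimension (em : ∀ {a} → ExcludedMiddle a) {c ℓ} (K : CommutativeRing c ℓ) (inverses : HasInverses K)
  (1≉0 : ¬ CommutativeRing._≈_ K (CommutativeRing.1# K) (CommutativeRing.0# K)) where

  private
    module 𝐏 n = CommutativeRing (MvPoly K n)
  open MvPolyKit K
  open AlgebraicDependence K (hasInverses⇒integral K inverses) 1≉0

  1≉0-MvPoly : ∀ n → ¬ 𝐏._≈_ n (𝐏.1# n) (𝐏.0# n)
  1≉0-MvPoly zero    = 1≉0
  1≉0-MvPoly (suc n) = λ e → 1≉0-MvPoly n (Polynomial.at e 0)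

  flag : ∀ n → Fin (suc n) → Pred (𝐏.Carrier n) ℓ
  flag n       zero    = λ p → 𝐏._≈_ n p (𝐏.0# n)
  flag (suc n) (suc i) = λ p → flag n i (Polynomial.coeff (MvPoly K n) p 0)

  flag-isPrime : ∀ n i → Ideals.IsPrime (MvPoly K n) (flag n i)
  flag-isPrime n       zero    = record
    { isIdeal = IdealKit.≈0-isIdeal (MvPoly K n)
    ; proper  = 1≉0-MvPoly n
    ; prime   = λ {x} {y} e → [ inj₁ , (λ reg → inj₂ (reg y e)) ]′ (integral-MvPoly (hasInverses⇒integral K inverses) n x)
    }
  flag-isPrime (suc n) (suc i) = record
    { isIdeal = record
      { I-resp = λ e → I-resp (φ.cong e)
      ; I-zero = I-zero
      ; I-add  = λ {x} {y} p q → I-resp (𝐏.sym n (φ.+-homo x y)) (I-add p q)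
      ; I-mul  = λ r {x} p → I-resp (𝐏.sym n (φ.*-homo r x)) (I-mul (φ.⟦_⟧ r) p)
      }
    ; proper  = proper
    ; prime   = λ {x} {y} e → prime (I-resp (φ.*-homo x y) e)
    }
    where
    module φ = Hom (PolyKit.coeff₀Hom (MvPoly K n))
    open Ideals.IsPrime (flag-isPrime n i)
    open Ideals.IsIdeal isIdeal

  flag-⊂ : ∀ n (i : Fin n) → flag n (inject₁ i) ⊂ flag n (suc i)
  flag-⊂ (suc n) zero    = (λ e → Polynomial.at e 0) ,
    λ ⊇ → 1≉0-MvPoly n (Polynomial.at (⊇ {Polynomial.X (MvPoly K n)} (𝐏.refl n)) 1)
  flag-⊂ (suc n) (suc i) = (λ {p} → proj₁ (flag-⊂ n i) {Polynomial.coeff (MvPoly K n) p 0}) ,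
    λ ⊇ → proj₂ (flag-⊂ n i) (λ {z} → ⊇ {Polynomial.C (MvPoly K n) z})

  module _ {r ℓr} {R : CommutativeRing r ℓr} (h : Hom K R) where

    private
      module R = CommutativeRing R
      module h = Hom h
    open Ideals R

    generic : ∀ {p} n (P : Fin (suc n) → Pred R.Carrier p) → (∀ i → IsPrime (P i)) →
      (∀ i → P (inject₁ i) ⊆ P (suc i)) →
      (x : Vector R.Carrier n) → (∀ i → x i ∈ P (suc i)) → (∀ i → x i ∉ P (inject₁ i)) →
      ∀ F → Hom.⟦_⟧ (evaluate h x) F ∈ P zero → 𝐏._≈_ n F (𝐏.0# n)
    generic zero P prime inc x x∈ x∉ a a∈P with inverses a
    ... | inj₁ a≈0     = a≈0
    ... | inj₂ (b , e) = contradiction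
          (I-resp (R.trans (R.sym (h.*-homo b a)) (R.trans (h.cong e) h.1-homo)) (I-mul h.⟦ b ⟧ a∈P)) proper
      where
      open IsPrime (prime zero) hiding (prime)
      open IsIdeal isIdeal
    generic (suc n) P prime inc x x∈ x∉ = go
      where
      open PolyKit (MvPoly K n)
      module P₀ = IsPrime (prime zero)
      module P₁ = IsPrime (prime (suc zero))
      open IsIdeal
      evₙ = evaluate h (x ∘ suc)

      go : ∀ F → Hom.⟦_⟧ (evaluate h x) F ∈ P zero → F ≋ []
      go []      _ = ≋-refl
      go (a ∷ F) e = ≋-trans (∷-cong a≈0 (go F F∈P₀)) 0∷[]
        where
        tail = x zero R.* Hom.⟦_⟧ (evaluate h x) F

        a≈0 : 𝐏._≈_ n a (𝐏.0# n)
        a≈0 = generic n (P ∘ suc) (prime ∘ suc) (inc ∘ suc) (x ∘ suc) (x∈ ∘ suc) (x∉ ∘ suc) a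
          (IdealKit.I-cancel R P₁.isIdeal (I-resp P₁.isIdeal (R.+-comm (Hom.⟦_⟧ evₙ a) tail) (inc zero e))
            (IdealKit.I-mulʳ R P₁.isIdeal _ (x∈ zero)))

        F∈P₀ : Hom.⟦_⟧ (evaluate h x) F ∈ P zero
        F∈P₀ = [ (λ x∈P → contradiction x∈P (x∉ zero)) , id ]′ (P₀.prime (IdealKit.I-cancel R P₀.isIdeal e
          (I-resp P₀.isIdeal (R.sym (R.trans (Hom.cong evₙ a≈0) (Hom.0-homo evₙ))) (I-zero P₀.isIdeal))))

  hasKrullDim : ∀ {R : CommutativeRing c (c ⊔ ℓ)} n (h : Hom K R) (ρ : Hom R (MvPoly K n)) →
    (∀ a → 𝐏._≈_ n (Hom.⟦_⟧ ρ (Hom.⟦_⟧ h a)) (const K {n} a)) →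
    (∀ p → ∃ λ x → 𝐏._≈_ n (Hom.⟦_⟧ ρ x) p) →
    (∀ (P : Pred (CommutativeRing.Carrier R) (c ⊔ ℓ)) → Ideals.IsPrime R P →
       ∀ {x} → 𝐏._≈_ n (Hom.⟦_⟧ ρ x) (𝐏.0# n) → x ∈ P) →
    HasKrullDim R n
  hasKrullDim {R} n h ρ over surjective kernel⊆ = chain , noLongerChain
    where
    module R = CommutativeRing R
    module ρ = Hom ρ
    P : Fin (suc n) → Pred R.Carrier (c ⊔ ℓ)
    P i x = Lift (c ⊔ ℓ) (flag n i (ρ.⟦ x ⟧))

    P-isPrime : ∀ i → Ideals.IsPrime R (P i)
    P-isPrime i = record
      { isIdeal = record
        { I-resp = λ e p → lift (I-resp (ρ.cong e) (lower p))
        ; I-zero = lift (I-resp (𝐏.sym n ρ.0-homo) I-zero)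
        ; I-add  = λ p q → lift (I-resp (𝐏.sym n (ρ.+-homo _ _)) (I-add (lower p) (lower q)))
        ; I-mul  = λ r p → lift (I-resp (𝐏.sym n (ρ.*-homo _ _)) (I-mul _ (lower p)))
        }
      ; proper  = λ p → proper (I-resp ρ.1-homo (lower p))
      ; prime   = λ p → [ inj₁ ∘ lift , inj₂ ∘ lift ]′ (prime (I-resp (ρ.*-homo _ _) (lower p)))
      }
      where
      open Ideals.IsPrime (flag-isPrime n i)
      open Ideals.IsIdeal isIdeal

    chain : PrimeChain R n
    chain = P , P-isPrime , λ i →
      (λ p → lift (proj₁ (flag-⊂ n i) (lower p))) ,
      λ ⊇ → proj₂ (flag-⊂ n i) λ {z} z∈ →
        let x , e = surjective z
            open Ideals.IsPrime
            open Ideals.IsIdeal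
        in I-resp (isIdeal (flag-isPrime n (inject₁ i))) e
             (lower (⊇ (lift (I-resp (isIdeal (flag-isPrime n (suc i))) (𝐏.sym n e) z∈))))

    noLongerChain : ¬ PrimeChain R (suc n)
    noLongerChain (P , prime , strict) = F≉0 (generic h (suc n) P prime (λ i → proj₁ (strict i)) x x∈ x∉ F
      (kernel⊆ (P zero) (prime zero) (𝐏.trans n agree relation)))
      where
      witness : ∀ i → ∃ λ x → x ∈ P (suc i) × x ∉ P (inject₁ i)
      witness i with em {P = ∃ λ x → x ∈ P (suc i) × x ∉ P (inject₁ i)}
      ... | yes w = w
      ... | no ¬w = contradiction
        (λ {x} x∈ → case em {P = x ∈ P (inject₁ i)} of λ { (yes p) → p ; (no ¬p) → contradiction (x , x∈ , ¬p) ¬w })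
        (proj₂ (strict i))
      x = λ i → proj₁ (witness i)
      x∈ = λ i → proj₁ (proj₂ (witness i))
      x∉ = λ i → proj₂ (proj₂ (witness i))
      dependence = algebraicallyDependent n (λ i → ρ.⟦ x i ⟧)
      F = proj₁ dependence
      F≉0 = proj₁ (proj₂ dependence)
      relation = proj₂ (proj₂ dependence)

      agree : 𝐏._≈_ n (ρ.⟦ Hom.⟦_⟧ (evaluate h x) F ⟧) (Hom.⟦_⟧ (evaluate (constHom n) (λ i → ρ.⟦ x i ⟧)) F)
      agree = hom-unique (ρ ∘ᴴ evaluate h x) (evaluate (constHom n) (λ i → ρ.⟦ x i ⟧))
        (λ a → 𝐏.trans n (ρ.cong (evaluate-const h x a)) (𝐏.trans n (over a)
          (𝐏.sym n (evaluate-const (constHom n) (λ i → ρ.⟦ x i ⟧) a))))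
        (λ i → 𝐏.trans n (ρ.cong (evaluate-var h x i)) (𝐏.sym n (evaluate-var (constHom n) (λ i → ρ.⟦ x i ⟧) i)))
        F

module LinearForms (em : ∀ {a} → ExcludedMiddle a) {c ℓ₁ ℓ₂} (F : HeytingField c ℓ₁ ℓ₂) (ℓ : ℕ) where

  open Arrangements F ℓ
  private module F = HeytingField F
  open CommutativeRing scalars hiding (zero)
  open RingKit scalars
  open Relation.Binary.Reasoning.Setoid setoid
  open import Data.Fin.Base using (punchIn; punchOut)

  inverses : HasInverses scalars
  inverses a with em {P = a F.# 0#}
  ... | no ¬#  = inj₁ (proj₁ (F.tight a 0#) ¬#)
  ... | yes a# = let b , left , _ = F.#⇒invertible a# in
                 inj₂ (b , trans (*-congˡ (sym (x-0≈x a))) left)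

  1≉0 : ¬ 1# ≈ 0#
  1≉0 1≈0 = F.#-irrefl refl (F.invertible⇒# {0#} {0#} (0# ,
    (trans (zeroˡ _) (sym 1≈0) , trans (zeroʳ _) (sym 1≈0))))

  inverse : ∀ {a} → ¬ a ≈ 0# → ∃ λ b → b * a ≈ 1#
  inverse {a} a≉0 = [ (λ a≈0 → contradiction a≈0 a≉0) , id ]′ (inverses a)

  integral : Integral scalars
  integral = hasInverses⇒integral scalars inverses

  isZero? : ∀ a → a ≈ 0# ⊎ ¬ a ≈ 0#
  isZero? a with em {P = a ≈ 0#}
  ... | yes p = inj₁ p
  ... | no ¬p = inj₂ ¬p

  Vanishing : List Form → Pred V (c ⊔ ℓ₁)
  Vanishing B v = ∀ {β} → β ∈ˡ B → β ∙ v ≈ 0#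

  data Span (B : List Form) : Form → Set (c ⊔ ℓ₁) where
    member  : ∀ {β} → β ∈ˡ B → Span B β
    null    : Span B (λ _ → 0#)
    plus    : ∀ {α β} → Span B α → Span B β → Span B (λ i → α i + β i)
    times   : ∀ a {β} → Span B β → Span B (λ i → a * β i)
    respect : ∀ {α β} → (∀ i → α i ≈ β i) → Span B α → Span B β

  Span-mono : ∀ {B C} → (∀ {β} → β ∈ˡ B → Span C β) → ∀ {α} → Span B α → Span C α
  Span-mono inc (member p)    = inc p
  Span-mono inc null          = null
  Span-mono inc (plus s t)    = plus (Span-mono inc s) (Span-mono inc t)
  Span-mono inc (times a s)   = times a (Span-mono inc s)
  Span-mono inc (respect e s) = respect e (Span-mono inc s)

  Span-vanishing : ∀ {B α v} → Span B α → v ∈ Vanishing B → α ∙ v ≈ 0#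
  Span-vanishing         (member p)  h = h p
  Span-vanishing {v = v} null        h = ∙-zeroˡ v (λ _ → refl)
  Span-vanishing {v = v} (plus {α} {β} s t) h =
    trans (∙-+ˡ α β v) (trans (+-cong (Span-vanishing s h) (Span-vanishing t h)) (+-identityˡ _))
  Span-vanishing {v = v} (times a {β} s) h = trans (∙-*ˡ a β v) (trans (*-congˡ (Span-vanishing s h)) (zeroʳ a))
  Span-vanishing {v = v} (respect e s) h =
    trans (∙-cong (λ i → sym (e i)) (λ _ → refl)) (Span-vanishing s h)

  -- A basis w of the subspace cut out by B, with dual forms y.
  record Frame (B : List Form) : Set (c ⊔ ℓ₁) where
    field
      dim    : ℕ
      w      : Fin dim → V
      y      : Fin dim → Form
      dual   : ∀ i j → y i ∙ w j ≈ δ i j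
      vanish : ∀ j → w j ∈ Vanishing B
      spans  : ∀ α → (∀ j → α ∙ w j ≈ 0#) → Span B α

    remainder : Form → Form
    remainder α i = α i - ∑ (λ j → (α ∙ w j) * y j i)

    remainder-vanishes : ∀ α j → remainder α ∙ w j ≈ 0#
    remainder-vanishes α j = begin
      remainder α ∙ w j
        ≈⟨ ∙-+ˡ α (λ i → - ∑ (λ j → (α ∙ w j) * y j i)) (w j) ⟩
      α ∙ w j + (λ i → - ∑ (λ j → (α ∙ w j) * y j i)) ∙ w j
        ≈⟨ +-congˡ (∙-negˡ (λ i → ∑ (λ j → (α ∙ w j) * y j i)) (w j)) ⟩
      α ∙ w j - (λ i → ∑ (λ j → (α ∙ w j) * y j i)) ∙ w j
        ≈⟨ +-congˡ (-‿cong (∙-∑ (λ j → α ∙ w j) y (w j))) ⟩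
      α ∙ w j - (λ i → α ∙ w i) ∙ (λ i → y i ∙ w j)
        ≈⟨ +-congˡ (-‿cong (∙-cong {u = λ i → α ∙ w i} (λ _ → refl) (λ i → trans (dual i j) (δ-sym i j)))) ⟩
      α ∙ w j - (λ i → α ∙ w i) ∙ δ j
        ≈⟨ +-congˡ (-‿cong (∙-δ (λ i → α ∙ w i) j)) ⟩
      α ∙ w j - α ∙ w j
        ≈⟨ -‿inverseʳ _ ⟩
      0# ∎

  emptyFrame : Frame []
  emptyFrame = record
    { dim = ℓ ; w = δ ; y = δ
    ; dual   = λ i j → trans (∙-δ (δ i) j) refl
    ; vanish = λ _ ()
    ; spans  = λ α h → respect (λ i → trans (sym (h i)) (∙-δ α i)) null
    }

  δ-punchIn : ∀ {n} (p : Fin (suc n)) i j → δ (punchIn p i) (punchIn p j) ≈ δ i j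
  δ-punchIn p i j with i Fin.≟ j
  ... | yes ≡.refl = trans (δ-diag (punchIn p i)) (sym (δ-diag i))
  ... | no i≢j     = trans (δ-off (i≢j ∘ Fin.punchIn-injective p i j)) (sym (δ-off i≢j))

  ∙-sub-scaled : ∀ (α u v : Vector Carrier ℓ) a → α ∙ (λ i → u i - a * v i) ≈ α ∙ u - a * α ∙ v
  ∙-sub-scaled α u v a = trans (∙-+ʳ α u (λ i → - (a * v i)))
    (+-congˡ (trans (∙-negʳ α (λ i → a * v i)) (-‿cong (∙-*ʳ a α v))))

  extend : ∀ {B} (𝔽 : Frame B) β →
    ∃ λ (𝔽′ : Frame (β ∷ B)) → Frame.dim 𝔽′ ℕ.≤ Frame.dim 𝔽 ×
      (¬ (∀ j → β ∙ Frame.w 𝔽 j ≈ 0#) → Frame.dim 𝔽′ ℕ.< Frame.dim 𝔽)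
  extend {B} 𝔽 β with ∀⊎∃ (λ j → isZero? (β ∙ Frame.w 𝔽 j))
  ... | inj₁ zeros = record
          { Frame 𝔽
          ; vanish = λ { j (here ≡.refl) → zeros j ; j (there p) → Frame.vanish 𝔽 j p }
          ; spans  = λ α h → Span-mono (λ p → member (there p)) (Frame.spans 𝔽 α h)
          } , ℕ.≤-refl , λ nz → contradiction zeros nz
  ... | inj₂ (p , b≉0) = go 𝔽 p b≉0
    where
    go : ∀ (𝔽 : Frame B) (p : Fin (Frame.dim 𝔽)) → ¬ β ∙ Frame.w 𝔽 p ≈ 0# →
      ∃ λ (𝔽′ : Frame (β ∷ B)) → Frame.dim 𝔽′ ℕ.≤ Frame.dim 𝔽 ×
        (¬ (∀ j → β ∙ Frame.w 𝔽 j ≈ 0#) → Frame.dim 𝔽′ ℕ.< Frame.dim 𝔽)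
    go record { dim = suc n ; w = w ; y = y ; dual = dual ; vanish = vanish ; spans = spans } p b≉0 =
      record
        { dim = n ; w = w′ ; y = y′ ; dual = dual′
        ; vanish = λ { j (here ≡.refl) → β∙w′ j ; j (there q) → B∙w′ j q }
        ; spans = spans′ } , ℕ.n≤1+n n , λ _ → ℕ.n<1+n n
      where
      b⁻¹ = proj₁ (inverse b≉0)
      b⁻¹b = proj₂ (inverse b≉0)
      a = λ j → (β ∙ w (punchIn p j)) * b⁻¹
      w′ = λ j i → w (punchIn p j) i - a j * w p i
      y′ = λ j → y (punchIn p j)

      dual′ : ∀ i j → y′ i ∙ w′ j ≈ δ i j
      dual′ i j = begin
        y′ i ∙ w′ j
          ≈⟨ ∙-sub-scaled (y′ i) (w (punchIn p j)) (w p) (a j) ⟩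
        y′ i ∙ w (punchIn p j) - a j * y′ i ∙ w p
          ≈⟨ +-cong (trans (dual (punchIn p i) (punchIn p j)) (δ-punchIn p i j))
               (-‿cong (trans (*-congˡ (trans (dual (punchIn p i) p) (δ-off (Fin.punchInᵢ≢i p i)))) (zeroʳ _))) ⟩
        δ i j - 0#
          ≈⟨ x-0≈x _ ⟩
        δ i j ∎

      β∙w′ : ∀ j → β ∙ w′ j ≈ 0#
      β∙w′ j = begin
        β ∙ w′ j
          ≈⟨ ∙-sub-scaled β (w (punchIn p j)) (w p) (a j) ⟩
        β ∙ w (punchIn p j) - a j * β ∙ w p
          ≈⟨ +-congˡ (-‿cong (trans (*-assoc _ _ _) (trans (*-congˡ b⁻¹b) (*-identityʳ _)))) ⟩
        β ∙ w (punchIn p j) - β ∙ w (punchIn p j)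
          ≈⟨ -‿inverseʳ _ ⟩
        0# ∎

      B∙w′ : ∀ j {γ} → γ ∈ˡ B → γ ∙ w′ j ≈ 0#
      B∙w′ j {γ} q = begin
        γ ∙ w′ j                                ≈⟨ ∙-sub-scaled γ (w (punchIn p j)) (w p) (a j) ⟩
        γ ∙ w (punchIn p j) - a j * γ ∙ w p     ≈⟨ +-cong (vanish _ q) (-‿cong (*-congˡ (vanish p q))) ⟩
        0# - a j * 0#                           ≈⟨ solve 1 (λ a → :0 :- a :* :0 := :0) refl (a j) ⟩
        0# ∎

      spans′ : ∀ α → (∀ j → α ∙ w′ j ≈ 0#) → Span (β ∷ B) α
      spans′ α h = respect (λ i → solve 2 (λ x y → (x :- y) :+ y := x) refl (α i) (c′ * β i))
        (plus (Span-mono (λ q → member (there q)) (spans α′ α′-vanishes)) (times c′ (member (here ≡.refl))))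
        where
        c′ = b⁻¹ * α ∙ w p
        α′ = λ i → α i - c′ * β i

        α′∙ : ∀ v → α′ ∙ v ≈ α ∙ v - c′ * β ∙ v
        α′∙ v = trans (∙-comm α′ v) (trans (∙-sub-scaled v α β c′)
          (+-cong (∙-comm v α) (-‿cong (*-congˡ (∙-comm v β)))))

        α′-vanishes : ∀ j → α′ ∙ w j ≈ 0#
        α′-vanishes j with p Fin.≟ j
        ... | yes ≡.refl = begin
          α′ ∙ w p                                      ≈⟨ α′∙ (w p) ⟩
          α ∙ w p - (b⁻¹ * α ∙ w p) * β ∙ w p
            ≈⟨ solve 3 (λ x b y → x :- (b :* x) :* y := x :- (b :* y) :* x) refl (α ∙ w p) b⁻¹ (β ∙ w p) ⟩
          α ∙ w p - (b⁻¹ * β ∙ w p) * α ∙ w p           ≈⟨ +-congˡ (-‿cong (trans (*-congʳ b⁻¹b) (*-identityˡ _))) ⟩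
          α ∙ w p - α ∙ w p                             ≈⟨ -‿inverseʳ _ ⟩
          0# ∎
        ... | no p≢j = ≡.subst (λ k → α′ ∙ w k ≈ 0#) (Fin.punchIn-punchOut p≢j) (begin
          α′ ∙ w (punchIn p k)                                              ≈⟨ α′∙ (w (punchIn p k)) ⟩
          α ∙ w (punchIn p k) - (b⁻¹ * α ∙ w p) * β ∙ w (punchIn p k)
            ≈⟨ solve 4 (λ x b y z → x :- (b :* y) :* z := x :- (z :* b) :* y) refl (α ∙ w (punchIn p k)) b⁻¹ (α ∙ w p) (β ∙ w (punchIn p k)) ⟩
          α ∙ w (punchIn p k) - a k * α ∙ w p                               ≈⟨ ∙-sub-scaled α (w (punchIn p k)) (w p) (a k) ⟨
          α ∙ w′ k                                                          ≈⟨ h k ⟩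
          0# ∎)
          where k = punchOut p≢j

  abstract

    extendAll : ∀ {C} (𝔽 : Frame C) B → ∃ λ (𝔽′ : Frame (B ++ C)) → Frame.dim 𝔽′ ℕ.≤ Frame.dim 𝔽
    extendAll 𝔽 []      = 𝔽 , ℕ.≤-refl
    extendAll 𝔽 (β ∷ B) = let 𝔽₁ , le₁ = extendAll 𝔽 B ; 𝔽₂ , le₂ , _ = extend 𝔽₁ β in 𝔽₂ , ℕ.≤-trans le₂ le₁

    frame : ∀ B → Frame B
    frame []      = emptyFrame
    frame (β ∷ B) = proj₁ (extend (frame B) β)

  Nonzero : Pred Form ℓ₁
  Nonzero α = ¬ (∀ i → α i ≈ 0#)

  abstract

    hyperplaneFrame : ∀ {H} → Nonzero H → ∃ λ (𝔽 : Frame (H ∷ [])) → Frame.dim 𝔽 ℕ.< ℓ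
    hyperplaneFrame {H} H≉0 = let 𝔽 , _ , lt = extend emptyFrame H in
      𝔽 , lt (λ z → H≉0 (λ i → trans (sym (∙-δ H i)) (z i)))

  Span-of-vanishing : ∀ {B α} → Vanishing B ⊆ ker α → Span B α
  Span-of-vanishing {B} {α} inc = spans α (λ j → inc (vanish j))
    where open Frame (frame B)

  Span₁ : ∀ {α β} → Span (β ∷ []) α → ∃ λ a → ∀ i → α i ≈ a * β i
  Span₁ (member (here ≡.refl)) = 1# , λ i → sym (*-identityˡ _)
  Span₁ null          = 0# , λ i → sym (zeroˡ _)
  Span₁ (plus s t)    = let a , p = Span₁ s ; b , q = Span₁ t in
                        a + b , λ i → trans (+-cong (p i) (q i)) (sym (distribʳ _ a b))
  Span₁ (times a s)   = let b , p = Span₁ s in a * b , λ i → trans (*-congˡ (p i)) (sym (*-assoc a b _))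
  Span₁ (respect e s) = let a , p = Span₁ s in a , λ i → trans (sym (e i)) (p i)

  Span₂ : ∀ {α β γ} → Span (β ∷ γ ∷ []) α → ∃ λ a → ∃ λ b → ∀ i → α i ≈ a * β i + b * γ i
  Span₂ {α} {β} {γ} (member (here ≡.refl))         = 1# , 0# , λ i → solve 2 (λ x y → x := :1 :* x :+ :0 :* y) refl (β i) (γ i)
  Span₂ {α} {β} {γ} (member (there (here ≡.refl))) = 0# , 1# , λ i → solve 2 (λ x y → y := :0 :* x :+ :1 :* y) refl (β i) (γ i)
  Span₂ {α} {β} {γ} null = 0# , 0# , λ i → solve 2 (λ x y → :0 := :0 :* x :+ :0 :* y) refl (β i) (γ i)
  Span₂ {α} {β} {γ} (plus s t) = let a , b , p = Span₂ s ; a′ , b′ , q = Span₂ t in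
    a + a′ , b + b′ , λ i → trans (+-cong (p i) (q i))
      (solve 6 (λ a b a′ b′ x y → (a :* x :+ b :* y) :+ (a′ :* x :+ b′ :* y) := (a :+ a′) :* x :+ (b :+ b′) :* y)
        refl a b a′ b′ (β i) (γ i))
  Span₂ {α} {β} {γ} (times r s) = let a , b , p = Span₂ s in r * a , r * b , λ i → trans (*-congˡ (p i))
      (solve 5 (λ r a b x y → r :* (a :* x :+ b :* y) := (r :* a) :* x :+ (r :* b) :* y) refl r a b (β i) (γ i))
  Span₂ (respect e s) = let a , b , p = Span₂ s in a , b , λ i → trans (sym (e i)) (p i)

  ker-antisym : ∀ {α β} → Nonzero α → ker β ⊆ ker α → ker α ≐ ker β
  ker-antisym {α} {β} α≉0 β⊆α = (λ {v} v∈α → α⊆β v v∈α) , β⊆α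
    where
    multiple = Span₁ (Span-of-vanishing {β ∷ []} {α} (λ h → β⊆α (h (here ≡.refl))))
    a = proj₁ multiple
    a≉0 : ¬ a ≈ 0#
    a≉0 a≈0 = α≉0 (λ i → trans (proj₂ multiple i) (trans (*-congʳ a≈0) (zeroˡ _)))
    α⊆β : ∀ v → α ∙ v ≈ 0# → β ∙ v ≈ 0#
    α⊆β v v∈α = [ (λ a≈0 → contradiction a≈0 a≉0) ,
                  (λ reg → reg (β ∙ v) (trans (sym (trans (∙-cong (proj₂ multiple) (λ _ → refl)) (∙-*ˡ a β v))) v∈α)) ]′
                (integral a)

  separate : ∀ {α β} → Nonzero α → ¬ (ker β ≐ ker α) → ∃ λ v → α ∙ v ≈ 1# × β ∙ v ≈ 0#
  separate {α} {β} α≉0 β≠α with ∀⊎∃ (λ j → isZero? (α ∙ Frame.w (frame (β ∷ [])) j))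
  ... | inj₁ zeros = ⊥-elim (β≠α (proj₂ kers , proj₁ kers))
    where
    kers : ker α ≐ ker β
    kers = ker-antisym {α} {β} α≉0 λ {v} v∈β →
      Span-vanishing (Frame.spans (frame (β ∷ [])) α zeros) λ { (here ≡.refl) → v∈β }
  ... | inj₂ (j , ≉0) = let b , e = inverse ≉0 in
          (λ i → b * w j i) , trans (∙-*ʳ b α (w j)) e ,
          trans (∙-*ʳ b β (w j)) (trans (*-congˡ (vanish j (here ≡.refl))) (zeroʳ b))
    where open Frame (frame (β ∷ []))

  normalize : ∀ {α} → Nonzero α → ∃ λ v → α ∙ v ≈ 1#
  normalize {α} α≉0 with ∀⊎∃ (λ j → isZero? (α j))
  ... | inj₁ zeros = contradiction zeros α≉0
  ... | inj₂ (j , ≉0) = let b , e = inverse ≉0 in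
          (λ i → b * δ j i) , trans (∙-*ʳ b α (δ j)) (trans (*-congˡ (∙-δ α j)) e)

module LinearPolynomials {c ℓ₁ ℓ₂} (F : HeytingField c ℓ₁ ℓ₂) (n : ℕ) where

  open Arrangements F n using (scalars; S; toPoly; Form)
  private module K = CommutativeRing scalars
  open CommutativeRing S hiding (zero)
  open RingKit S
  open MvPolyKit scalars
  private
    module κ = Hom (constHom n)
    module 𝐊 = RingKit scalars

  toPoly-cong : ∀ {α β} → (∀ i → α i K.≈ β i) → toPoly α ≈ toPoly β
  toPoly-cong e = ∙-cong (λ i → κ.cong (e i)) (λ _ → refl)

  toPoly-0 : toPoly (λ _ → K.0#) ≈ 0#
  toPoly-0 = ∙-zeroˡ (var scalars {n}) (λ _ → κ.0-homo)

  toPoly-+ : ∀ α β → toPoly (λ i → α i K.+ β i) ≈ toPoly α + toPoly β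
  toPoly-+ α β = trans (∙-cong (λ i → κ.+-homo (α i) (β i)) (λ _ → refl)) (∙-+ˡ (const scalars {n} ∘ α) (const scalars {n} ∘ β) (var scalars {n}))

  toPoly-* : ∀ a α → toPoly (λ i → a K.* α i) ≈ const scalars {n} a * toPoly α
  toPoly-* a α = trans (∙-cong (λ i → κ.*-homo a (α i)) (λ _ → refl)) (∙-*ˡ (const scalars {n} a) (const scalars {n} ∘ α) (var scalars {n}))

  toPoly-neg : ∀ α → toPoly (λ i → K.- α i) ≈ - toPoly α
  toPoly-neg α = trans (∙-cong (λ i → κ.neg-homo (α i)) (λ _ → refl)) (∙-negˡ (const scalars {n} ∘ α) (var scalars {n}))

  toPoly-∑ : ∀ {m} (a : Vector K.Carrier m) (β : Fin m → Form) →
             toPoly (λ i → 𝐊.∑ (λ j → a j K.* β j i)) ≈ (const scalars {n} ∘ a) ∙ (λ j → toPoly (β j))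
  toPoly-∑ a β = trans
    (∙-cong (λ i → trans (κ.∑-homo (λ j → a j K.* β j i)) (sum-cong-≋ (λ j → κ.*-homo (a j) (β j i)))) (λ _ → refl))
    (∙-∑ (const scalars {n} ∘ a) (λ j i → const scalars {n} (β j i)) (var scalars {n}))

  toPoly-δ : ∀ i → toPoly (𝐊.δ i) ≈ var scalars {n} i
  toPoly-δ i = trans (∙-cong (λ j → κ.δ-homo i j) (λ _ → refl)) (∑-δ i (var scalars {n}))

  module _ {m ℓm} {M : CommutativeRing m ℓm} where
    private module M = CommutativeRing M

    image-toPoly : (f : Hom S M) → ∀ α → Hom.⟦_⟧ f (toPoly α) M.≈
      RingKit._∙_ M (λ i → Hom.⟦_⟧ f (const scalars {n} (α i))) (λ i → Hom.⟦_⟧ f (var scalars {n} i))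
    image-toPoly f α = Hom.∙-homo f (const scalars {n} ∘ α) (var scalars {n})

    evaluate-toPoly : (h : Hom scalars M) → ∀ x α → Hom.⟦_⟧ (evaluate h {n} x) (toPoly α) M.≈
      RingKit._∙_ M (λ i → Hom.⟦_⟧ h (α i)) x
    evaluate-toPoly h x α = M.trans (image-toPoly (evaluate h x) α)
      (RingKit.∙-cong M (λ i → evaluate-const h x (α i)) (evaluate-var h x))

module RestrictionToSubspace (em : ∀ {a} → ExcludedMiddle a) {c ℓ₁ ℓ₂} (F : HeytingField c ℓ₁ ℓ₂) (ℓ : ℕ) where

  open Arrangements F ℓ
  open LinearForms em F ℓ
  open LinearPolynomials F ℓ public
  private module K = CommutativeRing scalars
  open CommutativeRing S hiding (zero)
  open Ideals S using (IsIdeal; ⟨_⟩; gen; zer; add; mul; resp)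
  open IdealKit S
  open RingKit S
  open MvPolyKit scalars
  private
    module κ = Hom (constHom ℓ)
    module 𝐊 = RingKit scalars

  Span⊆ : ∀ {p} {I : Pred Carrier p} → IsIdeal I → ∀ {B} → (∀ {β} → β ∈ˡ B → toPoly β ∈ I) →
          ∀ {α} → Span B α → toPoly α ∈ I
  Span⊆ {I = I} ideal {B} h = go
    where
    open IsIdeal ideal
    go : ∀ {α} → Span B α → toPoly α ∈ I
    go (member p)             = h p
    go null                   = I-resp (sym toPoly-0) I-zero
    go (plus {α} {β} s t)     = I-resp (sym (toPoly-+ α β)) (I-add (go s) (go t))
    go (times a {β} s)        = I-resp (sym (toPoly-* a β)) (I-mul _ (go s))
    go (respect e s)          = I-resp (toPoly-cong e) (go s)

  module Restriction {B} (𝔽 : Frame B) where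

    open Frame 𝔽 public
    private
      module E = LinearPolynomials F dim
    Sᵉ = MvPoly scalars dim
    private module 𝐄 = CommutativeRing Sᵉ
    linear : Vector K.Carrier dim → 𝐄.Carrier
    linear = Arrangements.toPoly F dim

    ρ : Hom S Sᵉ
    ρ = evaluate (constHom dim) (λ i → linear (λ j → w j i))
    module ρ = Hom ρ

    σ : Hom Sᵉ S
    σ = evaluate (constHom ℓ) (λ j → toPoly (y j))
    module σ = Hom σ

    ρ-toPoly : ∀ α → ρ.⟦ toPoly α ⟧ 𝐄.≈ linear (λ j → α 𝐊.∙ w j)
    ρ-toPoly α = 𝐄.trans (evaluate-toPoly (constHom dim) _ α)
      (𝐄.trans (𝐄.sym (E.toPoly-∑ α (λ i j → w j i))) (E.toPoly-cong (λ j → K.refl)))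

    ρ-const : ∀ a → ρ.⟦ const scalars {ℓ} a ⟧ 𝐄.≈ const scalars {dim} a
    ρ-const = evaluate-const (constHom dim) (λ i → linear (λ j → w j i))

    linear-injective : ∀ β → linear β 𝐄.≈ 𝐄.0# → ∀ j → β j K.≈ K.0#
    linear-injective β z j = K.trans (K.sym (𝐊.∙-δ β j))
      (K.trans (K.sym (E.evaluate-toPoly idHom (𝐊.δ j) β))
        (K.trans (Hom.cong (evaluate idHom (𝐊.δ j)) z) (Hom.0-homo (evaluate idHom {dim} (𝐊.δ j)))))

    ρσ : ∀ p → ρ.⟦ σ.⟦ p ⟧ ⟧ 𝐄.≈ p
    ρσ = hom-unique (ρ ∘ᴴ σ) idHom
      (λ a → 𝐄.trans (ρ.cong (evaluate-const (constHom ℓ) (λ j → toPoly (y j)) a)) (ρ-const a))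
      (λ j → 𝐄.trans (ρ.cong (evaluate-var (constHom ℓ) (λ j → toPoly (y j)) j))
        (𝐄.trans (ρ-toPoly (y j)) (𝐄.trans (E.toPoly-cong (dual j)) (E.toPoly-δ j))))

    module _ {p} {I : Pred Carrier p} (ideal : IsIdeal I)
      (forms⊆ : ∀ α → (∀ j → α 𝐊.∙ w j K.≈ K.0#) → toPoly α ∈ I) where

      open IsIdeal ideal

      id-σρ : ∀ x → x - σ.⟦ ρ.⟦ x ⟧ ⟧ ∈ I
      id-σρ = generation ℓ (λ x → x - σ.⟦ ρ.⟦ x ⟧ ⟧ ∈ I)
        (λ e → I-resp (+-cong e (-‿cong (σ.cong (ρ.cong e)))))
        (λ {x} {y} p q → I-resp
          (trans (solve 4 (λ x y x′ y′ → (x :- x′) :+ (y :- y′) := (x :+ y) :- (x′ :+ y′)) refl x y _ _)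
            (+-congˡ (-‿cong (sym (trans (σ.cong (ρ.+-homo x y)) (σ.+-homo _ _))))))
          (I-add p q))
        (λ {x} {y} p q → I-resp
          (trans (solve 4 (λ x y x′ y′ → y :* (x :- x′) :+ x′ :* (y :- y′) := (x :* y) :- (x′ :* y′)) refl x y _ _)
            (+-congˡ (-‿cong (sym (trans (σ.cong (ρ.*-homo x y)) (σ.*-homo _ _))))))
          (I-add (I-mul y p) (I-mul _ q)))
        (λ a → I-resp (sym (x≈y⇒x-y≈0 (sym (trans (σ.cong (ρ-const a)) (evaluate-const (constHom ℓ) (λ j → toPoly (y j)) a)))))
          I-zero)
        variable-case
        where
        variable-case : ∀ i → var scalars {ℓ} i - σ.⟦ ρ.⟦ var scalars {ℓ} i ⟧ ⟧ ∈ I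
        variable-case i = I-resp (sym eq) (forms⊆ (remainder (𝐊.δ i)) (remainder-vanishes (𝐊.δ i)))
          where
          open Relation.Binary.Reasoning.Setoid setoid
          eq : var scalars {ℓ} i - σ.⟦ ρ.⟦ var scalars {ℓ} i ⟧ ⟧ ≈ toPoly (remainder (𝐊.δ i))
          eq = sym (begin
            toPoly (remainder (𝐊.δ i))
              ≈⟨ toPoly-+ (𝐊.δ i) (λ k → K.- 𝐊.∑ (λ j → (𝐊.δ i 𝐊.∙ w j) K.* y j k)) ⟩
            toPoly (𝐊.δ i) + toPoly (λ k → K.- 𝐊.∑ (λ j → (𝐊.δ i 𝐊.∙ w j) K.* y j k))
              ≈⟨ +-cong (toPoly-δ i) (trans (toPoly-neg _) (-‿cong (toPoly-∑ (λ j → 𝐊.δ i 𝐊.∙ w j) y))) ⟩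
            var scalars {ℓ} i - (λ j → const scalars {ℓ} (𝐊.δ i 𝐊.∙ w j)) ∙ (λ j → toPoly (y j))
              ≈⟨ +-congˡ (-‿cong (∙-cong (λ j → κ.cong (𝐊.∑-δ i (w j))) (λ _ → refl))) ⟩
            var scalars {ℓ} i - (λ j → const scalars {ℓ} (w j i)) ∙ (λ j → toPoly (y j))
              ≈⟨ +-congˡ (-‿cong (E.evaluate-toPoly (constHom ℓ) (λ j → toPoly (y j)) (λ j → w j i))) ⟨
            var scalars {ℓ} i - σ.⟦ linear (λ j → w j i) ⟧
              ≈⟨ +-congˡ (-‿cong (σ.cong (evaluate-var (constHom dim) (λ i → linear (λ j → w j i)) i))) ⟨
            var scalars {ℓ} i - σ.⟦ ρ.⟦ var scalars {ℓ} i ⟧ ⟧ ∎)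

      kernel⊆ : ∀ {x} → ρ.⟦ x ⟧ 𝐄.≈ 𝐄.0# → x ∈ I
      kernel⊆ {x} z = I-resp (trans (+-congˡ (-‿cong (trans (σ.cong z) σ.0-homo))) (x-0≈x x)) (id-σρ x)

    Kernel : Pred Carrier ℓ₁
    Kernel x = ρ.⟦ x ⟧ 𝐄.≈ 𝐄.0#

    vanishing⇒Kernel : ∀ α → (∀ j → α 𝐊.∙ w j K.≈ K.0#) → toPoly α ∈ Kernel
    vanishing⇒Kernel α h = 𝐄.trans (ρ-toPoly α) (𝐄.trans (E.toPoly-cong h) E.toPoly-0)

    Kernel⇒vanishing : ∀ α → toPoly α ∈ Kernel → ∀ j → α 𝐊.∙ w j K.≈ K.0#
    Kernel⇒vanishing α z = linear-injective (λ j → α 𝐊.∙ w j) (𝐄.trans (𝐄.sym (ρ-toPoly α)) z)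

    Kernel⇒Span : ∀ α → toPoly α ∈ Kernel → Span B α
    Kernel⇒Span α z = spans α (Kernel⇒vanishing α z)

    form∈Kernel : ∀ {β} → β ∈ˡ B → toPoly β ∈ Kernel
    form∈Kernel {β} p = vanishing⇒Kernel β (λ j → vanish j p)

    Kernel-isPrime : Ideals.IsPrime S Kernel
    Kernel-isPrime = record
      { isIdeal = record
        { I-resp = λ e p → 𝐄.trans (ρ.cong (sym e)) p
        ; I-zero = ρ.0-homo
        ; I-add  = λ p q → 𝐄.trans (ρ.+-homo _ _) (𝐄.trans (𝐄.+-cong p q) (𝐄.+-identityˡ _))
        ; I-mul  = λ r p → 𝐄.trans (ρ.*-homo _ _) (𝐄.trans (𝐄.*-congˡ p) (𝐄.zeroʳ _))
        }
      ; proper  = λ e → KrullDimension.1≉0-MvPoly em scalars inverses 1≉0 dim (𝐄.trans (𝐄.sym ρ.1-homo) e)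
      ; prime   = λ {x} {y} p → [ inj₁ , (λ reg → inj₂ (reg ρ.⟦ y ⟧ (𝐄.trans (𝐄.sym (ρ.*-homo x y)) p))) ]′
                    (integral-MvPoly integral dim ρ.⟦ x ⟧)
      }

    open Ideals.IsPrime Kernel-isPrime public using () renaming (isIdeal to Kernel-isIdeal)

    Kernel⊆ : ∀ {p} {I : Pred Carrier p} → IsIdeal I → (∀ {β} → β ∈ˡ B → toPoly β ∈ I) → Kernel ⊆ I
    Kernel⊆ ideal h = kernel⊆ ideal (λ α z → Span⊆ ideal h (spans α z))

  _∣_ : Carrier → Pred Carrier (c ⊔ ℓ₁)
  a ∣ x = ∃ λ q → x ≈ a * q

  ∣-isIdeal : ∀ a → IsIdeal (a ∣_)
  ∣-isIdeal a = record
    { I-resp = λ { e (q , p) → q , trans (sym e) p }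
    ; I-zero = 0# , sym (zeroʳ a)
    ; I-add  = λ { (q , p) (r , p′) → q + r , trans (+-cong p p′) (sym (distribˡ a q r)) }
    ; I-mul  = λ { s (q , p) → s * q , trans (*-congˡ p) (solve 3 (λ s a q → s :* (a :* q) := a :* (s :* q)) refl s a q) }
    }

  ⟨⟩⇒∣ : ∀ {a x} → x ∈ ⟨ (λ s → s ≈ a) ⟩ → a ∣ x
  ⟨⟩⇒∣ {a} (gen e)    = 1# , trans e (sym (*-identityʳ a))
  ⟨⟩⇒∣ {a} zer        = IsIdeal.I-zero (∣-isIdeal a)
  ⟨⟩⇒∣ {a} (add p q)  = IsIdeal.I-add (∣-isIdeal a) (⟨⟩⇒∣ p) (⟨⟩⇒∣ q)
  ⟨⟩⇒∣ {a} (mul r p)  = IsIdeal.I-mul (∣-isIdeal a) r (⟨⟩⇒∣ p)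
  ⟨⟩⇒∣ {a} (resp e p) = IsIdeal.I-resp (∣-isIdeal a) e (⟨⟩⇒∣ p)

  ∣⇒⟨⟩ : ∀ {a x} → a ∣ x → x ∈ ⟨ (λ s → s ≈ a) ⟩
  ∣⇒⟨⟩ {a} (q , e) = resp (trans (*-comm q a) (sym e)) (mul q (gen refl))

  1≉0-S : ¬ 1# ≈ 0#
  1≉0-S = KrullDimension.1≉0-MvPoly em scalars inverses 1≉0 ℓ

  integral-S : Integral S
  integral-S = integral-MvPoly integral ℓ

  -- Its Kernel is the ideal generated by the forms in B.
  module ⟪_⟫ (B : List Form) = Restriction (frame B)

  Kernel₁⇒∣ : ∀ {α} → ⟪_⟫.Kernel (α ∷ []) ⊆ (toPoly α ∣_)
  Kernel₁⇒∣ {α} = ⟪_⟫.Kernel⊆ (α ∷ []) (∣-isIdeal (toPoly α)) λ { (here ≡.refl) → 1# , sym (*-identityʳ _) }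

  ∣⇒Kernel₁ : ∀ {α} → (toPoly α ∣_) ⊆ ⟪_⟫.Kernel (α ∷ [])
  ∣⇒Kernel₁ {α} (q , e) = I-resp (sym e) (I-mulʳ (⟪_⟫.Kernel-isIdeal (α ∷ [])) q (⟪_⟫.form∈Kernel (α ∷ []) (here ≡.refl)))
    where open IsIdeal (⟪_⟫.Kernel-isIdeal (α ∷ []))

  toPoly-prime : ∀ α {x y} → toPoly α ∣ (x * y) → toPoly α ∣ x ⊎ toPoly α ∣ y
  toPoly-prime α d = [ inj₁ ∘ Kernel₁⇒∣ , inj₂ ∘ Kernel₁⇒∣ ]′
    (Ideals.IsPrime.prime (⟪_⟫.Kernel-isPrime (α ∷ [])) (∣⇒Kernel₁ d))

  ∣-toPoly⇒ker⊆ : ∀ {α β} → toPoly α ∣ toPoly β → ker α ⊆ ker β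
  ∣-toPoly⇒ker⊆ {α} {β} d v∈α = Span-vanishing (⟪_⟫.Kernel⇒Span (α ∷ []) β (∣⇒Kernel₁ d)) λ { (here ≡.refl) → v∈α }

  toPoly≉0 : ∀ {α} → Nonzero α → ¬ toPoly α ≈ 0#
  toPoly≉0 {α} α≉0 e = α≉0 λ i → K.trans (K.sym (𝐊.∙-δ α i)) (Kernel⇒vanishing α (trans′ (ρ.cong e) ρ.0-homo) i)
    where
    open Restriction emptyFrame
    trans′ = CommutativeRing.trans Sᵉ

module ResidueIdeals (em : ∀ {a} → ExcludedMiddle a) {c ℓ₁ ℓ₂} (F : HeytingField c ℓ₁ ℓ₂) (ℓ : ℕ) where

  open Arrangements F ℓ
  open Residues em
  open LinearForms em F ℓ
  open RestrictionToSubspace em F ℓ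
  private module K = CommutativeRing scalars
  open CommutativeRing S hiding (zero)
  open Ideals S using (IsIdeal; mod)
  open IdealKit S
  open RingKit S
  open MvPolyKit scalars
  open Relation.Binary.Reasoning.Setoid setoid
  private
    module κ = Hom (constHom ℓ)
    module 𝐊 = RingKit scalars

  κ : K.Carrier → Carrier
  κ = const scalars {ℓ}

  infix 9 _⌟_
  _⌟_ : Ω¹ → V → Carrier
  η ⌟ v = η ∙ (κ ∘ v)

  form-⌟ : ∀ α v → (κ ∘ α) ⌟ v ≈ κ (α 𝐊.∙ v)
  form-⌟ α v = sym (κ.∙-homo α v)

  minor : Ω¹ → Form → Fin ℓ → Fin ℓ → Carrier
  minor η α i j = η i * κ (α j) - η j * κ (α i)

  Log⇒minor : ∀ {A η L} → η ∈ Log A → L ∈ˡ forms A → ∀ i j → toPoly L ∣ minor η L i j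
  Log⇒minor {A} {η} {L} h L∈A i j with All.lookup h L∈A | Fin.<-cmp i j
  ... | ξ , e | tri< i<j _ _ = ξ i j i<j , e i j i<j
  ... | _     | tri≈ _ ≡.refl _ = I-resp (sym (-‿inverseʳ _)) I-zero
    where open IsIdeal (∣-isIdeal (toPoly L))
  ... | ξ , e | tri> _ _ j<i = I-resp
        (solve 4 (λ x y z w → :- (x :* y :- z :* w) := z :* w :- x :* y) refl (η j) (κ (L i)) (η i) (κ (L j)))
        (I-neg (∣-isIdeal (toPoly L)) (ξ j i j<i , e j i j<i))
    where open IsIdeal (∣-isIdeal (toPoly L))

  minor⇒Log : ∀ A {η} → (∀ {L} → L ∈ˡ forms A → ∀ i j → toPoly L ∣ minor η L i j) → η ∈ Log A
  minor⇒Log A h = All.tabulate λ L∈A → (λ i j _ → proj₁ (h L∈A i j)) , λ i j _ → proj₂ (h L∈A i j)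

  nonzero′ : ∀ A {L} → L ∈ˡ forms A → Nonzero L
  nonzero′ A = All.lookup (nonzero A)

  pivot : ∀ {α} → Nonzero α → ∃ λ j → ∃ λ b → b K.* α j K.≈ K.1#
  pivot {α} α≉0 with ∀⊎∃ (λ j → isZero? (α j))
  ... | inj₁ zeros     = contradiction zeros α≉0
  ... | inj₂ (j , ≉0) = j , inverse ≉0

  -- Contraction of η ∧ dα_L with a derivation that preserves the ideal (α_L).
  contraction : ∀ A {η L} → η ∈ Log A → L ∈ˡ forms A → ∀ θ → toPoly L ∣ ((κ ∘ L) ∙ θ) → toPoly L ∣ (η ∙ θ)
  contraction A {η} {L} h L∈A θ d with pivot (nonzero′ A L∈A)
  ... | j , b , bL≈1 = I-resp unit (I-mul (κ b) scaled)
    where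
    ideal = ∣-isIdeal (toPoly L)
    open IsIdeal ideal
    unit : κ b * ((η ∙ θ) * κ (L j)) ≈ η ∙ θ
    unit = trans (solve 3 (λ b x l → b :* (x :* l) := (b :* l) :* x) refl (κ b) (η ∙ θ) (κ (L j)))
      (trans (*-congʳ (trans (sym (κ.*-homo b (L j))) (trans (κ.cong bL≈1) κ.1-homo))) (*-identityˡ _))
    scaled : toPoly L ∣ ((η ∙ θ) * κ (L j))
    scaled = I-resp eq (I-add (I-∑ ideal {f = λ i → θ i * minor η L i j} (λ i → I-mul (θ i) (Log⇒minor {A} {η} h L∈A i j))) (I-mul (η j) d))
      where
      eq : ∑ (λ i → θ i * minor η L i j) + η j * ((κ ∘ L) ∙ θ) ≈ (η ∙ θ) * κ (L j)
      eq = begin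
        ∑ (λ i → θ i * minor η L i j) + η j * ((κ ∘ L) ∙ θ)
          ≈⟨ +-congˡ (*-distribˡ-sum (η j) (λ i → κ (L i) * θ i)) ⟩
        ∑ (λ i → θ i * minor η L i j) + ∑ (λ i → η j * (κ (L i) * θ i))
          ≈⟨ ∑-distrib-+ (λ i → θ i * minor η L i j) (λ i → η j * (κ (L i) * θ i)) ⟨
        ∑ (λ i → θ i * minor η L i j + η j * (κ (L i) * θ i))
          ≈⟨ sum-cong-≋ (λ i → solve 5 (λ t n l n′ l′ → t :* (n :* l :- n′ :* l′) :+ n′ :* (l′ :* t) := (n :* t) :* l) refl
               (θ i) (η i) (κ (L j)) (η j) (κ (L i))) ⟩
        ∑ (λ i → (η i * θ i) * κ (L j))
          ≈⟨ *-distribʳ-sum (κ (L j)) (λ i → η i * θ i) ⟨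
        (η ∙ θ) * κ (L j) ∎

  contraction-vector : ∀ A {η L} → η ∈ Log A → L ∈ˡ forms A → ∀ v → L 𝐊.∙ v K.≈ K.0# → toPoly L ∣ (η ⌟ v)
  contraction-vector A {η} {L} h L∈A v z = contraction A {η} {L} h L∈A (κ ∘ v)
    (I-resp (sym (trans (form-⌟ L v) (trans (κ.cong z) κ.0-homo))) I-zero)
    where open IsIdeal (∣-isIdeal (toPoly L))

  ⌟-sub : ∀ η u v → η ⌟ (λ i → u i K.- v i) ≈ η ⌟ u - η ⌟ v
  ⌟-sub η u v = trans (∙-cong (λ _ → refl) (λ i → κ.sub-homo (u i) (v i)))
    (trans (∙-+ʳ η (κ ∘ u) (λ i → - κ (v i))) (+-congˡ (∙-negʳ η (κ ∘ v))))

  ⌟-independent : ∀ A {η H} → η ∈ Log A → H ∈ˡ forms A → ∀ u v → H 𝐊.∙ u K.≈ H 𝐊.∙ v →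
                  toPoly H ∣ (η ⌟ u - η ⌟ v)
  ⌟-independent A {η} {H} h H∈A u v e = I-resp (⌟-sub η u v) (contraction-vector A {η} {H} h H∈A (λ i → u i K.- v i)
    (K.trans (𝐊.∙-+ʳ H u (λ i → K.- v i)) (K.trans (K.+-congˡ (𝐊.∙-negʳ H v)) (𝐊.x≈y⇒x-y≈0 e))))
    where open IsIdeal (∣-isIdeal (toPoly H))

  dualVector : ∀ {β} → IsBasis β → ∀ i₀ → ∃ λ u → ∀ m → β m 𝐊.∙ u K.≈ 𝐊.δ m i₀
  dualVector {β} (spanning , independent) i₀ = u , λ m →
    𝐊.x-y≈0⇒x≈y (independent (b m) (b-relation m) i₀)
    where
    a : Fin ℓ → Vector K.Carrier ℓ
    a j = proj₁ (spanning (𝐊.δ j))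
    u = λ j → a j i₀
    b = λ m i → β m 𝐊.∙ (λ j → a j i) K.- 𝐊.δ m i
    b-relation : ∀ m k → 𝐊.∑ (λ i → b m i K.* β i k) K.≈ K.0#
    b-relation m k = let module R = Relation.Binary.Reasoning.Setoid K.setoid in R.begin
      b m 𝐊.∙ (λ i → β i k)
        R.≈⟨ 𝐊.∙-+ˡ (λ i → β m 𝐊.∙ (λ j → a j i)) (λ i → K.- 𝐊.δ m i) (λ i → β i k) ⟩
      (λ i → β m 𝐊.∙ (λ j → a j i)) 𝐊.∙ (λ i → β i k) K.+ (λ i → K.- 𝐊.δ m i) 𝐊.∙ (λ i → β i k)
        R.≈⟨ K.+-cong (𝐊.∙-∑ (β m) a (λ i → β i k)) (K.trans (𝐊.∙-negˡ (𝐊.δ m) (λ i → β i k)) (K.-‿cong (𝐊.∑-δ m (λ i → β i k)))) ⟩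
      β m 𝐊.∙ (λ j → a j 𝐊.∙ (λ i → β i k)) K.- β m k
        R.≈⟨ K.+-congʳ (𝐊.∙-cong {u = β m} (λ _ → K.refl) (λ j → K.trans (K.sym (proj₂ (spanning (𝐊.δ j)) k)) (𝐊.δ-sym j k))) ⟩
      β m 𝐊.∙ 𝐊.δ k K.- β m k
        R.≈⟨ 𝐊.x≈y⇒x-y≈0 (𝐊.∙-δ (β m) k) ⟩
      K.0# R.∎

  ≈̄⇒∣ : ∀ {H x y} → CommutativeRing._≈_ (S̄ H) x y → toPoly H ∣ (x - y)
  ≈̄⇒∣ (mod d) = ⟨⟩⇒∣ d

  ∣⇒≈̄ : ∀ {H x y} → toPoly H ∣ (x - y) → CommutativeRing._≈_ (S̄ H) x y
  ∣⇒≈̄ d = mod (∣⇒⟨⟩ d)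

  IsResidue⇒ : ∀ A {H η r} → H ∈ˡ forms A → η ∈ Log A → IsResidue A H η r → ∀ v → H 𝐊.∙ v K.≈ K.1# →
               toPoly H ∣ (product (restriction A H) * r - η ⌟ v)
  IsResidue⇒ A {H} {η} {r} H∈A h (β , i₀ , g , basis , β≈H , η≈ , res) v Hv≈1 =
    I-resp (trans (+-congˡ (+-congʳ η⌟u)) (solve 3 (λ x y z → (x :- y) :+ (y :- z) := x :- z) refl _ (g i₀) (η ⌟ v)))
      (I-add (≈̄⇒∣ {H} res) (⌟-independent A {η} {H} h H∈A u v (K.trans Hu≈1 (K.sym Hv≈1))))
    where
    open IsIdeal (∣-isIdeal (toPoly H))
    u = proj₁ (dualVector basis i₀)
    dual = proj₂ (dualVector basis i₀)
    Hu≈1 : H 𝐊.∙ u K.≈ K.1#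
    Hu≈1 = K.trans (𝐊.∙-cong (λ j → K.sym (β≈H j)) (λ _ → K.refl)) (K.trans (dual i₀) (𝐊.δ-diag i₀))
    η⌟u : η ⌟ u ≈ g i₀
    η⌟u = begin
      η ⌟ u                                        ≈⟨ ∙-cong η≈ (λ _ → refl) ⟩
      (λ j → ∑ (λ i → g i * κ (β i j))) ⌟ u        ≈⟨ ∙-∑ g (λ i j → κ (β i j)) (κ ∘ u) ⟩
      g ∙ (λ i → (κ ∘ β i) ⌟ u)                    ≈⟨ ∙-cong {u = g} (λ _ → refl) (λ i → trans (form-⌟ (β i) u)
                                                       (trans (κ.cong (K.trans (dual i) (𝐊.δ-sym i i₀))) (κ.δ-homo i₀ i))) ⟩
      g ∙ δ i₀                                     ≈⟨ ∙-δ g i₀ ⟩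
      g i₀ ∎

  ⇒IsResidue : ∀ A {H η r} → H ∈ˡ forms A → η ∈ Log A → ∀ v → H 𝐊.∙ v K.≈ K.1# →
               toPoly H ∣ (product (restriction A H) * r - η ⌟ v) → IsResidue A H η r
  ⇒IsResidue A {H} {η} {r} H∈A hη v Hv≈1 d with pivot (nonzero′ A H∈A)
  ... | p , h , hH≈1 = β , p , g , (spanning , independent) , β≈H , η≈ , ∣⇒≈̄ {H} residue
    where
    open IsIdeal (∣-isIdeal (toPoly H))
    x = λ j → H j K.- 𝐊.δ p j
    β : Fin ℓ → Form
    β i j = 𝐊.δ i j K.+ 𝐊.δ p i K.* x j

    combine : ∀ (a : Vector K.Carrier ℓ) j → 𝐊.∑ (λ i → a i K.* β i j) K.≈ a j K.+ a p K.* x j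
    combine a j = K.trans (𝐊.∙-+ʳ a (λ i → 𝐊.δ i j) (λ i → 𝐊.δ p i K.* x j))
      (K.+-cong (K.trans (𝐊.∙-cong {u = a} (λ _ → K.refl) (λ i → 𝐊.δ-sym i j)) (𝐊.∙-δ a j))
        (K.trans (𝐊.sum-cong-≋ (λ i → K.sym (K.*-assoc (a i) (𝐊.δ p i) (x j))))
          (K.trans (K.sym (𝐊.*-distribʳ-sum (x j) (λ i → a i K.* 𝐊.δ p i))) (K.*-congʳ (𝐊.∙-δ a p)))))

    combineˢ : ∀ (a : Vector Carrier ℓ) j → ∑ (λ i → a i * κ (β i j)) ≈ a j + a p * κ (x j)
    combineˢ a j = trans
      (∙-cong {u = a} (λ _ → refl) (λ i → trans (κ.+-homo _ _) (+-cong (κ.δ-homo i j) (trans (κ.*-homo _ _) (*-congʳ (κ.δ-homo p i))))))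
      (trans (∙-+ʳ a (λ i → δ i j) (λ i → δ p i * κ (x j)))
        (+-cong (trans (∙-cong {u = a} (λ _ → refl) (λ i → δ-sym i j)) (∙-δ a j))
          (trans (sum-cong-≋ (λ i → sym (*-assoc (a i) (δ p i) (κ (x j)))))
            (trans (sym (*-distribʳ-sum (κ (x j)) (λ i → a i * δ p i))) (*-congʳ (∙-δ a p))))))

    hx≈1-h : h K.* x p K.≈ K.1# K.- h
    hx≈1-h = K.trans (𝐊.solve 3 (λ h H d → h 𝐊.:* (H 𝐊.:- d) 𝐊.:= h 𝐊.:* H 𝐊.:- h 𝐊.:* d) K.refl h (H p) (𝐊.δ p p))
      (K.+-cong hH≈1 (K.-‿cong (K.trans (K.*-congˡ (𝐊.δ-diag p)) (K.*-identityʳ h))))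

    spanning : ∀ (γ : Form) → ∃ λ (a : Vector K.Carrier ℓ) → ∀ j → γ j K.≈ 𝐊.∑ (λ i → a i K.* β i j)
    spanning γ = a , λ j → K.sym (K.trans (combine a j) (K.trans (K.+-congˡ (K.*-congʳ ap))
        (𝐊.solve 2 (λ g y → (g 𝐊.:- y) 𝐊.:+ y 𝐊.:= g) K.refl (γ j) ((γ p K.* h) K.* x j))))
      where
      a = λ i → γ i K.- (γ p K.* h) K.* x i
      ap : a p K.≈ γ p K.* h
      ap = K.trans (K.+-congˡ (K.-‿cong (K.trans (K.*-assoc _ _ _) (K.*-congˡ hx≈1-h))))
        (𝐊.solve 2 (λ g h → g 𝐊.:- g 𝐊.:* (𝐊.:1 𝐊.:- h) 𝐊.:= g 𝐊.:* h) K.refl (γ p) h)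

    independent : ∀ (a : Vector K.Carrier ℓ) → (∀ j → 𝐊.∑ (λ i → a i K.* β i j) K.≈ K.0#) → ∀ i → a i K.≈ K.0#
    independent a z i = K.trans (K.sym (K.trans (K.+-congˡ (K.trans (K.*-congʳ ap≈0) (K.zeroˡ _))) (K.+-identityʳ _)))
      (K.trans (K.sym (combine a i)) (z i))
      where
      apH≈0 : a p K.* H p K.≈ K.0#
      apH≈0 = K.trans (K.sym (K.trans (K.+-congˡ (K.*-congˡ (K.+-congˡ (K.-‿cong (𝐊.δ-diag p)))))
        (𝐊.solve 2 (λ a H → a 𝐊.:+ a 𝐊.:* (H 𝐊.:- 𝐊.:1) 𝐊.:= a 𝐊.:* H) K.refl (a p) (H p))))
        (K.trans (K.sym (combine a p)) (z p))
      ap≈0 : a p K.≈ K.0#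
      ap≈0 = K.trans (K.sym (K.trans (K.*-congˡ hH≈1) (K.*-identityʳ _)))
        (K.trans (𝐊.solve 3 (λ a h H → a 𝐊.:* (h 𝐊.:* H) 𝐊.:= h 𝐊.:* (a 𝐊.:* H)) K.refl (a p) h (H p))
          (K.trans (K.*-congˡ apH≈0) (K.zeroʳ h)))

    β≈H : ∀ j → β p j K.≈ H j
    β≈H j = K.trans (K.+-congˡ (K.trans (K.*-congʳ (𝐊.δ-diag p)) (K.*-identityˡ _)))
      (𝐊.solve 2 (λ d H → d 𝐊.:+ (H 𝐊.:- d) 𝐊.:= H) K.refl (𝐊.δ p j) (H j))

    g : Vector Carrier ℓ
    g i = η i - (η p * κ h) * κ (x i)

    gp : g p ≈ η p * κ h
    gp = trans (+-congˡ (-‿cong (trans (*-assoc _ _ _) (*-congˡ (trans (sym (κ.*-homo h (x p)))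
        (trans (κ.cong hx≈1-h) (trans (κ.sub-homo K.1# h) (+-congʳ κ.1-homo))))))))
      (solve 2 (λ g h → g :- g :* (:1 :- h) := g :* h) refl (η p) (κ h))

    η≈ : ∀ j → η j ≈ ∑ (λ i → g i * κ (β i j))
    η≈ j = sym (trans (combineˢ g j) (trans (+-congˡ (*-congʳ gp))
      (solve 2 (λ g y → (g :- y) :+ y := g) refl (η j) ((η p * κ h) * κ (x j)))))

    u : V
    u i = h K.* 𝐊.δ p i

    η⌟u : η ⌟ u ≈ g p
    η⌟u = trans (∙-cong {u = η} (λ _ → refl) (λ i → trans (κ.*-homo _ _) (*-congˡ (κ.δ-homo p i))))
      (trans (∙-*ʳ (κ h) η (δ p)) (trans (*-congˡ (∙-δ η p)) (trans (*-comm _ _) (sym gp))))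

    residue : toPoly H ∣ (product (restriction A H) * r - g p)
    residue = I-resp (trans (solve 3 (λ x y z → (x :- y) :+ (y :- z) := x :- z) refl _ (η ⌟ v) (η ⌟ u)) (+-congˡ (-‿cong η⌟u)))
      (I-add d (⌟-independent A {η} {H} hη H∈A v u
        (K.trans Hv≈1 (K.sym (K.trans (𝐊.∙-*ʳ h H (𝐊.δ p)) (K.trans (K.*-congˡ (𝐊.∙-δ H p)) hH≈1))))))

  module _ (A : Arrangement) where

    Log-0 : (λ _ → 0#) ∈ Log A
    Log-0 = minor⇒Log A λ {L} L∈A i j → IsIdeal.I-resp (∣-isIdeal (toPoly L))
      (sym (solve 2 (λ x y → :0 :* x :- :0 :* y := :0) refl (κ (L j)) (κ (L i)))) (IsIdeal.I-zero (∣-isIdeal (toPoly L)))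

    Log-+ : ∀ {η ζ} → η ∈ Log A → ζ ∈ Log A → (λ i → η i + ζ i) ∈ Log A
    Log-+ {η} {ζ} p q = minor⇒Log A λ {L} L∈A i j → IsIdeal.I-resp (∣-isIdeal (toPoly L))
      (solve 6 (λ a b c d x y → (a :* x :- b :* y) :+ (c :* x :- d :* y) := (a :+ c) :* x :- (b :+ d) :* y) refl
        (η i) (η j) (ζ i) (ζ j) (κ (L j)) (κ (L i)))
      (IsIdeal.I-add (∣-isIdeal (toPoly L)) (Log⇒minor {A} {η} p L∈A i j) (Log⇒minor {A} {ζ} q L∈A i j))

    Log-* : ∀ s {η} → η ∈ Log A → (λ i → s * η i) ∈ Log A
    Log-* s {η} p = minor⇒Log A λ {L} L∈A i j → IsIdeal.I-resp (∣-isIdeal (toPoly L))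
      (solve 5 (λ s a b x y → s :* (a :* x :- b :* y) := (s :* a) :* x :- (s :* b) :* y) refl
        s (η i) (η j) (κ (L j)) (κ (L i)))
      (IsIdeal.I-mul (∣-isIdeal (toPoly L)) s (Log⇒minor {A} {η} p L∈A i j))

    module _ {H} (H∈A : H ∈ˡ forms A) where

      private
        J = residueIdeal A H
        𝐇 = ∣-isIdeal (toPoly H)
        module 𝐇 = IsIdeal 𝐇
        v = proj₁ (normalize (nonzero′ A H∈A))
        Hv≈1 = proj₂ (normalize (nonzero′ A H∈A))

      J-intro : ∀ {r η} v → H 𝐊.∙ v K.≈ K.1# → η ∈ Log A → toPoly H ∣ (product (restriction A H) * r - η ⌟ v) → r ∈ J
      J-intro {r} {η} v Hv≈1 h d = η , h , ⇒IsResidue A {H} {η} H∈A h v Hv≈1 d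

      J-elim : ∀ {r} v → H 𝐊.∙ v K.≈ K.1# → r ∈ J → ∃ λ η → η ∈ Log A × toPoly H ∣ (product (restriction A H) * r - η ⌟ v)
      J-elim {r} v Hv≈1 (η , h , res) = η , h , IsResidue⇒ A {H} {η} H∈A h res v Hv≈1

      J-H : ∀ {x} → toPoly H ∣ x → x ∈ J
      J-H {x} (q , e) = J-intro v Hv≈1 Log-0 (𝐇.I-resp
        (trans (sym (x-0≈x _)) (+-congˡ (-‿cong (sym (∙-zeroˡ (κ ∘ v) (λ _ → refl))))))
        (𝐇.I-mul (product (restriction A H)) (q , e)))

      J-isIdeal : IsIdeal J
      J-isIdeal = record
        { I-resp = λ {x} {y} e p → let η , h , d = J-elim v Hv≈1 p in
            J-intro v Hv≈1 h (𝐇.I-resp (+-congʳ (*-congˡ e)) d)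
        ; I-zero = J-H 𝐇.I-zero
        ; I-add  = λ {x} {y} p q → let η , h , d = J-elim v Hv≈1 p ; ζ , k , e = J-elim v Hv≈1 q in
            J-intro v Hv≈1 (Log-+ {η} {ζ} h k) (𝐇.I-resp
              (trans (solve 5 (λ Q x y a b → (Q :* x :- a) :+ (Q :* y :- b) := Q :* (x :+ y) :- (a :+ b)) refl _ x y (η ⌟ v) (ζ ⌟ v))
                (+-congˡ (-‿cong (sym (∙-+ˡ η ζ (κ ∘ v))))))
              (𝐇.I-add d e))
        ; I-mul  = λ s {x} p → let η , h , d = J-elim v Hv≈1 p in
            J-intro v Hv≈1 (Log-* s {η} h) (𝐇.I-resp
              (trans (solve 4 (λ s Q x a → s :* (Q :* x :- a) := Q :* (s :* x) :- s :* a) refl s _ x (η ⌟ v))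
                (+-congˡ (-‿cong (sym (∙-*ˡ s η (κ ∘ v))))))
              (𝐇.I-mul s d))
        }

      J-resp̄ : ∀ {x y} → CommutativeRing._≈_ (S̄ H) x y → x ∈ J → y ∈ J
      J-resp̄ e p = I-shift′ J-isIdeal (J-H (≈̄⇒∣ {H} e)) p

      J-closed : ∀ {x} → Ideals.⟨_⟩ (S̄ H) J x → x ∈ J
      J-closed (Ideals.gen p)    = p
      J-closed Ideals.zer        = IsIdeal.I-zero J-isIdeal
      J-closed (Ideals.add p q)  = IsIdeal.I-add J-isIdeal (J-closed p) (J-closed q)
      J-closed (Ideals.mul r p)  = IsIdeal.I-mul J-isIdeal r (J-closed p)
      J-closed (Ideals.resp e p) = J-resp̄ e (J-closed p)

module FilterDeduplicate {a} {A : Set a} where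

  filter-comm : ∀ {p q} {P : Pred A p} {Q : Pred A q} (P? : Decidable₁ P) (Q? : Decidable₁ Q) xs →
                filter P? (filter Q? xs) ≡ filter Q? (filter P? xs)
  filter-comm P? Q? [] = ≡.refl
  filter-comm P? Q? (x ∷ xs) with P? x | Q? x
  ... | yes p | yes q = ≡.trans (List.filter-accept P? p) (≡.trans (≡.cong (x ∷_) (filter-comm P? Q? xs)) (≡.sym (List.filter-accept Q? q)))
  ... | yes p | no ¬q = ≡.trans (filter-comm P? Q? xs) (≡.sym (List.filter-reject Q? ¬q))
  ... | no ¬p | yes q = ≡.trans (List.filter-reject P? ¬p) (filter-comm P? Q? xs)
  ... | no ¬p | no ¬q = filter-comm P? Q? xs

  filter-filter : ∀ {p q} {P : Pred A p} {Q : Pred A q} (P? : Decidable₁ P) (Q? : Decidable₁ Q) →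
                  (∀ {x} → P x → Q x) → ∀ xs → filter P? (filter Q? xs) ≡ filter P? xs
  filter-filter P? Q? P⊆Q [] = ≡.refl
  filter-filter P? Q? P⊆Q (x ∷ xs) with P? x | Q? x
  ... | yes p | yes q = ≡.trans (List.filter-accept P? p) (≡.cong (x ∷_) (filter-filter P? Q? P⊆Q xs))
  ... | yes p | no ¬q = contradiction (P⊆Q p) ¬q
  ... | no ¬p | yes q = ≡.trans (List.filter-reject P? ¬p) (filter-filter P? Q? P⊆Q xs)
  ... | no ¬p | no ¬q = filter-filter P? Q? P⊆Q xs

  module _ {r} {R : A → A → Set r} (R? : Decidable R) where

    deduplicate-Sublist : ∀ xs → deduplicate R? xs Sublist.⊆ xs
    deduplicate-Sublist []       = []
    deduplicate-Sublist (x ∷ xs) = ≡.refl ∷ Sublist.⊆-trans (Sublist.filter-⊆ (¬? ∘ R? x) _) (deduplicate-Sublist xs)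

    deduplicate-AllPairs : ∀ xs → AllPairs (λ x y → ¬ R x y) (deduplicate R? xs)
    deduplicate-AllPairs []       = []
    deduplicate-AllPairs (x ∷ xs) = All.all-filter (¬? ∘ R? x) (deduplicate R? xs) ∷ AllPairs.filter⁺ (¬? ∘ R? x) (deduplicate-AllPairs xs)

    deduplicate-complete : (∀ {x} → R x x) → (∀ {x y z} → R x y → R y z → R x z) →
      ∀ xs {x} → x ∈ˡ xs → ∃ λ y → y ∈ˡ deduplicate R? xs × R y x
    deduplicate-complete rfl trn (x ∷ xs) (here ≡.refl) = x , here ≡.refl , rfl
    deduplicate-complete rfl trn (z ∷ xs) (there p) with deduplicate-complete rfl trn xs p
    ... | y , y∈ , Ryx with R? z y in eq
    ...   | yes Rzy = z , here ≡.refl , trn Rzy Ryx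
    ...   | no ¬Rzy = y , there (∈ˡ.∈-filter⁺ (¬? ∘ R? z) y∈ ¬Rzy) , Ryx

    module _ {p} {P : Pred A p} (P? : Decidable₁ P) (P-resp : ∀ {x y} → R x y → P y → P x) where

      deduplicate-filter : ∀ xs → deduplicate R? (filter P? xs) ≡ filter P? (deduplicate R? xs)
      deduplicate-filter []       = ≡.refl
      deduplicate-filter (x ∷ xs) with P? x
      ... | yes p = ≡.cong (x ∷_) (≡.trans (≡.cong (filter (¬? ∘ R? x)) (deduplicate-filter xs))
                      (filter-comm (¬? ∘ R? x) P? (deduplicate R? xs)))
      ... | no ¬p = ≡.trans (deduplicate-filter xs)
                      (≡.sym (filter-filter P? (¬? ∘ R? x) (λ py Rxy → ¬p (P-resp Rxy py)) (deduplicate R? xs)))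

module Localization (em : ∀ {a} → ExcludedMiddle a) {c ℓ₁ ℓ₂} (F : HeytingField c ℓ₁ ℓ₂) (ℓ : ℕ) where

  open Arrangements F ℓ
  open Residues em
  open LinearForms em F ℓ
  open RestrictionToSubspace em F ℓ
  open ResidueIdeals em F ℓ
  open CommutativeRing S hiding (zero)
  open Ideals S using (IsIdeal; IsPrime)
  open IdealKit S
  open RingKit S
  open FilterDeduplicate
  open Relation.Binary.Reasoning.Setoid setoid

  product-split : ∀ {p} {P : Pred Form p} (P? : Decidable₁ P) fs →
                  product fs ≈ product (filter P? fs) * product (filter (¬? ∘ P?) fs)
  product-split P? []       = sym (*-identityˡ 1#)
  product-split P? (L ∷ fs) with P? L
  ... | yes _ = trans (*-congˡ (product-split P? fs)) (sym (*-assoc _ _ _))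
  ... | no _  = trans (*-congˡ (product-split P? fs)) (solve 3 (λ l x y → l :* (x :* y) := x :* (l :* y)) refl (toPoly L) _ _)

  product-Sublist : ∀ {fs gs} → fs Sublist.⊆ gs →
                    ∃ λ hs → product gs ≈ product fs * product hs × (∀ {L} → L ∈ˡ hs → L ∈ˡ gs)
  product-Sublist [] = [] , sym (*-identityˡ 1#) , λ ()
  product-Sublist (L ∷ʳ s) = let hs , e , inc = product-Sublist s in
    L ∷ hs , trans (*-congˡ e) (solve 3 (λ l x y → l :* (x :* y) := x :* (l :* y)) refl (toPoly L) _ _) ,
    λ { (here p) → here p ; (there p) → there (inc p) }
  product-Sublist (≡.refl ∷ s) = let hs , e , inc = product-Sublist s in
    hs , trans (*-congˡ e) (sym (*-assoc _ _ _)) , there ∘ inc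

  ∣-product : ∀ {L fs} → L ∈ˡ fs → toPoly L ∣ product fs
  ∣-product (here ≡.refl) = _ , refl
  ∣-product {fs = M ∷ fs} (there p) = IsIdeal.I-mul (∣-isIdeal _) (toPoly M) (∣-product p)

  product∉ : ∀ {p} {P : Pred Carrier p} → IsPrime P → ∀ fs → (∀ {L} → L ∈ˡ fs → toPoly L ∉ P) → product fs ∉ P
  product∉ isPrime []       h = IsPrime.proper isPrime
  product∉ isPrime (L ∷ fs) h = λ d → [ h (here ≡.refl) , product∉ isPrime fs (h ∘ there) ]′ (IsPrime.prime isPrime d)

  SameTrace : Form → Form → Form → Set (c ⊔ ℓ₁)
  SameTrace H L M = (ker H ∩ ker L) ≐ (ker H ∩ ker M)

  SameTrace? : ∀ H → Decidable (SameTrace H)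
  SameTrace? H L M = em

  representative : ∀ A {H L} → L ∈ˡ forms A → ¬ (ker L ≐ ker H) → ∃ λ M → M ∈ˡ restriction A H × SameTrace H M L
  representative A {H} {L} L∈A L≠H = deduplicate-complete (SameTrace? H)
    ((λ p → p) , (λ p → p)) (λ { (p , q) (r , s) → (λ x → r (p x)) , (λ x → q (s x)) })
    _ (∈ˡ.∈-filter⁺ (λ L → ¬? (em {P = ker L ≐ ker H})) L∈A L≠H)

  restriction-Sublist : ∀ A H → restriction A H Sublist.⊆ forms A
  restriction-Sublist A H = Sublist.⊆-trans (deduplicate-Sublist (SameTrace? H) _) (Sublist.filter-⊆ (λ L → ¬? (em {P = ker L ≐ ker H})) _)

  restriction-≠ : ∀ A H {L} → L ∈ˡ restriction A H → ¬ (ker L ≐ ker H)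
  restriction-≠ A H {L} p = proj₂ (∈ˡ.∈-filter⁻ (λ L → ¬? (em {P = ker L ≐ ker H})) {xs = forms A}
    (Sublist.Any-resp-⊆ (deduplicate-Sublist (SameTrace? H) (filter (λ L → ¬? (em {P = ker L ≐ ker H})) (forms A))) p))

  module _ (A : Arrangement) {H} (H∈A : H ∈ˡ forms A) (X : Pred V (c ⊔ ℓ₁)) (X⊆H : X ⊆ ker H) where

    X⊆? : Decidable₁ (λ L → X ⊆ ker L)
    X⊆? L = em

    private
      Aₓ = localization A X

    H∈Aₓ : H ∈ˡ forms Aₓ
    H∈Aₓ = ∈ˡ.∈-filter⁺ X⊆? H∈A X⊆H

    restriction-localization : restriction Aₓ H ≡ filter X⊆? (restriction A H)
    restriction-localization = ≡.trans
      (≡.cong (deduplicate (SameTrace? H)) (filter-comm (λ L → ¬? (em {P = ker L ≐ ker H})) X⊆? (forms A)))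
      (deduplicate-filter (SameTrace? H) X⊆? (λ { (p , q) X⊆M x∈X → proj₂ (q (X⊆H x∈X , X⊆M x∈X)) })
        (filter (λ L → ¬? (em {P = ker L ≐ ker H})) (forms A)))

    away : List Form
    away = filter (¬? ∘ X⊆?) (forms A)

    private
      awayᴴ = filter (¬? ∘ X⊆?) (restriction A H)

      cofactor : ∃ λ hs → product away ≈ product awayᴴ * product hs × (∀ {L} → L ∈ˡ hs → L ∈ˡ away)
      cofactor = product-Sublist (Sublist.filter⁺ (¬? ∘ X⊆?) (¬? ∘ X⊆?) (λ { ≡.refl p → p }) (restriction-Sublist A H))

    q rest : Carrier
    q = product awayᴴ
    rest = product (proj₁ cofactor)

    product-restriction : product (restriction A H) ≈ product (restriction Aₓ H) * q
    product-restriction = trans (product-split X⊆? (restriction A H))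
      (*-congʳ (reflexive (≡.cong product (≡.sym restriction-localization))))

    product-away : product away ≈ q * rest
    product-away = proj₁ (proj₂ cofactor)

    private
      away-⊈ : ∀ {L} → L ∈ˡ away → L ∈ˡ forms A × ¬ (X ⊆ ker L)
      away-⊈ = ∈ˡ.∈-filter⁻ (¬? ∘ X⊆?)

    module _ {p} {P : Pred Carrier p} (isPrime : IsPrime P) (h : ∀ {L} → L ∈ˡ forms A → toPoly L ∈ P → X ⊆ ker L) where

      q∉ : q ∉ P
      q∉ = product∉ isPrime awayᴴ λ {L} p e → let r , X⊈L = ∈ˡ.∈-filter⁻ (¬? ∘ X⊆?) {xs = restriction A H} p in
        X⊈L (λ {x} → h (Sublist.Any-resp-⊆ (restriction-Sublist A H) r) e {x})

      rest∉ : rest ∉ P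
      rest∉ = product∉ isPrime (proj₁ cofactor) λ {L} p e → let L∈A , X⊈L = away-⊈ (proj₂ (proj₂ cofactor) p) in
        X⊈L (λ {x} → h L∈A e {x})

    private
      v = proj₁ (normalize (nonzero′ A H∈A))
      Hv≈1 = proj₂ (normalize (nonzero′ A H∈A))
      module 𝐇 = IsIdeal (∣-isIdeal (toPoly H))

    localize : ∀ {r} → r ∈ residueIdeal A H → q * r ∈ residueIdeal Aₓ H
    localize {r} p = let η , h , d = J-elim A H∈A v Hv≈1 p in
      J-intro Aₓ H∈Aₓ v Hv≈1 (All.filter⁺ X⊆? h) (𝐇.I-resp
        (+-congʳ (trans (*-congʳ product-restriction) (*-assoc _ _ _))) d)

    globalize : ∀ {r} → r ∈ residueIdeal Aₓ H → rest * r ∈ residueIdeal A H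
    globalize {r} p = let η , h , d = J-elim Aₓ H∈Aₓ v Hv≈1 p in
      J-intro A H∈A v Hv≈1 (log η h) (𝐇.I-resp (eq η) (𝐇.I-mul (product away) d))
      where
      eq : ∀ η → product away * (product (restriction Aₓ H) * r - η ⌟ v) ≈
                 product (restriction A H) * (rest * r) - (λ i → product away * η i) ⌟ v
      eq η = begin
        product away * (product (restriction Aₓ H) * r - η ⌟ v)
          ≈⟨ solve 4 (λ a p r y → a :* (p :* r :- y) := a :* (p :* r) :- a :* y) refl _ _ r (η ⌟ v) ⟩
        product away * (product (restriction Aₓ H) * r) - product away * η ⌟ v
          ≈⟨ +-cong (*-congʳ product-away) (-‿cong (sym (∙-*ˡ (product away) η _))) ⟩
        (q * rest) * (product (restriction Aₓ H) * r) - (λ i → product away * η i) ⌟ v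
          ≈⟨ +-congʳ (solve 4 (λ q s p r → (q :* s) :* (p :* r) := (p :* q) :* (s :* r)) refl q rest _ r) ⟩
        (product (restriction Aₓ H) * q) * (rest * r) - (λ i → product away * η i) ⌟ v
          ≈⟨ +-congʳ (*-congʳ (sym product-restriction)) ⟩
        product (restriction A H) * (rest * r) - (λ i → product away * η i) ⌟ v ∎

      log : ∀ η → η ∈ Log Aₓ → (λ i → product away * η i) ∈ Log A
      log η h = minor⇒Log A λ {L} L∈A i j → case X⊆? L of λ
        { (yes X⊆L) → scaled L i j (IsIdeal.I-mul (∣-isIdeal (toPoly L)) (product away)
                        (Log⇒minor {Aₓ} {η} h (∈ˡ.∈-filter⁺ X⊆? L∈A X⊆L) i j))
        ; (no X⊈L)  → scaled L i j (I-mulʳ (∣-isIdeal (toPoly L)) _ (∣-product (∈ˡ.∈-filter⁺ (¬? ∘ X⊆?) L∈A X⊈L))) }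
        where
        scaled : ∀ L i j → toPoly L ∣ (product away * minor η L i j) → toPoly L ∣ minor (λ i → product away * η i) L i j
        scaled L i j = IsIdeal.I-resp (∣-isIdeal (toPoly L))
          (solve 5 (λ s a b x y → s :* (a :* x :- b :* y) := (s :* a) :* x :- (s :* b) :* y) refl
            (product away) (η i) (η j) _ _)

module _ {a ℓa b ℓb} {A : CommutativeRing a ℓa} {B : CommutativeRing b ℓb} where

  private
    module A = CommutativeRing A
    module B = CommutativeRing B

  record IsLinear (ι : Hom A B) (c : B.Carrier → A.Carrier) : Set (a ⊔ ℓa ⊔ b ⊔ ℓb) where
    field
      cong   : ∀ {x y} → x B.≈ y → c x A.≈ c y
      +-homo : ∀ x y → c (x B.+ y) A.≈ c x A.+ c y
      linear : ∀ s x → c (Hom.⟦_⟧ ι s B.* x) A.≈ s A.* c x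

    0-homo : c B.0# A.≈ A.0#
    0-homo = A.trans (cong (B.sym (B.zeroʳ _))) (A.trans (linear A.0# B.0#) (A.zeroˡ _))

    neg-homo : ∀ x → c (B.- x) A.≈ A.- c x
    neg-homo x = A.trans (solve 2 (λ u v → u := (u :+ v) :- v) A.refl (c (B.- x)) (c x))
      (A.trans (A.+-congʳ (A.trans (A.sym (+-homo _ _)) (A.trans (cong (B.-‿inverseˡ x)) 0-homo)))
        (A.+-identityˡ _))
      where open RingSolver A

    sub-homo : ∀ x y → c (x B.- y) A.≈ c x A.- c y
    sub-homo x y = A.trans (+-homo _ _) (A.+-congˡ (neg-homo y))

    linearʳ : ∀ s x → c (x B.* Hom.⟦_⟧ ι s) A.≈ c x A.* s
    linearʳ s x = A.trans (cong (B.*-comm _ _)) (A.trans (linear s x) (A.*-comm _ _))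

    ∙-homo : ∀ {n} (u : Vector B.Carrier n) (s : Vector A.Carrier n) →
             c (RingKit._∙_ B u (λ i → Hom.⟦_⟧ ι (s i))) A.≈ RingKit._∙_ A (c ∘ u) s
    ∙-homo {zero}  u s = 0-homo
    ∙-homo {suc n} u s = A.trans (+-homo _ _) (A.+-cong (linearʳ _ _) (∙-homo (u ∘ suc) (s ∘ suc)))

module Invariance (em : ∀ {a} → ExcludedMiddle a) {c ℓ₁ ℓ₂} (F : HeytingField c ℓ₁ ℓ₂) (ℓ : ℕ) where

  open Arrangements F ℓ
  open Residues em
  open LinearForms em F ℓ
  open RestrictionToSubspace em F ℓ
  open ResidueIdeals em F ℓ
  open Localization em F ℓ
  open MvPolyKit scalars
  private
    module K = CommutativeRing scalars
    module κ = Hom (constHom ℓ)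
  open CommutativeRing S hiding (zero)
  open RingKit S
  open Ideals S using (IsIdeal)
  open IdealKit S

  -- A family T of endomorphisms of S that multiplies every α_L by the same
  -- parameter τ acts on Log A and on numerators of residues.
  module _ (A : Arrangement) {H} (H∈A : H ∈ˡ forms A)
    {m ℓm} {M : CommutativeRing m ℓm} (ι T : Hom S M) (τ : CommutativeRing.Carrier M)
    (T-const : ∀ a → CommutativeRing._≈_ M (Hom.⟦_⟧ T (κ a)) (Hom.⟦_⟧ ι (κ a)))
    (T-form : ∀ {L} → L ∈ˡ forms A → CommutativeRing._≈_ M (Hom.⟦_⟧ T (toPoly L)) (CommutativeRing._*_ M (Hom.⟦_⟧ ι (toPoly L)) τ))
    where

    private
      module M = CommutativeRing M
      module ι = Hom ι
      module T = Hom T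
    open Algebra.Properties.Semiring.Exp M.semiring using (_^_)
    open RingSolver M using () renaming (solve to solveᴹ; _:*_ to _⊛_; _:=_ to _⊜_)

    T-product : ∀ fs → (∀ {L} → L ∈ˡ fs → L ∈ˡ forms A) → T.⟦ product fs ⟧ M.≈ ι.⟦ product fs ⟧ M.* τ ^ List.length fs
    T-product []       inc = M.trans T.1-homo (M.sym (M.trans (M.*-identityʳ _) ι.1-homo))
    T-product (L ∷ fs) inc = M.trans (T.*-homo _ _)
      (M.trans (M.*-cong (T-form (inc (here ≡.refl))) (T-product fs (inc ∘ there)))
        (M.trans (solveᴹ 4 (λ a b c d → (a ⊛ b) ⊛ (c ⊛ d) ⊜ (a ⊛ c) ⊛ (b ⊛ d)) M.refl _ _ _ _)
          (M.*-congʳ (M.sym (ι.*-homo _ _)))))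

    module _ {c c′ : M.Carrier → Carrier} (c-linear : IsLinear ι c) (c′-linear : IsLinear ι c′)
      (c′-shift : ∀ z → c′ (τ ^ List.length (restriction A H) M.* z) ≈ c z) where

      private
        module c′ = IsLinear c′-linear
        v = proj₁ (normalize (nonzero′ A H∈A))
        Hv≈1 = proj₂ (normalize (nonzero′ A H∈A))

      c′-multiple : ∀ {L} → L ∈ˡ forms A → ∀ z → c′ T.⟦ toPoly L * z ⟧ ≈ toPoly L * c′ (τ M.* T.⟦ z ⟧)
      c′-multiple L∈A z = trans (c′.cong (M.trans (T.*-homo _ _) (M.trans (M.*-congʳ (T-form L∈A)) (M.*-assoc _ _ _))))
        (c′.linear _ _)

      c′-Log : ∀ {η} → η ∈ Log A → (λ i → c′ T.⟦ η i ⟧) ∈ Log A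
      c′-Log {η} h = minor⇒Log A λ {L} L∈A i j → let z , e = Log⇒minor {A} {η} h L∈A i j in
        c′ (τ M.* T.⟦ z ⟧) , trans (sym (eq L i j)) (trans (c′.cong (T.cong e)) (c′-multiple L∈A z))
        where
        term : ∀ s a → c′ T.⟦ s * κ a ⟧ ≈ c′ T.⟦ s ⟧ * κ a
        term s a = trans (c′.cong (M.trans (T.*-homo _ _) (M.*-congˡ (T-const a)))) (c′.linearʳ _ _)
        eq : ∀ L i j → c′ T.⟦ minor η L i j ⟧ ≈ minor (λ i → c′ T.⟦ η i ⟧) L i j
        eq L i j = trans (c′.cong (T.sub-homo _ _)) (trans (c′.sub-homo _ _)
          (+-cong (term (η i) (L j)) (-‿cong (term (η j) (L i)))))

      invariant : ∀ {r} → r ∈ residueIdeal A H → c T.⟦ r ⟧ ∈ residueIdeal A H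
      invariant {r} p = let η , h , (z , e) = J-elim A H∈A v Hv≈1 p in
        J-intro A H∈A v Hv≈1 (c′-Log {η} h)
          (c′ (τ M.* T.⟦ z ⟧) , trans (sym (eq η)) (trans (c′.cong (T.cong e)) (c′-multiple H∈A z)))
        where
        Qᴴ = product (restriction A H)
        n = List.length (restriction A H)
        first : c′ T.⟦ Qᴴ * r ⟧ ≈ Qᴴ * c T.⟦ r ⟧
        first = trans (c′.cong (M.trans (T.*-homo _ _) (M.trans
            (M.*-congʳ (T-product (restriction A H) (Sublist.Any-resp-⊆ (restriction-Sublist A H)))) (M.*-assoc _ _ _))))
          (trans (c′.linear _ _) (*-congˡ (c′-shift _)))
        second : ∀ η → c′ T.⟦ η ⌟ v ⟧ ≈ (λ i → c′ T.⟦ η i ⟧) ⌟ v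
        second η = trans (c′.cong (M.trans (T.∙-homo η (κ ∘ v)) (RingKit.∙-cong M (λ _ → M.refl) (λ i → T-const (v i)))))
          (c′.∙-homo (λ i → T.⟦ η i ⟧) (κ ∘ v))
        eq : ∀ η → c′ T.⟦ Qᴴ * r - η ⌟ v ⟧ ≈ Qᴴ * c T.⟦ r ⟧ - (λ i → c′ T.⟦ η i ⟧) ⌟ v
        eq η = trans (c′.cong (T.sub-homo _ _)) (trans (c′.sub-homo _ _) (+-cong first (-‿cong (second η))))

  -- Scaling transversally to a subspace X (by t) and moving along X (by y′):
  -- the substitution xᵢ ↦ t xᵢ + Σⱼ wⱼᵢ y′ⱼ into S[y′][t].
  module Deformation {B} (𝔽 : Frame B) where

    open Restriction 𝔽
    private
      module 𝐓 = MvPolyKit S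
      module MC = MvCoeff S

    S[y] : CommutativeRing c ℓ₁
    S[y] = MvPoly S dim

    open PolyKit S[y] using (C; coeff; eval-X; coeff-C*; coeff-X*; coeff-⊕; coeff₀Hom; CHom; head-tail; at)
      renaming (X to t; polynomialRing to S[y][t])
    private
      module Y = CommutativeRing S[y]
      module M = CommutativeRing S[y][t]

    ι : Hom S S[y][t]
    ι = CHom ∘ᴴ 𝐓.constHom dim
    private module ι = Hom ι

    along : Hom Sᵉ S[y]
    along = mapMv (constHom ℓ) dim
    private module along = Hom along

    T : Hom S S[y][t]
    T = evaluate (ι ∘ᴴ constHom ℓ) (λ i → ι.⟦ var scalars {ℓ} i ⟧ M.* t M.+ C along.⟦ ρ.⟦ var scalars {ℓ} i ⟧ ⟧)
    module T = Hom T

    private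
      along-ρ : Hom S S[y]
      along-ρ = along ∘ᴴ ρ
      module along-ρ = Hom along-ρ

      along-ρ-const : ∀ a → along-ρ.⟦ κ a ⟧ Y.≈ const S {dim} (κ a)
      along-ρ-const a = Y.trans (along.cong (ρ-const a)) (mapMv-const (constHom ℓ) dim a)

    T-const : ∀ a → T.⟦ κ a ⟧ M.≈ ι.⟦ κ a ⟧
    T-const = evaluate-const (ι ∘ᴴ constHom ℓ) (λ i → ι.⟦ var scalars {ℓ} i ⟧ M.* t M.+ C along.⟦ ρ.⟦ var scalars {ℓ} i ⟧ ⟧)

    T-var : ∀ i → T.⟦ var scalars {ℓ} i ⟧ M.≈ ι.⟦ var scalars {ℓ} i ⟧ M.* t M.+ C along.⟦ ρ.⟦ var scalars {ℓ} i ⟧ ⟧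
    T-var = evaluate-var (ι ∘ᴴ constHom ℓ) (λ i → ι.⟦ var scalars {ℓ} i ⟧ M.* t M.+ C along.⟦ ρ.⟦ var scalars {ℓ} i ⟧ ⟧)

    T-toPoly : ∀ α → T.⟦ toPoly α ⟧ M.≈ ι.⟦ toPoly α ⟧ M.* t M.+ C along.⟦ ρ.⟦ toPoly α ⟧ ⟧
    T-toPoly α = begin
      T.⟦ toPoly α ⟧
        ≈⟨ image-toPoly T α ⟩
      (λ i → T.⟦ κ (α i) ⟧) ∙ᴹ (λ i → T.⟦ var scalars {ℓ} i ⟧)
        ≈⟨ ∙ᴹ-cong (λ i → T-const (α i)) T-var ⟩
      (λ i → ι.⟦ κ (α i) ⟧) ∙ᴹ (λ i → ι.⟦ var scalars {ℓ} i ⟧ M.* t M.+ C along-ρ.⟦ var scalars {ℓ} i ⟧)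
        ≈⟨ ∙ᴹ-+ʳ (λ i → ι.⟦ κ (α i) ⟧) (λ i → ι.⟦ var scalars {ℓ} i ⟧ M.* t) (λ i → C along-ρ.⟦ var scalars {ℓ} i ⟧) ⟩
      (λ i → ι.⟦ κ (α i) ⟧) ∙ᴹ (λ i → ι.⟦ var scalars {ℓ} i ⟧ M.* t) M.+
      (λ i → ι.⟦ κ (α i) ⟧) ∙ᴹ (λ i → C along-ρ.⟦ var scalars {ℓ} i ⟧)
        ≈⟨ M.+-cong (M.trans (∙ᴹ-cong {u = λ i → ι.⟦ κ (α i) ⟧} (λ _ → M.refl) (λ i → M.*-comm ι.⟦ var scalars {ℓ} i ⟧ t))
                      (M.trans (∙ᴹ-*ʳ t (λ i → ι.⟦ κ (α i) ⟧) (λ i → ι.⟦ var scalars {ℓ} i ⟧)) (M.*-comm t _)))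
                    (∙ᴹ-cong {v = λ i → C along-ρ.⟦ var scalars {ℓ} i ⟧} (λ i → Hom.cong CHom (Y.sym (along-ρ-const (α i)))) (λ _ → M.refl)) ⟩
      (λ i → ι.⟦ κ (α i) ⟧) ∙ᴹ (λ i → ι.⟦ var scalars {ℓ} i ⟧) M.* t M.+
      (λ i → C along-ρ.⟦ κ (α i) ⟧) ∙ᴹ (λ i → C along-ρ.⟦ var scalars {ℓ} i ⟧)
        ≈⟨ M.+-cong (M.*-congʳ (image-toPoly ι α)) (image-toPoly (CHom ∘ᴴ along-ρ) α) ⟨
      ι.⟦ toPoly α ⟧ M.* t M.+ C along-ρ.⟦ toPoly α ⟧ ∎
      where
      open Relation.Binary.Reasoning.Setoid M.setoid
      open RingKit S[y][t] using () renaming (_∙_ to infixl 9 _∙ᴹ_; ∙-cong to ∙ᴹ-cong; ∙-+ʳ to ∙ᴹ-+ʳ; ∙-*ʳ to ∙ᴹ-*ʳ)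

    T-Kernel : ∀ {α} → toPoly α ∈ Kernel → T.⟦ toPoly α ⟧ M.≈ ι.⟦ toPoly α ⟧ M.* t
    T-Kernel {α} k = M.trans (T-toPoly α) (M.trans (M.+-congˡ {ι.⟦ toPoly α ⟧ M.* t}
      (M.trans (Hom.cong CHom (Y.trans (along.cong k) along.0-homo)) (Hom.0-homo CHom))) (M.+-identityʳ _))

    T-coeff₀ : ∀ x → coeff T.⟦ x ⟧ 0 Y.≈ along.⟦ ρ.⟦ x ⟧ ⟧
    T-coeff₀ = hom-unique (coeff₀Hom ∘ᴴ T) along-ρ
      (λ a → Y.trans (at (T-const a) 0) (Y.sym (along-ρ-const a)))
      (λ i → Y.trans (at (T-var i) 0) (Y.trans (coeff-⊕ (ι.⟦ var scalars {ℓ} i ⟧ M.* t) (C along.⟦ ρ.⟦ var scalars {ℓ} i ⟧ ⟧) 0)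
        (Y.trans (Y.+-congʳ (Y.trans (coeff-C* _ t 0) (Y.zeroʳ _))) (Y.+-identityˡ _))))

    origin : Vector Carrier (suc dim)
    origin zero    = 1#
    origin (suc _) = 0#

    undo : Hom S[y][t] S
    undo = 𝐓.evaluate idHom {suc dim} origin
    private module undo = Hom undo

    undo-T : ∀ x → undo.⟦ T.⟦ x ⟧ ⟧ ≈ x
    undo-T = hom-unique (undo ∘ᴴ T) idHom
      (λ a → trans (undo.cong (T-const a)) (undo-ι (κ a)))
      (λ i → trans (undo.cong (T-var i)) (trans (undo.+-homo (ι.⟦ var scalars {ℓ} i ⟧ M.* t) (C along.⟦ ρ.⟦ var scalars {ℓ} i ⟧ ⟧))
        (trans (+-cong (trans (undo.*-homo ι.⟦ var scalars {ℓ} i ⟧ t)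
                         (trans (*-cong (undo-ι _) (eval-X (𝐓.evaluate idHom (origin ∘ suc)) 1#)) (*-identityʳ _)))
                       (trans (undo-C _) (undo-linear i)))
          (+-identityʳ _))))
      where
      at-0 : Hom S[y] S
      at-0 = 𝐓.evaluate idHom {dim} (origin ∘ suc)
      undo-C : ∀ p → undo.⟦ C p ⟧ ≈ Hom.⟦_⟧ at-0 p
      undo-C p = PolyKit.eval-C S[y] at-0 1# p
      undo-ι : ∀ s → undo.⟦ ι.⟦ s ⟧ ⟧ ≈ s
      undo-ι s = trans (undo-C (const S {dim} s)) (𝐓.evaluate-const idHom (origin ∘ suc) s)
      undo-linear : ∀ i → Hom.⟦_⟧ at-0 along.⟦ ρ.⟦ var scalars {ℓ} i ⟧ ⟧ ≈ 0#
      undo-linear i = trans (Hom.cong (at-0 ∘ᴴ along) (evaluate-var (constHom dim) (λ i → linear (λ j → w j i)) i))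
        (trans (LinearPolynomials.image-toPoly F dim (at-0 ∘ᴴ along) (λ j → w j i))
          (trans (∙-comm (λ j → Hom.⟦_⟧ (at-0 ∘ᴴ along) (const scalars {dim} (w j i))) (λ j → Hom.⟦_⟧ (at-0 ∘ᴴ along) (var scalars {dim} j)))
            (∙-zeroˡ (λ j → Hom.⟦_⟧ (at-0 ∘ᴴ along) (const scalars {dim} (w j i))) (λ j →
            trans (Hom.cong at-0 (mapMv-var (constHom ℓ) dim j)) (𝐓.evaluate-var idHom (origin ∘ suc) j)))))

    coefficient : Vec ℕ dim → ℕ → M.Carrier → Carrier
    coefficient m k z = MC.mcoeff m (coeff z k)

    coefficient-linear : ∀ m k → IsLinear ι (coefficient m k)
    coefficient-linear m k = record
      { cong   = λ e → MC.mcoeff-cong m (at e k)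
      ; +-homo = λ x y → trans (MC.mcoeff-cong m (coeff-⊕ x y k)) (MC.mcoeff-+ m _ _)
      ; linear = λ s x → trans (MC.mcoeff-cong m (coeff-C* (const S {dim} s) x k)) (MC.mcoeff-const* m s _)
      }

    open Algebra.Properties.Semiring.Exp M.semiring using (_^_)

    coeff-t^ : ∀ n k z → coeff (t ^ n M.* z) (n ℕ.+ k) Y.≈ coeff z k
    coeff-t^ zero    k z = at (M.*-identityˡ z) k
    coeff-t^ (suc n) k z = Y.trans (at (M.*-assoc t (t ^ n) z) _) (Y.trans (coeff-X* (t ^ n M.* z) (n ℕ.+ k)) (coeff-t^ n k z))

    module _ (A : Arrangement) {H} (H∈A : H ∈ˡ forms A) (forms⊆ : ∀ {L} → L ∈ˡ forms A → toPoly L ∈ Kernel) where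

      private
        J = residueIdeal A H
        J-ideal = J-isIdeal A H∈A

      coefficients∈J : ∀ {r} → r ∈ J → ∀ m k → coefficient m k T.⟦ r ⟧ ∈ J
      coefficients∈J r∈J m k = invariant A H∈A ι T t T-const (λ {L} L∈A → T-Kernel {L} (forms⊆ L∈A))
        (coefficient-linear m k) (coefficient-linear m (List.length (restriction A H) ℕ.+ k))
        (λ z → MC.mcoeff-cong m (coeff-t^ (List.length (restriction A H)) k z)) r∈J

      T-Extension : ∀ {r} → r ∈ J → T.⟦ r ⟧ ∈ Extension J-ideal (suc dim)
      T-Extension r∈J k = MC.mcoeffs⇒Extension J-ideal dim (λ m → coefficients∈J r∈J m k)

      -- T p has the nonzero lowest coefficient ρ p, whose coefficients are
      -- constants, so it is regular modulo J[y′][t].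
      cancel-Kernel : ∀ {p f} → p * f ∈ J → p ∉ Kernel → f ∈ J
      cancel-Kernel {p} {f} pf∈J p∉ = IsIdeal.I-resp J-ideal (undo-T f)
        (MC.evaluate-Extension J-ideal (suc dim) origin {T.⟦ f ⟧} (T-regular T.⟦ f ⟧
          (Ideals.IsIdeal.I-resp (Extension-isIdeal J-ideal (suc dim)) (T.*-homo p f) (T-Extension pf∈J))))
        where
        unit-or-zero : ∀ a → a K.≈ K.0# ⊎ Regular J (κ a)
        unit-or-zero a with inverses a
        ... | inj₁ a≈0     = inj₁ a≈0
        ... | inj₂ (b , e) = inj₂ λ s h → IsIdeal.I-resp J-ideal
              (trans (sym (*-assoc _ _ _)) (trans (*-congʳ (trans (sym (κ.*-homo b a)) (trans (κ.cong e) κ.1-homo))) (*-identityˡ s)))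
              (IsIdeal.I-mul J-ideal (κ b) h)

        T-regular : IdealKit.Regular S[y][t] (Extension J-ideal (suc dim)) T.⟦ p ⟧
        T-regular with regular-mapMv (constHom ℓ) J-ideal unit-or-zero dim ρ.⟦ p ⟧
        ... | inj₁ ρp≈0 = contradiction ρp≈0 p∉
        ... | inj₂ reg  = PolyIdeal.regular-cong S[y] (Extension-isIdeal J-ideal dim) _ _
              (M.trans (Polynomial.∷-cong S[y] (Y.sym (T-coeff₀ p)) (M.refl {List.drop 1 T.⟦ p ⟧})) (M.sym (head-tail T.⟦ p ⟧)))
              (PolyIdeal.regular-∷ S[y] (Extension-isIdeal J-ideal dim) (List.drop 1 T.⟦ p ⟧) reg)

module ResiduePrimes (em : ∀ {a} → ExcludedMiddle a) {c ℓ₁ ℓ₂} (F : HeytingField c ℓ₁ ℓ₂) (ℓ : ℕ) where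

  open Arrangements F ℓ
  open Residues em
  open LinearForms em F ℓ
  open RestrictionToSubspace em F ℓ
  open ResidueIdeals em F ℓ
  open Localization em F ℓ
  open Invariance em F ℓ
  open CommutativeRing S hiding (zero)
  open RingKit S
  open Ideals S using (IsIdeal; IsPrime)
  open IdealKit S

  byCases : ∀ {p} {P : Set p} → (¬ P → P) → P
  byCases {P = P} f with em {P = P}
  ... | yes p = p
  ... | no ¬p = f ¬p

  module _ {p} {P : Pred Carrier p} {H : Form} where

    private module 𝐒̄ = Ideals (S̄ H)

    IsPrime-S̄⇒S : 𝐒̄.IsPrime P → IsPrime P
    IsPrime-S̄⇒S P-prime = record
      { isIdeal = record
        { I-resp = λ e → I-resp (∣⇒≈̄ {H} (0# , trans (x≈y⇒x-y≈0 e) (sym (zeroʳ _))))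
        ; I-zero = I-zero ; I-add = I-add ; I-mul = I-mul }
      ; proper = proper ; prime = prime }
      where
      open 𝐒̄.IsPrime P-prime
      open 𝐒̄.IsIdeal isIdeal

    H∈P : 𝐒̄.IsPrime P → toPoly H ∈ P
    H∈P P-prime = I-resp (∣⇒≈̄ {H} (- 1# , solve 1 (λ h → :0 :- h := h :* (:- :1)) refl (toPoly H))) I-zero
      where
      open 𝐒̄.IsPrime P-prime
      open 𝐒̄.IsIdeal isIdeal

    IsPrime-S⇒S̄ : IsPrime P → toPoly H ∈ P → 𝐒̄.IsPrime P
    IsPrime-S⇒S̄ P-prime H∈P = record
      { isIdeal = record
        { I-resp = λ {x} {y} e h → I-shift′ isIdeal (let q , r = ≈̄⇒∣ {H} e in I-resp (sym r) (I-mulʳ isIdeal q H∈P)) h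
        ; I-zero = I-zero ; I-add = I-add ; I-mul = I-mul }
      ; proper = proper ; prime = prime }
      where
      open IsPrime P-prime
      open IsIdeal isIdeal

  IsPrime-≐ : ∀ {p q} {P : Pred Carrier p} {Q : Pred Carrier q} → P ≐ Q → IsPrime P → IsPrime Q
  IsPrime-≐ (P⊆Q , Q⊆P) P-prime = record
    { isIdeal = record
      { I-resp = λ e h → P⊆Q (I-resp e (Q⊆P h))
      ; I-zero = P⊆Q I-zero
      ; I-add  = λ g h → P⊆Q (I-add (Q⊆P g) (Q⊆P h))
      ; I-mul  = λ r h → P⊆Q (I-mul r (Q⊆P h)) }
    ; proper = λ h → proper (Q⊆P h)
    ; prime  = λ h → [ (λ g → inj₁ (P⊆Q g)) , (λ g → inj₂ (P⊆Q g)) ]′ (prime (Q⊆P h)) }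
    where
    open IsPrime P-prime
    open IsIdeal isIdeal

  module Flat (A : Arrangement) {H} (H∈A : H ∈ˡ forms A) (X : Pred V (c ⊔ ℓ₁)) (flat : IsFlat A H X) where

    private
      B₀ = proj₁ flat
      X≐ = proj₂ (proj₂ flat)

    equations : List Form
    equations = B₀ ++ (H ∷ [])

    private
      base = hyperplaneFrame (nonzero′ A H∈A)
      total = extendAll (proj₁ base) B₀

    X-frame : Frame equations
    X-frame = proj₁ total

    open Restriction X-frame public
    open Deformation X-frame public

    dim<ℓ : dim ℕ.< ℓ
    dim<ℓ = ℕ.≤-<-trans (proj₂ total) (proj₂ base)

    X⊆H : X ⊆ ker H
    X⊆H x = proj₁ (proj₁ X≐ x)

    X⇒Vanishing : ∀ {v} → v ∈ X → v ∈ Vanishing equations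
    X⇒Vanishing {v} x {β} p with ∈ˡ.∈-++⁻ B₀ p
    ... | inj₁ q              = All.lookup (proj₂ (proj₁ X≐ x)) q
    ... | inj₂ (here ≡.refl) = X⊆H x

    Vanishing⇒X : ∀ {v} → v ∈ Vanishing equations → v ∈ X
    Vanishing⇒X {v} h = proj₂ X≐ (h (∈ˡ.∈-++⁺ʳ B₀ (here ≡.refl)) , All.tabulate λ p → h (∈ˡ.∈-++⁺ˡ p))

    ⊇⇒Kernel : ∀ {α} → X ⊆ ker α → toPoly α ∈ Kernel
    ⊇⇒Kernel {α} h = vanishing⇒Kernel α λ j → h (Vanishing⇒X (vanish j))

    Kernel⇒⊇ : ∀ {α} → toPoly α ∈ Kernel → X ⊆ ker α
    Kernel⇒⊇ {α} k x = Span-vanishing (Kernel⇒Span α k) (X⇒Vanishing x)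

    H∈Kernel : toPoly H ∈ Kernel
    H∈Kernel = ⊇⇒Kernel {H} X⊆H

    Kernel⇒definingIdeal : Kernel ⊆ definingIdeal H X
    Kernel⇒definingIdeal = Kernel⊆ ideal λ {β} p → Ideals.gen
      (β , (λ x → X⇒Vanishing x p) , CommutativeRing.refl (S̄ H))
      where
      ideal : IsIdeal (definingIdeal H X)
      ideal = record
        { I-resp = λ e → Ideals.resp (∣⇒≈̄ {H} (0# , trans (x≈y⇒x-y≈0 e) (sym (zeroʳ _))))
        ; I-zero = Ideals.zer ; I-add = Ideals.add ; I-mul = Ideals.mul }

    definingIdeal⇒Kernel : definingIdeal H X ⊆ Kernel
    definingIdeal⇒Kernel = go
      where
      open Ideals.IsPrime (IsPrime-S⇒S̄ {P = Kernel} {H} Kernel-isPrime H∈Kernel)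
      open Ideals.IsIdeal isIdeal
      go : definingIdeal H X ⊆ Kernel
      go (Ideals.gen (α , X⊆α , e)) = I-resp (CommutativeRing.sym (S̄ H) e) (⊇⇒Kernel {α} X⊆α)
      go Ideals.zer                  = I-zero
      go (Ideals.add p q)            = I-add (go p) (go q)
      go (Ideals.mul r p)            = I-mul r (go p)
      go (Ideals.resp e p)           = I-resp e (go p)

    definingIdeal-isPrime : Ideals.IsPrime (S̄ H) (definingIdeal H X)
    definingIdeal-isPrime = IsPrime-S⇒S̄ (IsPrime-≐ (Kernel⇒definingIdeal , definingIdeal⇒Kernel) Kernel-isPrime)
      (Kernel⇒definingIdeal H∈Kernel)

    Aₓ = localization A X

    H∈Aₓ′ : H ∈ˡ forms Aₓ
    H∈Aₓ′ = H∈Aₓ A H∈A X X⊆H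

    Jₓ J : Pred Carrier (c ⊔ ℓ₁)
    Jₓ = residueIdeal Aₓ H
    J = residueIdeal A H

    localForms⊆ : ∀ {L} → L ∈ˡ forms Aₓ → toPoly L ∈ Kernel
    localForms⊆ {L} p = ⊇⇒Kernel {L} (proj₂ (∈ˡ.∈-filter⁻ (X⊆? A H∈A X X⊆H) {xs = forms A} p))

    primary : ∀ {p f} → p * f ∈ Jₓ → p ∉ Kernel → f ∈ Jₓ
    primary = cancel-Kernel Aₓ H∈Aₓ′ localForms⊆

    1∈J⇒U : 1# ∈ Jₓ → Jₓ ≐ U
    1∈J⇒U h = (λ _ → _) , λ {x} _ → IsIdeal.I-resp (J-isIdeal Aₓ H∈Aₓ′) (*-identityʳ x) (IsIdeal.I-mul (J-isIdeal Aₓ H∈Aₓ′) x h)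

    Jₓ⊆Kernel : ¬ (Jₓ ≐ U) → Jₓ ⊆ Kernel
    Jₓ⊆Kernel proper {r} h = byCases λ r∉ → contradiction
      (1∈J⇒U (primary (IsIdeal.I-resp (J-isIdeal Aₓ H∈Aₓ′) (sym (*-identityʳ r)) h) r∉)) proper

    onlyLocalForms : ∀ {L} → L ∈ˡ forms A → toPoly L ∈ Kernel → X ⊆ ker L
    onlyLocalForms {L} _ = Kernel⇒⊇ {L}

    J⊆Kernel : ¬ (Jₓ ≐ U) → J ⊆ Kernel
    J⊆Kernel proper h = [ (λ q∈ → contradiction q∈ (q∉ A H∈A X X⊆H Kernel-isPrime onlyLocalForms)) , id ]′
      (IsPrime.prime Kernel-isPrime (Jₓ⊆Kernel proper (localize A H∈A X X⊆H h)))

  module _ (A : Arrangement) {H} (H∈A : H ∈ˡ forms A) (P : Pred Carrier (c ⊔ ℓ₁)) (P-prime̅ : Ideals.IsPrime (S̄ H) P) where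

    private
      P-prime = IsPrime-S̄⇒S P-prime̅
      P? : Decidable₁ (λ L → toPoly L ∈ P)
      P? L = em

    -- For this flat X, the ideals J_A and J_{A_X} agree after localization at P.
    centre : Pred V (c ⊔ ℓ₁)
    centre = ker H ∩ λ v → All (λ L → v ∈ ker L) (filter P? (restriction A H))

    centre-flat : IsFlat A H centre
    centre-flat = filter P? (restriction A H) , (λ p → proj₁ (∈ˡ.∈-filter⁻ P? p)) , (λ x → x) , (λ x → x)

    private module X = Flat A H∈A centre centre-flat

    Kernel⊆P : X.Kernel ⊆ P
    Kernel⊆P = X.Kernel⊆ (IsPrime.isIdeal P-prime) λ {β} p → case ∈ˡ.∈-++⁻ (filter P? (restriction A H)) p of λ
      { (inj₁ q)             → proj₂ (∈ˡ.∈-filter⁻ P? {xs = restriction A H} q)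
      ; (inj₂ (here ≡.refl)) → H∈P P-prime̅ }

    centre⊆ : ∀ {L} → L ∈ˡ forms A → toPoly L ∈ P → centre ⊆ ker L
    centre⊆ {L} L∈A L∈P {v} (v∈H , v∈B) with em {P = ker L ≐ ker H}
    ... | yes (_ , H⊆L) = H⊆L v∈H
    ... | no L≠H with representative A L∈A L≠H
    ...   | M , M∈R , (M⇒L , L⇒M) = proj₂ (M⇒L (v∈H , All.lookup v∈B (∈ˡ.∈-filter⁺ P? M∈R M∈P)))
      where
      M∈Span : Span (H ∷ L ∷ []) M
      M∈Span = Span-of-vanishing λ h → proj₂ (L⇒M (h (here ≡.refl) , h (there (here ≡.refl))))
      M∈P : toPoly M ∈ P
      M∈P = Span⊆ (IsPrime.isIdeal P-prime) (λ { (here ≡.refl) → H∈P P-prime̅ ; (there (here ≡.refl)) → L∈P }) M∈Span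

    module _ (J⊆P : residueIdeal A H ⊆ P) where

      Jₓ⊆P : X.Jₓ ⊆ P
      Jₓ⊆P h = [ (λ r → contradiction r (rest∉ A H∈A centre X.X⊆H P-prime centre⊆)) , id ]′
        (IsPrime.prime P-prime (J⊆P (globalize A H∈A centre X.X⊆H h)))

      centre∈Ξ : centre ∈ Ξ A H
      centre∈Ξ = centre-flat , λ { (_ , U⊆) → IsPrime.proper P-prime (Jₓ⊆P (U⊆ {1#} _)) }

  module _ (A : Arrangement) {H} (H∈A : H ∈ˡ forms A) where

    private
      J = residueIdeal A H
      module 𝐒̄ = Ideals (S̄ H)

    associatedPrimes : ∀ (P : Pred Carrier (c ⊔ ℓ₁)) → 𝐒̄.IsAssociatedPrime J P →
                       ∃ λ X → X ∈ Ξ A H × P ≐ definingIdeal H X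
    associatedPrimes P (P-prime̅ , f , P⇒ , ⇒P) =
      X , centre∈Ξ A H∈A P P-prime̅ J⊆P ,
      (λ {p} p∈P → Kernel⇒definingIdeal (byCases λ p∉ → contradiction (rest*q∈P p∈P p∉) rest*q∉)) ,
      λ d → Kernel⊆P A H∈A P P-prime̅ (definingIdeal⇒Kernel d)
      where
      X = centre A H∈A P P-prime̅
      open Flat A H∈A X (centre-flat A H∈A P P-prime̅) hiding (J)
      P-prime = IsPrime-S̄⇒S P-prime̅

      annihilates : ∀ {r} → r ∈ P → r * f ∈ J
      annihilates {r} r∈P with P⇒ r∈P
      ... | Ideals.mod d = IsIdeal.I-resp (J-isIdeal A H∈A) (x-0≈x (r * f)) (J-closed A H∈A d)

      annihilator : ∀ {r} → r * f ∈ J → r ∈ P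
      annihilator {r} h = ⇒P (Ideals.mod (Ideals.gen (IsIdeal.I-resp (J-isIdeal A H∈A) (sym (x-0≈x (r * f))) h)))

      J⊆P : J ⊆ P
      J⊆P h = annihilator (I-mulʳ (J-isIdeal A H∈A) f h)

      q′ = q A H∈A X X⊆H
      rest′ = rest A H∈A X X⊆H

      rest*q∈P : ∀ {p} → p ∈ P → p ∉ Kernel → rest′ * q′ ∈ P
      rest*q∈P {p} p∈P p∉ = annihilator (IsIdeal.I-resp (J-isIdeal A H∈A) (sym (*-assoc _ _ _))
        (globalize A H∈A X X⊆H (primary (IsIdeal.I-resp (J-isIdeal Aₓ H∈Aₓ′)
          (solve 3 (λ q p f → q :* (p :* f) := p :* (q :* f)) refl q′ p f)
          (localize A H∈A X X⊆H (annihilates p∈P))) p∉)))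

      rest*q∉ : rest′ * q′ ∉ P
      rest*q∉ h = [ rest∉ A H∈A X X⊆H P-prime (centre⊆ A H∈A P P-prime̅) , q∉ A H∈A X X⊆H P-prime (centre⊆ A H∈A P P-prime̅) ]′
        (IsPrime.prime P-prime h)

    private
      module Order {X Y} (X-flat : IsFlat A H X) (Y-flat : IsFlat A H Y) where
        module X = Flat A H∈A X X-flat
        module Y = Flat A H∈A Y Y-flat

        antitone : X ⊆ Y → Y.Kernel ⊆ X.Kernel
        antitone X⊆Y = Y.Kernel⊆ X.Kernel-isIdeal λ {β} p → X.⊇⇒Kernel {β} (λ x → Y.X⇒Vanishing (X⊆Y x) p)

        antitone⁻ : Y.Kernel ⊆ X.Kernel → X ⊆ Y
        antitone⁻ h x = Y.Vanishing⇒X λ {β} p → X.Kernel⇒⊇ {β} (h (Y.form∈Kernel p)) x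

    minimalPrimes⇒ : ∀ (P : Pred Carrier (c ⊔ ℓ₁)) → 𝐒̄.IsMinimalPrimeOver J P →
                     ∃ λ X → X ∈ Ξmax A H × P ≐ definingIdeal H X
    minimalPrimes⇒ P record { isPrime = P-prime̅ ; contains = J⊆P ; minimal = minimal } =
      X , (X∈Ξ , maximal) , P⊆ , λ d → Kernel⊆P A H∈A P P-prime̅ (X.definingIdeal⇒Kernel d)
      where
      X = centre A H∈A P P-prime̅
      X-flat = centre-flat A H∈A P P-prime̅
      X∈Ξ = centre∈Ξ A H∈A P P-prime̅ J⊆P
      module X = Flat A H∈A X X-flat

      P⊆ : P ⊆ definingIdeal H X
      P⊆ = minimal (definingIdeal H X) X.definingIdeal-isPrime (λ h → X.Kernel⇒definingIdeal (X.J⊆Kernel (proj₂ X∈Ξ) h))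
        (λ d → Kernel⊆P A H∈A P P-prime̅ (X.definingIdeal⇒Kernel d))

      maximal : ∀ Y → Y ∈ Ξ A H → X ⊆ Y → Y ⊆ X
      maximal Y (Y-flat , Y-proper) X⊆Y = Order.antitone⁻ Y-flat X-flat λ k →
        Y.definingIdeal⇒Kernel (minimal (definingIdeal H Y) Y.definingIdeal-isPrime
          (λ h → Y.Kernel⇒definingIdeal (Y.J⊆Kernel Y-proper h))
          (λ d → Kernel⊆P A H∈A P P-prime̅ (Order.antitone X-flat Y-flat X⊆Y (Y.definingIdeal⇒Kernel d)))
          (Kernel⊆P A H∈A P P-prime̅ k))
        where module Y = Flat A H∈A Y Y-flat

    minimalPrimes⇐ : ∀ (P : Pred Carrier (c ⊔ ℓ₁)) → (∃ λ X → X ∈ Ξmax A H × P ≐ definingIdeal H X) →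
                     𝐒̄.IsMinimalPrimeOver J P
    minimalPrimes⇐ P (X , ((X-flat , X-proper) , maximal) , P⊆ , ⊆P) = record
      { isPrime  = IsPrime-S⇒S̄ (IsPrime-≐ {P = X.Kernel} ((λ k → ⊆P (X.Kernel⇒definingIdeal k)) , (λ h → X.definingIdeal⇒Kernel (P⊆ h)))
                     X.Kernel-isPrime) (⊆P (X.Kernel⇒definingIdeal X.H∈Kernel))
      ; contains = λ h → ⊆P (X.Kernel⇒definingIdeal (X.J⊆Kernel X-proper h))
      ; minimal  = λ P′ P′-prime̅ J⊆P′ P′⊆P p∈P → let
          Y = centre A H∈A P′ P′-prime̅
          Y-flat = centre-flat A H∈A P′ P′-prime̅
          X⊆Y = Order.antitone⁻ X-flat Y-flat (λ k → X.definingIdeal⇒Kernel (P⊆ (P′⊆P (Kernel⊆P A H∈A P′ P′-prime̅ k))))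
          Y⊆X = maximal Y (centre∈Ξ A H∈A P′ P′-prime̅ J⊆P′) X⊆Y
          in Kernel⊆P A H∈A P′ P′-prime̅ (Order.antitone Y-flat X-flat Y⊆X (X.definingIdeal⇒Kernel (P⊆ p∈P)))
      }
      where module X = Flat A H∈A X X-flat

module Divisibility (em : ∀ {a} → ExcludedMiddle a) {c ℓ₁ ℓ₂} (F : HeytingField c ℓ₁ ℓ₂) (ℓ : ℕ) where

  open Arrangements F ℓ
  open Residues em
  open LinearForms em F ℓ
  open RestrictionToSubspace em F ℓ
  open ResidueIdeals em F ℓ
  open Localization em F ℓ
  private
    module K = CommutativeRing scalars
    module 𝐊 = RingKit scalars
  open CommutativeRing S hiding (zero)
  open RingKit S
  open Ideals S using (IsIdeal; IsPrime)
  open IdealKit S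

  product-∣ : ∀ {fs x} → All Nonzero fs → AllPairs (λ α β → ¬ (ker α ≐ ker β)) fs →
              (∀ {L} → L ∈ˡ fs → toPoly L ∣ x) → product fs ∣ x
  product-∣ {[]} {x} _ _ _ = x , sym (*-identityˡ x)
  product-∣ {L ∷ fs} {x} (L≉0 ∷ nonzeros) (L≠ ∷ pairs) h =
    proj₁ others , trans x≈Ly (trans (*-congˡ (proj₂ others)) (sym (*-assoc _ _ _)))
    where
    y = proj₁ (h (here ≡.refl))
    x≈Ly : x ≈ toPoly L * y
    x≈Ly = proj₂ (h (here ≡.refl))
    divides : ∀ {M} → M ∈ˡ fs → toPoly M ∣ y
    divides {M} M∈ =
      [ (λ M∣L → ⊥-elim (All.lookup L≠ M∈ (ker-antisym {L} {M} L≉0 (∣-toPoly⇒ker⊆ {M} {L} M∣L)))) , id ]′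
      (toPoly-prime M {toPoly L} {y} (IsIdeal.I-resp (∣-isIdeal (toPoly M)) x≈Ly (h (there M∈))))
    others : product fs ∣ y
    others = product-∣ nonzeros pairs divides

  Q-∣ : ∀ A {x} → (∀ {L} → L ∈ˡ forms A → toPoly L ∣ x) → Q A ∣ x
  Q-∣ A = product-∣ (nonzero A) (distinct A)

  Q≉0 : ∀ A → ¬ Q A ≈ 0#
  Q≉0 A = product∉ prime₀ (forms A) (λ L∈A → toPoly≉0 (nonzero′ A L∈A))
    where
    prime₀ : IsPrime (_≈ 0#)
    prime₀ = record
      { isIdeal = ≈0-isIdeal
      ; proper  = 1≉0-S
      ; prime   = λ {x} {y} e → [ inj₁ , (λ reg → inj₂ (reg y e)) ]′ (integral-S x) }

  Q-cancel : ∀ A {x y} → Q A * x ≈ Q A * y → x ≈ y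
  Q-cancel A {x} {y} e = [ (λ z → contradiction z (Q≉0 A)) ,
    (λ reg → x-y≈0⇒x≈y (reg (x - y) (trans (solve 3 (λ q x y → q :* (x :- y) := q :* x :- q :* y) refl (Q A) x y) (x≈y⇒x-y≈0 e)))) ]′
    (integral-S (Q A))

  module ModuloForm (H : Form) where

    private
      𝐇 = ∣-isIdeal (toPoly H)
      module 𝐇 = IsIdeal 𝐇

    ∈⟪_,H⟫ : Form → Pred Carrier ℓ₁
    ∈⟪ L ,H⟫ = ⟪_⟫.Kernel (L ∷ H ∷ [])

    decompose : ∀ {L x} → x ∈ ∈⟪ L ,H⟫ → ∃ λ y → toPoly H ∣ (toPoly L * y - x)
    decompose {L} = ⟪_⟫.Kernel⊆ (L ∷ H ∷ []) ideal λ
      { (here ≡.refl)         → 1# , 𝐇.I-resp (sym (x≈y⇒x-y≈0 (*-identityʳ _))) 𝐇.I-zero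
      ; (there (here ≡.refl)) → 0# , - 1# , solve 2 (λ l h → l :* :0 :- h := h :* (:- :1)) refl (toPoly L) (toPoly H) }
      where
      ideal : IsIdeal (λ x → ∃ λ y → toPoly H ∣ (toPoly L * y - x))
      ideal = record
        { I-resp = λ { e (y , d) → y , 𝐇.I-resp (+-congˡ (-‿cong e)) d }
        ; I-zero = 0# , 𝐇.I-resp (solve 1 (λ l → :0 := l :* :0 :- :0) refl (toPoly L)) 𝐇.I-zero
        ; I-add  = λ { {a} {b} (y , d) (z , e) → y + z , 𝐇.I-resp
            (solve 5 (λ l y z a b → (l :* y :- a) :+ (l :* z :- b) := l :* (y :+ z) :- (a :+ b)) refl (toPoly L) y z a b) (𝐇.I-add d e) }
        ; I-mul  = λ { r {a} (y , d) → r * y , 𝐇.I-resp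
            (solve 4 (λ r l y a → r :* (l :* y :- a) := l :* (r :* y) :- r :* a) refl r (toPoly L) y a) (𝐇.I-mul r d) }
        }

    H⊆⟪⟫ : ∀ {L x} → toPoly H ∣ x → x ∈ ∈⟪ L ,H⟫
    H⊆⟪⟫ {L} (q , e) = I-resp (sym e) (I-mulʳ (⟪_⟫.Kernel-isIdeal (L ∷ H ∷ [])) q (⟪_⟫.form∈Kernel (L ∷ H ∷ []) (there (here ≡.refl))))
      where open IsIdeal (⟪_⟫.Kernel-isIdeal (L ∷ H ∷ []))

    L⊆⟪⟫ : ∀ {L x} → toPoly L ∣ x → x ∈ ∈⟪ L ,H⟫
    L⊆⟪⟫ {L} (q , e) = I-resp (sym e) (I-mulʳ (⟪_⟫.Kernel-isIdeal (L ∷ H ∷ [])) q (⟪_⟫.form∈Kernel (L ∷ H ∷ []) (here ≡.refl)))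
      where open IsIdeal (⟪_⟫.Kernel-isIdeal (L ∷ H ∷ []))

    distinct-traces : ∀ {L M} → Nonzero L → ¬ (ker L ≐ ker H) → ¬ SameTrace H L M → toPoly L ∉ ∈⟪ M ,H⟫
    distinct-traces {L} {M} L≉0 L≠H L≁M d = L≁M
      ( (λ { {v} (v∈H , v∈L) → v∈H , M-vanishes v v∈H v∈L })
      , (λ { (v∈H , v∈M) → v∈H , Span-vanishing span λ { (here ≡.refl) → v∈M ; (there (here ≡.refl)) → v∈H } }))
      where
      span = ⟪_⟫.Kernel⇒Span (M ∷ H ∷ []) L d
      a = proj₁ (Span₂ span)
      b = proj₁ (proj₂ (Span₂ span))
      L≈ = proj₂ (proj₂ (Span₂ span))

      L∙ : ∀ v → L 𝐊.∙ v K.≈ a K.* M 𝐊.∙ v K.+ b K.* H 𝐊.∙ v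
      L∙ v = K.trans (𝐊.∙-cong L≈ (λ _ → K.refl)) (K.trans (𝐊.∙-+ˡ (λ i → a K.* M i) (λ i → b K.* H i) v)
        (K.+-cong (𝐊.∙-*ˡ a M v) (𝐊.∙-*ˡ b H v)))

      a≉0 : ¬ a K.≈ K.0#
      a≉0 a≈0 = L≠H (ker-antisym {L} {H} L≉0 λ {v} v∈H → K.trans (L∙ v)
        (K.trans (K.+-cong (K.trans (K.*-congʳ a≈0) (K.zeroˡ _)) (K.trans (K.*-congˡ v∈H) (K.zeroʳ b))) (K.+-identityˡ _)))

      M-vanishes : ∀ v → v ∈ ker H → v ∈ ker L → M 𝐊.∙ v K.≈ K.0#
      M-vanishes v v∈H v∈L = [ (λ z → contradiction z a≉0) , (λ reg → reg (M 𝐊.∙ v) aMv≈0) ]′ (integral a)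
        where
        aMv≈0 : a K.* M 𝐊.∙ v K.≈ K.0#
        aMv≈0 = K.trans (K.sym (K.trans (K.+-congˡ (K.trans (K.*-congˡ v∈H) (K.zeroʳ b))) (K.+-identityʳ _)))
          (K.trans (K.sym (L∙ v)) v∈L)

    product-∣̄ : ∀ fs {x} → All Nonzero fs → All (λ L → ¬ (ker L ≐ ker H)) fs → AllPairs (λ L M → ¬ SameTrace H L M) fs →
                (∀ {L} → L ∈ˡ fs → x ∈ ∈⟪ L ,H⟫) → ∃ λ y → toPoly H ∣ (product fs * y - x)
    product-∣̄ [] {x} _ _ _ _ = x , 𝐇.I-resp (sym (x≈y⇒x-y≈0 (*-identityˡ x))) 𝐇.I-zero
    product-∣̄ (L ∷ fs) {x} (L≉0 ∷ nonzeros) (L≠H ∷ L≠Hs) (L≁ ∷ pairs) h = proj₁ others , 𝐇.I-resp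
      (solve 5 (λ l y x p z → (l :* y :- x) :+ l :* (p :* z :- y) := (l :* p) :* z :- x) refl (toPoly L) y x (product fs) (proj₁ others))
      (𝐇.I-add d′ (𝐇.I-mul (toPoly L) (proj₂ others)))
      where
      y = proj₁ (decompose {L} (h (here ≡.refl)))
      d′ : toPoly H ∣ (toPoly L * y - x)
      d′ = proj₂ (decompose {L} (h (here ≡.refl)))
      divides : ∀ {M} → M ∈ˡ fs → y ∈ ∈⟪ M ,H⟫
      divides {M} M∈ = [ (λ L∈ → contradiction L∈ (distinct-traces {L} {M} L≉0 L≠H (All.lookup L≁ M∈))) , id ]′
        (IsPrime.prime (⟪_⟫.Kernel-isPrime (M ∷ H ∷ [])) {toPoly L} {y}
          (I-shift (⟪_⟫.Kernel-isIdeal (M ∷ H ∷ [])) (H⊆⟪⟫ {M} d′) (h (there M∈))))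
      others : ∃ λ z → toPoly H ∣ (product fs * z - y)
      others = product-∣̄ fs {y} nonzeros L≠Hs pairs divides

  module _ (A : Arrangement) {H} (H∈A : H ∈ˡ forms A) where

    open ModuloForm H
    private
      𝐇 = ∣-isIdeal (toPoly H)
      module 𝐇 = IsIdeal 𝐇

      R⊆A : ∀ {L} → L ∈ˡ restriction A H → L ∈ˡ forms A
      R⊆A = Sublist.Any-resp-⊆ (restriction-Sublist A H)

    residueExists : ∀ {η} → η ∈ Log A → ∀ v → H 𝐊.∙ v K.≈ K.1# →
                    ∃ λ r → toPoly H ∣ (product (restriction A H) * r - η ⌟ v)
    residueExists {η} h v Hv≈1 = product-∣̄ (restriction A H)
      (All.tabulate λ p → nonzero′ A (R⊆A p)) (All.tabulate λ {L} p → restriction-≠ A H {L} p)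
      (deduplicate-AllPairs (SameTrace? H) (filter (λ L → ¬? (em {P = ker L ≐ ker H})) (forms A))) divisible
      where
      open FilterDeduplicate
      divisible : ∀ {L} → L ∈ˡ restriction A H → (η ⌟ v) ∈ ∈⟪ L ,H⟫
      divisible {L} p = let u , Hu≈1 , Lu≈0 = separate {H} {L} (nonzero′ A H∈A) (restriction-≠ A H p) in
        I-shift (⟪_⟫.Kernel-isIdeal (L ∷ H ∷ []))
          (H⊆⟪⟫ {L} (⌟-independent A {η} {H} h H∈A v u (K.trans Hv≈1 (K.sym Hu≈1))))
          (L⊆⟪⟫ {L} (contraction-vector A {η} {L} h (R⊆A p) u Lu≈0))

    restriction-cancel : ∀ {x} → toPoly H ∣ (product (restriction A H) * x) → toPoly H ∣ x
    restriction-cancel {x} d = [ (λ p → contradiction p product∉H) , Kernel₁⇒∣ ]′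
      (IsPrime.prime (⟪_⟫.Kernel-isPrime (H ∷ [])) {product (restriction A H)} {x} (∣⇒Kernel₁ d))
      where
      product∉H : product (restriction A H) ∉ ⟪_⟫.Kernel (H ∷ [])
      product∉H = product∉ (⟪_⟫.Kernel-isPrime (H ∷ [])) (restriction A H) λ {L} p k →
        restriction-≠ A H p (ker-antisym {L} {H} (nonzero′ A (R⊆A p)) (∣-toPoly⇒ker⊆ {H} {L} (Kernel₁⇒∣ k)))

  extract : ∀ {L fs} → L ∈ˡ fs → ∃ λ gs → product fs ≈ toPoly L * product gs × (∀ {M} → M ∈ˡ fs → M ≡ L ⊎ M ∈ˡ gs)
  extract {L} {_ ∷ fs} (here ≡.refl) = fs , refl , λ { (here e) → inj₁ e ; (there p) → inj₂ p }
  extract {L} {N ∷ fs} (there p) = let gs , e , h = extract p in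
    N ∷ gs , trans (*-congˡ e) (solve 3 (λ n l x → n :* (l :* x) := l :* (n :* x)) refl (toPoly N) (toPoly L) _) ,
    λ { (here ≡.refl) → inj₂ (here ≡.refl)
      ; (there q) → [ inj₁ , (λ r → inj₂ (there r)) ]′ (h q) }

module Grading (em : ∀ {a} → ExcludedMiddle a) {c ℓ₁ ℓ₂} (F : HeytingField c ℓ₁ ℓ₂) (ℓ : ℕ) where

  open Arrangements F ℓ
  open Residues em
  open LinearForms em F ℓ
  open RestrictionToSubspace em F ℓ
  open ResidueIdeals em F ℓ
  open Invariance em F ℓ
  open MvPolyKit scalars
  private
    module K = CommutativeRing scalars
    module κ = Hom (constHom ℓ)
    module 𝐊 = RingKit scalars
  open CommutativeRing S hiding (zero)
  open RingKit S
  open Ideals S using (IsIdeal; ⟨_⟩)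
  open IdealKit S
  open PolyKit S

  Span-∑ : ∀ {B n} (a : Vector K.Carrier n) {β : Fin n → Form} → (∀ i → Span B (β i)) → Span B (λ k → 𝐊.∑ (λ i → a i K.* β i k))
  Span-∑ {n = zero}  a s = null
  Span-∑ {n = suc n} a s = plus (times (a zero) (s zero)) (Span-∑ (a ∘ suc) (s ∘ suc))

  originFrame : Frame (List.tabulate 𝐊.δ)
  originFrame = record
    { dim = 0 ; w = λ () ; y = λ () ; dual = λ () ; vanish = λ ()
    ; spans = λ α _ → respect (λ k → K.trans (𝐊.∙-cong {u = α} (λ _ → K.refl) (λ i → 𝐊.δ-sym i k)) (𝐊.∙-δ α k))
        (Span-∑ α (λ i → member (∈ˡ.∈-tabulate⁺ i)))
    }

  private
    module O = Restriction originFrame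
    module D = Deformation originFrame
  open D using (T; module T)

  ε : Hom S scalars
  ε = O.ρ
  module ε = Hom ε

  ε-κ : ∀ a → ε.⟦ κ a ⟧ K.≈ a
  ε-κ = O.ρ-const

  ε-toPoly : ∀ α → ε.⟦ toPoly α ⟧ K.≈ K.0#
  ε-toPoly α = O.vanishing⇒Kernel α λ ()

  component : ℕ → Carrier → Carrier
  component d x = coeff T.⟦ x ⟧ d

  component-cong : ∀ d {x y} → x ≈ y → component d x ≈ component d y
  component-cong d e = at (T.cong e) d

  component-0 : ∀ x → component 0 x ≈ κ ε.⟦ x ⟧
  component-0 = D.T-coeff₀

  component-zero : ∀ d → component d 0# ≈ 0#
  component-zero d = at T.0-homo d

  component-+ : ∀ d x y → component d (x + y) ≈ component d x + component d y
  component-+ d x y = trans (at (T.+-homo x y) d) (coeff-⊕ T.⟦ x ⟧ T.⟦ y ⟧ d)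

  component-* : ∀ {p} {I : Pred Carrier p} → IsIdeal I → ∀ d x y →
                (∀ i j → i ℕ.+ j ≡ d → component i x * component j y ∈ I) → component d (x * y) ∈ I
  component-* {I = I} ideal d x y h = I-resp (sym (at (T.*-homo x y) d))
    (coeff-⊗ I I-resp I-zero I-add T.⟦ x ⟧ T.⟦ y ⟧ d h)
    where open IsIdeal ideal

  component-toPoly : ∀ d α → toPoly α ∣ component d (toPoly α)
  component-toPoly d α = coeff X d , trans (at (D.T-Kernel {α} (ε-toPoly α)) d) (coeff-C* (toPoly α) X d)

  assemble : ∀ {p} {I : Pred Carrier p} → IsIdeal I → ∀ {x} → (∀ d → component d x ∈ I) → x ∈ I
  assemble ideal {x} h = IsIdeal.I-resp ideal (D.undo-T x) (MvCoeff.evaluate-Extension S ideal 1 D.origin {T.⟦ x ⟧} h)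

  private
    module 𝐓 = PolyKit polynomialRing
    open 𝐓 using () renaming (polynomialRing to S[t][u])
    module U = CommutativeRing S[t][u]

    Φ Ψ : Hom polynomialRing S[t][u]
    Φ = evalHom (𝐓.CHom ∘ᴴ T) 𝐓.X
    Ψ = evalHom (𝐓.CHom ∘ᴴ CHom) (𝐓.C X U.* 𝐓.X)
    module Φ = Hom Φ
    module Ψ = Hom Ψ

    Φ-coeff : ∀ p d → 𝐓.coeff Φ.⟦ p ⟧ d ≋ T.⟦ coeff p d ⟧
    Φ-coeff []      d       = ≋-sym T.0-homo
    Φ-coeff (a ∷ p) zero    = 𝐓.at (𝐓.C+X* T.⟦ a ⟧ Φ.⟦ p ⟧) 0
    Φ-coeff (a ∷ p) (suc d) = ≋-trans (𝐓.at (𝐓.C+X* T.⟦ a ⟧ Φ.⟦ p ⟧) (suc d)) (Φ-coeff p d)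

    Ψ-step : ∀ a p → Ψ.⟦ a ∷ p ⟧ 𝐓.≋ (C a ∷ 𝐓.scale X Ψ.⟦ p ⟧)
    Ψ-step a p = U.trans (U.+-congˡ {𝐓.C (C a)} (U.trans (U.trans (U.*-congʳ {Ψ.⟦ p ⟧} (U.*-comm (𝐓.C X) 𝐓.X)) (U.*-assoc 𝐓.X (𝐓.C X) Ψ.⟦ p ⟧))
        (U.*-congˡ {𝐓.X} (𝐓.C-* X Ψ.⟦ p ⟧))))
      (𝐓.C+X* (C a) (𝐓.scale X Ψ.⟦ p ⟧))

    Ψ-coeff : ∀ p d → 𝐓.coeff Ψ.⟦ p ⟧ d ≋ shift d (C (coeff p d))
    Ψ-coeff []      zero    = ≋-sym 0∷[]
    Ψ-coeff []      (suc d) = ≋-sym (shift-zero (suc d))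
      where
      shift-zero : ∀ d → shift d (C 0#) ≋ []
      shift-zero zero    = 0∷[]
      shift-zero (suc d) = ≋-trans (∷-cong refl (shift-zero d)) 0∷[]
    Ψ-coeff (a ∷ p) zero    = 𝐓.at (Ψ-step a p) 0
    Ψ-coeff (a ∷ p) (suc d) = ≋-trans (𝐓.at (Ψ-step a p) (suc d)) (≋-trans (𝐓.coeff-scale X Ψ.⟦ p ⟧ d)
      (≋-trans (X-* (𝐓.coeff Ψ.⟦ p ⟧ d)) (∷-cong refl (Ψ-coeff p d))))

    T-linear-var : ∀ i → T.⟦ var scalars {ℓ} i ⟧ ≋ C (var scalars {ℓ} i) ⊗ X
    T-linear-var i = ≋-trans (T.cong (sym (toPoly-δ i))) (≋-trans (D.T-Kernel {𝐊.δ i} (ε-toPoly (𝐊.δ i)))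
      (⊗-cong (∷-cong (toPoly-δ i) (≋-refl {[]})) (≋-refl {X})))

    Φ∘T≈Ψ∘T : ∀ x → Φ.⟦ T.⟦ x ⟧ ⟧ 𝐓.≋ Ψ.⟦ T.⟦ x ⟧ ⟧
    Φ∘T≈Ψ∘T = hom-unique (Φ ∘ᴴ T) (Ψ ∘ᴴ T)
      (λ a → U.trans (Φ.cong (D.T-const a)) (U.trans (eval-C (𝐓.CHom ∘ᴴ T) 𝐓.X (κ a)) (U.trans (Hom.cong 𝐓.CHom (D.T-const a))
        (U.sym (U.trans (Ψ.cong (D.T-const a)) (eval-C (𝐓.CHom ∘ᴴ CHom) (𝐓.C X U.* 𝐓.X) (κ a)))))))
      (λ i → let x = var scalars {ℓ} i in
        U.trans (Φ.cong (T-linear-var i)) (U.trans (Φ.*-homo (C x) X) (U.trans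
          (U.*-cong {Φ.⟦ C x ⟧} {𝐓.C (C x) U.* 𝐓.C X} {Φ.⟦ X ⟧} {𝐓.X}
            (U.trans (eval-C (𝐓.CHom ∘ᴴ T) 𝐓.X x) (U.trans (Hom.cong 𝐓.CHom (T-linear-var i)) (Hom.*-homo 𝐓.CHom (C x) X)))
            (eval-X (𝐓.CHom ∘ᴴ T) 𝐓.X))
          (U.trans (U.*-assoc (𝐓.C (C x)) (𝐓.C X) 𝐓.X)
          (U.sym (U.trans (Ψ.cong (T-linear-var i)) (U.trans (Ψ.*-homo (C x) X)
            (U.*-cong {Ψ.⟦ C x ⟧} {𝐓.C (C x)} {Ψ.⟦ X ⟧} {𝐓.C X U.* 𝐓.X}
              (eval-C (𝐓.CHom ∘ᴴ CHom) (𝐓.C X U.* 𝐓.X) x) (eval-X (𝐓.CHom ∘ᴴ CHom) (𝐓.C X U.* 𝐓.X))))))))))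

  Homogeneous : Carrier → Set ℓ₁
  Homogeneous x = ∀ d → component d x ≈ 0# ⊎ component d x ≈ x

  -- Coassociativity of the grading: scaling by t and then by u is scaling by tu.
  component-homogeneous : ∀ d x → Homogeneous (component d x)
  component-homogeneous d x e = pick (e ℕ.≟ d)
    where
    spread : T.⟦ component d x ⟧ ≋ shift d (C (component d x))
    spread = ≋-trans (≋-sym (Φ-coeff T.⟦ x ⟧ d)) (≋-trans (𝐓.at (Φ∘T≈Ψ∘T x) d) (Ψ-coeff T.⟦ x ⟧ d))
    pick : Dec (e ≡ d) → component e (component d x) ≈ 0# ⊎ component e (component d x) ≈ component d x
    pick (yes ≡.refl) = inj₂ (trans (at spread d) (reflexive (coeff-shift d (component d x))))
    pick (no e≢d)     = inj₁ (trans (at spread e) (reflexive (coeff-shift-off d e (component d x) e≢d)))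

  residueIdeal-graded : ∀ A {H} → H ∈ˡ forms A → ∀ d {x} → x ∈ residueIdeal A H → component d x ∈ residueIdeal A H
  residueIdeal-graded A H∈A d x∈J = D.coefficients∈J A H∈A (λ {L} _ → ε-toPoly L) x∈J [] d

  module Nakayama {J : Pred Carrier (c ⊔ ℓ₁)} (J-ideal : IsIdeal J) (J-graded : ∀ d {x} → x ∈ J → component d x ∈ J) (H : Form) where

    Generated Generated+𝔪J : ∀ {N} → (Fin N → Carrier) → Pred Carrier (c ⊔ ℓ₁)
    Generated h    = ⟨ (λ s → (∃ λ i → s ≈ h i) ⊎ s ≈ toPoly H) ⟩
    Generated+𝔪J h = ⟨ (λ s → ((∃ λ i → s ≈ h i) ⊎ s ≈ toPoly H) ⊎
                              (∃ λ μ → ∃ λ ζ → ε.⟦ μ ⟧ K.≈ K.0# × ζ ∈ J × s ≈ μ * ζ)) ⟩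

    ⟨⟩-isIdeal : ∀ {g} {G : Pred Carrier g} → IsIdeal ⟨ G ⟩
    ⟨⟩-isIdeal = record { I-resp = Ideals.resp ; I-zero = Ideals.zer ; I-add = Ideals.add ; I-mul = Ideals.mul }

    ⟨⟩-least : ∀ {g p} {G : Pred Carrier g} {I : Pred Carrier p} → IsIdeal I → G ⊆ I → ⟨ G ⟩ ⊆ I
    ⟨⟩-least ideal h (Ideals.gen p)    = h p
    ⟨⟩-least ideal h Ideals.zer        = IsIdeal.I-zero ideal
    ⟨⟩-least ideal h (Ideals.add p q)  = IsIdeal.I-add ideal (⟨⟩-least ideal h p) (⟨⟩-least ideal h q)
    ⟨⟩-least ideal h (Ideals.mul r p)  = IsIdeal.I-mul ideal r (⟨⟩-least ideal h p)
    ⟨⟩-least ideal h (Ideals.resp e p) = IsIdeal.I-resp ideal e (⟨⟩-least ideal h p)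

    module _ {N} (h : Fin N → Carrier) (homogeneous : ∀ i → Homogeneous (h i)) (J⊆ : J ⊆ Generated+𝔪J h) where

      private
        G = Generated h
        module G = IsIdeal (⟨⟩-isIdeal {G = λ s → (∃ λ i → s ≈ h i) ⊎ s ≈ toPoly H})

        step : ∀ d → (∀ {ζ} → ζ ∈ J → ∀ j → j ℕ.< d → component j ζ ∈ G) →
               ∀ {x} → x ∈ Generated+𝔪J h → ∀ j → j ℕ.≤ d → component j x ∈ G
        step d IH (Ideals.gen (inj₁ (inj₁ (i , e)))) j j≤d = G.I-resp (sym (component-cong j e))
          ([ (λ z → G.I-resp (sym z) G.I-zero) , (λ z → G.I-resp (sym z) (Ideals.gen (inj₁ (i , refl)))) ]′ (homogeneous i j))
        step d IH (Ideals.gen (inj₁ (inj₂ e))) j j≤d = G.I-resp (sym (component-cong j e))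
          (G.I-resp (sym (proj₂ (component-toPoly j H))) (I-mulʳ ⟨⟩-isIdeal (proj₁ (component-toPoly j H)) (Ideals.gen (inj₂ refl))))
        step d IH (Ideals.gen (inj₂ (μ , ζ , μ₀ , ζ∈J , e))) j j≤d = G.I-resp (sym (component-cong j e))
          (component-* ⟨⟩-isIdeal j μ ζ λ
            { zero    j′ _    → G.I-resp (sym (trans (*-congʳ (trans (component-0 μ) (trans (κ.cong μ₀) κ.0-homo))) (zeroˡ _))) G.I-zero
            ; (suc i) j′ ≡.refl → G.I-mul _ (IH ζ∈J j′ (ℕ.≤-trans (ℕ.s≤s (ℕ.m≤n+m j′ i)) j≤d)) })
        step d IH Ideals.zer j j≤d = G.I-resp (sym (component-zero j)) G.I-zero
        step d IH (Ideals.add {x} {y} p q) j j≤d =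
          G.I-resp (sym (component-+ j x y)) (G.I-add (step d IH p j j≤d) (step d IH q j j≤d))
        step d IH (Ideals.mul r {x} p) j j≤d = component-* ⟨⟩-isIdeal j r x λ i j′ e →
          G.I-mul _ (step d IH p j′ (ℕ.≤-trans (ℕ.m≤n+m j′ i) (ℕ.≤-trans (ℕ.≤-reflexive e) j≤d)))
        step d IH (Ideals.resp e p) j j≤d = G.I-resp (component-cong j e) (step d IH p j j≤d)

        below : ∀ d {ζ} → ζ ∈ J → ∀ j → j ℕ.< d → component j ζ ∈ G
        below (suc d) ζ∈J j (ℕ.s≤s j≤d) = step d (below d) (J⊆ ζ∈J) j j≤d

      nakayama : J ⊆ Generated h
      nakayama x∈J = assemble ⟨⟩-isIdeal λ d → below (suc d) x∈J d ℕ.≤-refl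

    module _ {k} (relation : ∀ {N} → k ℕ.< N → (h : Fin N → Carrier) → (∀ i → h i ∈ J) →
                   ∃ λ (a : Fin N → K.Carrier) → (∃ λ p → ¬ a p K.≈ K.0#) × (κ ∘ a) ∙ h ∈ Generated+𝔪J {0} λ ()) where

      open import Data.Fin.Base using (punchIn; punchOut)

      discard : ∀ {N} (h : Fin (suc N) → Carrier) (a : Fin (suc N) → K.Carrier) p → ¬ a p K.≈ K.0# →
                (κ ∘ a) ∙ h ∈ Generated+𝔪J {0} (λ ()) → Generated+𝔪J h ⊆ Generated+𝔪J (h ∘ punchIn p)
      discard h a p a≉0 rel = ⟨⟩-least ⟨⟩-isIdeal λ
        { (inj₁ (inj₁ (i , e))) → Ideals.resp (sym e) (generator i (p Fin.≟ i))
        ; (inj₁ (inj₂ e))       → Ideals.gen (inj₁ (inj₂ e))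
        ; (inj₂ g)              → Ideals.gen (inj₂ g) }
        where
        W = Generated+𝔪J (h ∘ punchIn p)
        other : ∀ i → h (punchIn p i) ∈ W
        other i = Ideals.gen (inj₁ (inj₁ (i , refl)))
        rel′ : (κ ∘ a) ∙ h ∈ W
        rel′ = ⟨⟩-least ⟨⟩-isIdeal (λ { (inj₁ (inj₁ (() , _))) ; (inj₁ (inj₂ e)) → Ideals.gen (inj₁ (inj₂ e)) ; (inj₂ g) → Ideals.gen (inj₂ g) }) rel
        b = proj₁ (inverse a≉0)
        scaled : κ (a p) * h p ∈ W
        scaled = I-cancel ⟨⟩-isIdeal
          (Ideals.resp (trans (sum-remove {i = p} (λ i → κ (a i) * h i)) (+-comm _ _)) rel′)
          (I-∑ ⟨⟩-isIdeal {f = λ i → κ (a (punchIn p i)) * h (punchIn p i)} (λ i → Ideals.mul _ (other i)))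
        generator : ∀ i → Dec (p ≡ i) → h i ∈ W
        generator i (no p≢i)     = ≡.subst (λ j → h j ∈ W) (Fin.punchIn-punchOut p≢i) (other (punchOut p≢i))
        generator i (yes ≡.refl) = Ideals.resp
          (trans (sym (*-assoc _ _ _)) (trans (*-congʳ (trans (sym (κ.*-homo b (a p))) (trans (κ.cong (proj₂ (inverse a≉0))) κ.1-homo))) (*-identityˡ _)))
          (Ideals.mul (κ b) scaled)

      reduce : ∀ N (h : Fin N → Carrier) → (∀ i → Homogeneous (h i)) → (∀ i → h i ∈ J) → J ⊆ Generated+𝔪J h →
               ∃ λ N′ → N′ ℕ.≤ k × ∃ λ (h′ : Fin N′ → Carrier) → (∀ i → h′ i ∈ J) × J ⊆ Generated h′
      reduce zero    h homogeneous h∈J J⊆ = zero , ℕ.z≤n , h , h∈J , nakayama h homogeneous J⊆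
      reduce (suc N) h homogeneous h∈J J⊆ = decide (suc N ℕ.≤? k)
        where
        decide : Dec (suc N ℕ.≤ k) →
                 ∃ λ N′ → N′ ℕ.≤ k × ∃ λ (h′ : Fin N′ → Carrier) → (∀ i → h′ i ∈ J) × J ⊆ Generated h′
        decide (yes N<k) = suc N , N<k , h , h∈J , nakayama h homogeneous J⊆
        decide (no N≮k)  =
          let a , (p , a≉0) , rel = relation (ℕ.≰⇒> N≮k) h h∈J in
          reduce N (h ∘ punchIn p) (homogeneous ∘ punchIn p) (h∈J ∘ punchIn p)
            (λ x∈J → discard h a p a≉0 rel (J⊆ x∈J))

      padded : ∀ {N} → N ℕ.≤ k → (h : Fin N → Carrier) → ∃ λ (a : Fin k → Carrier) →
               (∀ i → ∃ λ j → a j ≡ h i) × (∀ j → a j ≡ 0# ⊎ ∃ λ i → a j ≡ h i)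
      padded = pad
        where
        pad : ∀ {N k} → N ℕ.≤ k → (h : Fin N → Carrier) → ∃ λ (a : Fin k → Carrier) →
              (∀ i → ∃ λ j → a j ≡ h i) × (∀ j → a j ≡ 0# ⊎ ∃ λ i → a j ≡ h i)
        pad ℕ.z≤n     h = (λ _ → 0#) , (λ ()) , λ _ → inj₁ ≡.refl
        pad (ℕ.s≤s le) h = let a , f , g = pad le (h ∘ suc) in
          (λ { zero → h zero ; (suc j) → a j }) ,
          (λ { zero → zero , ≡.refl ; (suc i) → let j , e = f i in suc j , e }) ,
          (λ { zero → inj₂ (zero , ≡.refl)
             ; (suc j) → [ inj₁ , (λ { (i , e) → inj₂ (suc i , e) }) ]′ (g j) })

      fromList : (g : List Carrier) → (∀ {s} → s ∈ˡ g → Homogeneous s × s ∈ J) →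
                 (∀ {p} {W : Pred Carrier p} → IsIdeal W → (∀ {s} → s ∈ˡ g → s ∈ W) → toPoly H ∈ W → J ⊆ W) →
                 ∃ λ (a : Fin k → Carrier) → (∀ j → a j ∈ J) × J ⊆ Generated a
      fromList g g∈ spans =
        let N , N≤k , h′ , h′∈J , J⊆h′ = reduce (List.length g) (List.lookup g)
              (λ i → proj₁ (g∈ (∈ˡ.∈-lookup {xs = g} i))) (λ i → proj₂ (g∈ (∈ˡ.∈-lookup {xs = g} i)))
              (spans ⟨⟩-isIdeal (λ p → Ideals.gen (inj₁ (inj₁ (Any.index p , reflexive (Any.lookup-index p)))))
                (Ideals.gen (inj₁ (inj₂ refl))))
            a , f , f′ = padded N≤k h′
        in a , (λ j → [ (λ e → IsIdeal.I-resp J-ideal (reflexive (≡.sym e)) (IsIdeal.I-zero J-ideal)) ,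
                        (λ { (i , e) → IsIdeal.I-resp J-ideal (reflexive (≡.sym e)) (h′∈J i) }) ]′ (f′ j)) ,
           λ x∈J → ⟨⟩-least ⟨⟩-isIdeal
             (λ { (inj₁ (i , e)) → Ideals.gen (inj₁ (proj₁ (f i) , trans e (reflexive (≡.sym (proj₂ (f i))))))
                ; (inj₂ e) → Ideals.gen (inj₂ e) })
             (J⊆h′ x∈J)

      generators : ∀ {m} (r : Fin m → Carrier) → (∀ j → r j ∈ J) →
                   (∀ {x} → x ∈ J → ∃ λ s → toPoly H ∣ (x - s ∙ r)) →
                   ∃ λ (a : Fin k → Carrier) → (∀ j → a j ∈ J) × J ⊆ Generated a
      generators {m} r r∈J spans = fromList (List.concat components) origin span
        where
        components : List (List Carrier)
        components = List.tabulate (λ j → T.⟦ r j ⟧)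

        origin : ∀ {s} → s ∈ˡ List.concat components → Homogeneous s × s ∈ J
        origin {s} p = conclude (proj₁ (∈ˡ.∈-tabulate⁻ xs∈)) (proj₁ (∈-coeff s∈xs))
            (≡.trans (proj₂ (∈-coeff s∈xs)) (≡.cong (λ p → coeff p (proj₁ (∈-coeff s∈xs))) (proj₂ (∈ˡ.∈-tabulate⁻ xs∈))))
          where
          split = ∈ˡ.∈-concat⁻′ components p
          s∈xs = proj₁ (proj₂ split)
          xs∈ = proj₂ (proj₂ split)
          conclude : ∀ j d → s ≡ component d (r j) → Homogeneous s × s ∈ J
          conclude j d e = ≡.subst (λ s → Homogeneous s × s ∈ J) (≡.sym e) (component-homogeneous d (r j) , J-graded d (r∈J j))

        span : ∀ {p} {W : Pred Carrier p} → IsIdeal W → (∀ {s} → s ∈ˡ List.concat components → s ∈ W) → toPoly H ∈ W → J ⊆ W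
        span {W = W} W-ideal g⊆W H∈W {x} x∈J = let s , q , e = spans x∈J in
          I-shift W-ideal (IsIdeal.I-resp W-ideal (sym e) (I-mulʳ W-ideal q H∈W))
            (I-∑ W-ideal {f = λ j → s j * r j} (λ j → IsIdeal.I-mul W-ideal (s j) (r∈W j)))
          where
          r∈W : ∀ j → r j ∈ W
          r∈W j = assemble W-ideal λ d → [ (λ p → g⊆W (∈ˡ.∈-concat⁺′ p (∈ˡ.∈-tabulate⁺ j))) ,
            (λ e → IsIdeal.I-resp W-ideal (reflexive (≡.sym e)) (IsIdeal.I-zero W-ideal)) ]′ (coeff-∈ T.⟦ r j ⟧ d)

enumerate : (em : ∀ {a} → ExcludedMiddle a) → ∀ {i} (I : Set i) n →
            (∃ λ m → m ℕ.< n × Σ (Fin m → I) λ f → ∀ x → ∃ λ j → f j ≡ x) ⊎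
            (Σ (Fin n → I) λ f → Injective _≡_ _≡_ f)
enumerate em I zero    = inj₂ ((λ ()) , λ { {()} })
enumerate em I (suc n) with enumerate em I n
... | inj₁ (m , m<n , f) = inj₁ (m , ℕ.m<n⇒m<1+n m<n , f)
... | inj₂ (f , f-injective) with em {P = ∃ λ x → ∀ j → ¬ f j ≡ x}
...   | yes (x , new) = inj₂ (g , g-injective)
  where
  g : Fin (suc n) → I
  g zero    = x
  g (suc j) = f j
  g-injective : Injective _≡_ _≡_ g
  g-injective {zero}  {zero}  e = ≡.refl
  g-injective {zero}  {suc j} e = contradiction (≡.sym e) (new j)
  g-injective {suc i} {zero}  e = contradiction e (new i)
  g-injective {suc i} {suc j} e = ≡.cong suc (f-injective e)
...   | no ¬new = inj₁ (n , ℕ.n<1+n n , f , surjective)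
  where
  surjective : ∀ x → ∃ λ j → f j ≡ x
  surjective x with em {P = ∃ λ j → f j ≡ x}
  ... | yes p = p
  ... | no ¬p = contradiction (x , λ j e → ¬p (j , e)) ¬new

module FiniteGeneration (em : ∀ {a} → ExcludedMiddle a) {c ℓ} (R : CommutativeRing c ℓ) (integral : Integral R)
  (1≉0 : ¬ CommutativeRing._≈_ R (CommutativeRing.1# R) (CommutativeRing.0# R)) where

  open CommutativeRing R hiding (zero)
  open RingKit R
  open LinearDependence R integral 1≉0

  Combination : ∀ {m n} → (Fin m → Vector Carrier n) → Pred (Vector Carrier n) (c ⊔ ℓ)
  Combination g x = ∃ λ s → ∀ k → x k ≈ s ∙ (λ j → g j k)

  Combination-∑ : ∀ {m n p} (g : Fin m → Vector Carrier n) (s : Vector Carrier p) (x : Fin p → Vector Carrier n) →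
                  (∀ i → x i ∈ Combination g) → (λ k → s ∙ (λ i → x i k)) ∈ Combination g
  Combination-∑ g s x h = (λ j → s ∙ (λ i → proj₁ (h i) j)) , λ k →
    trans (∙-cong {u = s} (λ _ → refl) (λ i → proj₂ (h i) k))
      (sym (∙-∑ s (λ i → proj₁ (h i)) (λ j → g j k)))

  free⇒generated : ∀ {n p} {N : Pred (Vector Carrier n) p} → IsFree R N →
    ∃ λ m → m ℕ.≤ n × ∃ λ (g : Fin m → Vector Carrier n) → (∀ j → g j ∈ N) × (∀ {x} → x ∈ N → x ∈ Combination g)
  free⇒generated {n} {N = N} (I , b , b∈ , spans , independent) = conclude (enumerate em I (suc n))
    where
    conclude : _ → ∃ λ m → m ℕ.≤ n × ∃ λ (g : Fin m → Vector Carrier n) → (∀ j → g j ∈ N) × (∀ {x} → x ∈ N → x ∈ Combination g)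
    conclude (inj₂ (f , f-injective)) =
      let s , (i , s≉0) , relation = dependent n (suc n) (ℕ.n<1+n n) (λ i → b (f i)) in
      contradiction (independent (suc n) f f-injective s relation i) s≉0
    conclude (inj₁ (m , m<1+n , f , surjective)) = m , ℕ.s≤s⁻¹ m<1+n , b ∘ f , b∈ ∘ f , λ {x} x∈ →
      let p , e , s , x≈ = spans x x∈
          t , y≈ = Combination-∑ (b ∘ f) s (b ∘ e) (λ i → basis (e i))
      in t , λ k → trans (x≈ k) (y≈ k)
      where
      basis : ∀ i → b i ∈ Combination (b ∘ f)
      basis i = let j , fj≡i = surjective i in δ j , λ k →
        sym (trans (∑-δ j (λ j → b (f j) k)) (reflexive (≡.cong (λ i → b i k) fj≡i)))

module _ {c ℓ} (R : CommutativeRing c ℓ) where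

  open CommutativeRing R hiding (zero)
  open RingKit R
  open import Data.Fin.Base using (_↑ˡ_; _↑ʳ_)

  ∑-↑ : ∀ m {n} (f : Vector Carrier (m ℕ.+ n)) → ∑ f ≈ ∑ (λ i → f (i ↑ˡ n)) + ∑ (λ i → f (m ↑ʳ i))
  ∑-↑ zero    f = sym (+-identityˡ _)
  ∑-↑ (suc m) f = trans (+-congˡ (∑-↑ m (f ∘ suc))) (sym (+-assoc _ _ _))

module Generators (em : ∀ {a} → ExcludedMiddle a) {c ℓ₁ ℓ₂} (F : HeytingField c ℓ₁ ℓ₂) (ℓ : ℕ) where

  open Arrangements F ℓ
  open Residues em
  open LinearForms em F ℓ
  open RestrictionToSubspace em F ℓ
  open ResidueIdeals em F ℓ
  open Localization em F ℓ
  open Divisibility em F ℓ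
  open Grading em F ℓ
  private
    module K = CommutativeRing scalars
    module κ = Hom (MvPolyKit.constHom scalars ℓ)
    module 𝐊 = RingKit scalars
  open CommutativeRing S hiding (zero)
  open RingKit S
  open Ideals S using (IsIdeal)
  open IdealKit S
  open FiniteGeneration em S integral-S 1≉0-S
  open import Data.Fin.Base using (_↑ˡ_; _↑ʳ_)

  module _ (A : Arrangement) {H} (H∈A : H ∈ˡ forms A) {L} (L∈A : L ∈ˡ forms A) (L≠H : ¬ (ker L ≐ ker H))
    {B} (𝔽 : Frame B) (forms⊆ : ∀ {M} → M ∈ˡ forms A → toPoly M ∈ Restriction.Kernel 𝔽)
    {m} (g : Fin m → Ω¹) (g∈ : ∀ j → g j ∈ Log A) (spans : ∀ {η} → η ∈ Log A → η ∈ Combination g) where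

    open Frame 𝔽 using (dim; w; y; dual)
    private
      J = residueIdeal A H
      J-ideal = J-isIdeal A H∈A
      𝐇 = ∣-isIdeal (toPoly H)
      module 𝐇 = IsIdeal 𝐇
      Qᴴ = product (restriction A H)
      point = separate {H} {L} (nonzero′ A H∈A) L≠H
      v = proj₁ point
      Hv≈1 = proj₁ (proj₂ point)
      Lv≈0 = proj₂ (proj₂ point)

    residue : Fin m → Carrier
    residue j = proj₁ (residueExists A H∈A {g j} (g∈ j) v Hv≈1)

    residue-spec : ∀ j → toPoly H ∣ (Qᴴ * residue j - g j ⌟ v)
    residue-spec j = proj₂ (residueExists A H∈A {g j} (g∈ j) v Hv≈1)

    residue∈J : ∀ j → residue j ∈ J
    residue∈J j = J-intro A H∈A {residue j} {g j} v Hv≈1 (g∈ j) (residue-spec j)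

    residue-combination : ∀ {η s r} → (∀ k → η k ≈ s ∙ (λ j → g j k)) → toPoly H ∣ (Qᴴ * r - η ⌟ v) → toPoly H ∣ (r - s ∙ residue)
    residue-combination {η} {s} {r} η≈ d = restriction-cancel A H∈A (𝐇.I-resp eq
      (I-sub 𝐇 d (I-∑ 𝐇 {f = λ j → s j * (Qᴴ * residue j - g j ⌟ v)} (λ j → 𝐇.I-mul (s j) (residue-spec j)))))
      where
      open Relation.Binary.Reasoning.Setoid setoid
      η⌟v : η ⌟ v ≈ s ∙ (λ j → g j ⌟ v)
      η⌟v = trans (∙-cong {v = κ ∘ v} η≈ (λ _ → refl)) (∙-∑ s g (κ ∘ v))
      total : ∑ (λ j → s j * (Qᴴ * residue j - g j ⌟ v)) ≈ Qᴴ * s ∙ residue - s ∙ (λ j → g j ⌟ v)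
      total = trans (∙-+ʳ s (λ j → Qᴴ * residue j) (λ j → - (g j ⌟ v)))
        (+-cong (∙-*ʳ Qᴴ s residue) (∙-negʳ s (λ j → g j ⌟ v)))
      eq : (Qᴴ * r - η ⌟ v) - ∑ (λ j → s j * (Qᴴ * residue j - g j ⌟ v)) ≈ Qᴴ * (r - s ∙ residue)
      eq = begin
        (Qᴴ * r - η ⌟ v) - ∑ (λ j → s j * (Qᴴ * residue j - g j ⌟ v))
          ≈⟨ +-cong (+-congˡ (-‿cong η⌟v)) (-‿cong total) ⟩
        (Qᴴ * r - s ∙ (λ j → g j ⌟ v)) - (Qᴴ * s ∙ residue - s ∙ (λ j → g j ⌟ v))
          ≈⟨ solve 4 (λ q r x y → (q :* r :- y) :- (q :* x :- y) := q :* (r :- x)) refl Qᴴ r (s ∙ residue) (s ∙ (λ j → g j ⌟ v)) ⟩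
        Qᴴ * (r - s ∙ residue) ∎

    residues-span : ∀ {x} → x ∈ J → ∃ λ s → toPoly H ∣ (x - s ∙ residue)
    residues-span {x} x∈J = let η , h , e = J-elim A H∈A v Hv≈1 x∈J
                                s , η≈ = spans h
                            in s , residue-combination {η} {s} {x} η≈ e

    private
      others = extract {L} {forms A} L∈A
      Q/L = product (proj₁ others)

    Q≈ : Q A ≈ toPoly L * Q/L
    Q≈ = proj₁ (proj₂ others)

    -- Forms with residue zero: (Q/α_L) dα_L and Q dyⱼ.
    trivial : Fin (suc dim) → Ω¹
    trivial zero    i = Q/L * κ (L i)
    trivial (suc j) i = Q A * κ (y j i)

    trivial∈Log : ∀ i → trivial i ∈ Log A
    trivial∈Log zero    = minor⇒Log A λ {M} M∈A i j →
      [ (λ { ≡.refl → IsIdeal.I-resp (∣-isIdeal (toPoly M))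
              (solve 3 (λ q x y → :0 := (q :* x) :* y :- (q :* y) :* x) refl Q/L (κ (L i)) (κ (L j)))
              (IsIdeal.I-zero (∣-isIdeal (toPoly M))) }) ,
        (λ M∈ → IsIdeal.I-resp (∣-isIdeal (toPoly M))
              (solve 5 (λ q a b x y → q :* (a :* y :- b :* x) := (q :* a) :* y :- (q :* b) :* x) refl Q/L (κ (L i)) (κ (L j)) (κ (M i)) (κ (M j)))
              (I-mulʳ (∣-isIdeal (toPoly M)) _ (∣-product M∈))) ]′
      (proj₂ (proj₂ others) M∈A)
    trivial∈Log (suc t) = minor⇒Log A λ {M} M∈A i j → IsIdeal.I-resp (∣-isIdeal (toPoly M))
      (solve 5 (λ q a b x y → q :* (a :* y :- b :* x) := (q :* a) :* y :- (q :* b) :* x) refl (Q A) (κ (y t i)) (κ (y t j)) (κ (M i)) (κ (M j)))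
      (I-mulʳ (∣-isIdeal (toPoly M)) _ (∣-product M∈A))

    contract-0 : ∀ θ → trivial zero ∙ θ ≈ Q/L * (κ ∘ L) ∙ θ
    contract-0 θ = ∙-*ˡ Q/L (κ ∘ L) θ

    contract-suc : ∀ j θ → trivial (suc j) ∙ θ ≈ Q A * (κ ∘ y j) ∙ θ
    contract-suc j θ = ∙-*ˡ (Q A) (κ ∘ y j) θ

    coordinates : Fin (suc dim) → Vector Carrier m
    coordinates i = proj₁ (spans (trivial∈Log i))

    coordinates-residue : ∀ i → toPoly H ∣ (coordinates i ∙ residue)
    coordinates-residue i = 𝐇.I-resp (solve 1 (λ x → :- (:0 :- x) := x) refl (coordinates i ∙ residue))
      (I-neg 𝐇 (residue-combination {trivial i} {coordinates i} {0#} (proj₂ (spans (trivial∈Log i))) (contracted i)))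
      where
      contracted : ∀ i → toPoly H ∣ (Qᴴ * 0# - trivial i ⌟ v)
      contracted zero = 𝐇.I-resp (sym (trans (+-congˡ (-‿cong (trans (contract-0 (κ ∘ v))
          (trans (*-congˡ (trans (form-⌟ L v) (trans (κ.cong Lv≈0) κ.0-homo))) (zeroʳ _)))))
        (solve 1 (λ q → q :* :0 :- :0 := :0) refl Qᴴ))) 𝐇.I-zero
      contracted (suc j) = 𝐇.I-resp (sym (trans (+-congˡ (-‿cong (contract-suc j (κ ∘ v))))
          (solve 3 (λ q a b → q :* :0 :- a :* b := a :* (:- b)) refl Qᴴ (Q A) ((κ ∘ y j) ⌟ v))))
        (I-mulʳ 𝐇 _ (∣-product H∈A))

    -- Pairing with the Euler derivation and with the derivations along X shows
    -- that the trivial forms are independent modulo the irrelevant ideal.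
    module _ (a : Fin (suc dim) → K.Carrier) (dependence : ∀ j → a 𝐊.∙ (λ i → ε.⟦ coordinates i j ⟧) K.≈ K.0#) where

      private
        μ : Fin m → Carrier
        μ j = (κ ∘ a) ∙ (λ i → coordinates i j)

        εμ≈0 : ∀ j → ε.⟦ μ j ⟧ K.≈ K.0#
        εμ≈0 j = K.trans (ε.∙-homo (κ ∘ a) (λ i → coordinates i j))
          (K.trans (𝐊.∙-cong {v = λ i → ε.⟦ coordinates i j ⟧} (λ i → ε-κ (a i)) (λ _ → K.refl)) (dependence j))

        η : Ω¹
        η k = (κ ∘ a) ∙ (λ i → trivial i k)

        η≈ : ∀ k → η k ≈ μ ∙ (λ j → g j k)
        η≈ k = trans (∙-cong {u = κ ∘ a} (λ _ → refl) (λ i → proj₂ (spans (trivial∈Log i)) k))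
          (sym (∙-∑ (κ ∘ a) coordinates (λ j → g j k)))

      pairing : ∀ θ x → (∀ {M} → M ∈ˡ forms A → toPoly M ∣ ((κ ∘ M) ∙ θ)) → η ∙ θ ≈ Q A * x → ε.⟦ x ⟧ K.≈ K.0#
      pairing θ x preserved ηθ≈ = K.trans (ε.cong x≈) (K.trans (ε.∙-homo μ p) (𝐊.∙-zeroˡ (λ j → ε.⟦ p j ⟧) εμ≈0))
        where
        quotient : ∀ j → Q A ∣ (g j ∙ θ)
        quotient j = Q-∣ A λ {M} M∈A → contraction A {g j} {M} (g∈ j) M∈A θ (preserved M∈A)
        p = λ j → proj₁ (quotient j)
        x≈ : x ≈ μ ∙ p
        x≈ = Q-cancel A (trans (sym ηθ≈) (trans (∙-cong {v = θ} η≈ (λ _ → refl)) (trans (∙-∑ μ g θ)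
          (trans (∙-cong {u = μ} (λ _ → refl) (λ j → proj₂ (quotient j))) (∙-*ʳ (Q A) μ p)))))

      η-contract : ∀ θ → η ∙ θ ≈ κ (a zero) * (Q/L * (κ ∘ L) ∙ θ) + (λ j → κ (a (suc j))) ∙ (λ j → Q A * (κ ∘ y j) ∙ θ)
      η-contract θ = trans (∙-∑ (κ ∘ a) trivial θ)
        (+-cong (*-congˡ (contract-0 θ)) (∙-cong {u = λ j → κ (a (suc j))} (λ _ → refl) (λ j → contract-suc j θ)))

      independent-suc : ∀ t → a (suc t) K.≈ K.0#
      independent-suc t = K.trans (K.sym (ε-κ (a (suc t)))) (pairing (κ ∘ w t) (κ (a (suc t))) preserved eq)
        where
        vanishing : ∀ {M} → M ∈ˡ forms A → (κ ∘ M) ∙ (κ ∘ w t) ≈ 0#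
        vanishing {M} M∈A = trans (form-⌟ M (w t)) (trans (κ.cong (Restriction.Kernel⇒vanishing 𝔽 M (forms⊆ M∈A) t)) κ.0-homo)
        preserved : ∀ {M} → M ∈ˡ forms A → toPoly M ∣ ((κ ∘ M) ∙ (κ ∘ w t))
        preserved {M} M∈A = IsIdeal.I-resp (∣-isIdeal (toPoly M)) (sym (vanishing M∈A)) (IsIdeal.I-zero (∣-isIdeal (toPoly M)))
        eq : η ∙ (κ ∘ w t) ≈ Q A * κ (a (suc t))
        eq = trans (η-contract (κ ∘ w t)) (trans
          (+-cong (trans (*-congˡ (trans (*-congˡ (vanishing L∈A)) (zeroʳ _))) (zeroʳ _))
            (trans (∙-cong {u = λ j → κ (a (suc j))} (λ _ → refl) (λ j → *-congˡ (trans (form-⌟ (y j) (w t)) (trans (κ.cong (K.trans (dual j t) (𝐊.δ-sym j t))) (κ.δ-homo t j)))))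
              (trans (∙-*ʳ (Q A) (λ j → κ (a (suc j))) (δ t)) (*-congˡ (∙-δ (λ j → κ (a (suc j))) t)))))
          (+-identityˡ _))

      independent-zero : a zero K.≈ K.0#
      independent-zero = K.trans (K.sym ε-value) (pairing θ (κ (a zero) + s ∙ (λ j → toPoly (y j))) (λ {M} _ → 1# , sym (*-identityʳ _)) eq)
        where
        θ = var scalars {ℓ}
        s = λ j → κ (a (suc j))
        ε-value : ε.⟦ κ (a zero) + s ∙ (λ j → toPoly (y j)) ⟧ K.≈ a zero
        ε-value = K.trans (ε.+-homo (κ (a zero)) (s ∙ (λ j → toPoly (y j))))
          (K.trans (K.+-cong (ε-κ (a zero)) (K.trans (ε.∙-homo s (λ j → toPoly (y j)))
            (K.trans (𝐊.∙-comm (λ j → ε.⟦ s j ⟧) (λ j → ε.⟦ toPoly (y j) ⟧)) (𝐊.∙-zeroˡ (λ j → ε.⟦ s j ⟧) (λ j → ε-toPoly (y j))))))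
            (K.+-identityʳ _))
        eq : η ∙ θ ≈ Q A * (κ (a zero) + s ∙ (λ j → toPoly (y j)))
        eq = trans (η-contract θ) (trans
          (+-cong (trans (*-congˡ (trans (*-comm Q/L (toPoly L)) (sym Q≈))) (*-comm _ _)) (∙-*ʳ (Q A) s (λ j → toPoly (y j))))
          (sym (distribˡ (Q A) _ _)))

    open Nakayama {J} J-ideal (λ d → residueIdeal-graded A H∈A d) H using (Generated+𝔪J; ⟨⟩-isIdeal)

    relation : ∀ {k} → m ℕ.≤ k ℕ.+ suc dim → ∀ {N} → k ℕ.< N → (h : Fin N → Carrier) → (∀ i → h i ∈ J) →
               ∃ λ (a : Fin N → K.Carrier) → (∃ λ p → ¬ a p K.≈ K.0#) × (κ ∘ a) ∙ h ∈ Generated+𝔪J {0} λ ()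
    relation {k} m≤ {N} k<N h h∈J = a , nonzero-a , combination∈W
      where
      rows : Fin (N ℕ.+ suc dim) → Vector Carrier m
      rows i = [ (λ i → proj₁ (residues-span (h∈J i))) , coordinates ]′ (Fin.splitAt N i)
      open LinearDependence scalars integral 1≉0
      dep = dependent m (N ℕ.+ suc dim) (ℕ.≤-<-trans m≤ (ℕ.+-monoˡ-< (suc dim) k<N)) (λ i j → ε.⟦ rows i j ⟧)
      s = proj₁ dep
      a = λ i → s (i ↑ˡ suc dim)
      b = λ i → s (N ↑ʳ i)
      G = λ i → proj₁ (residues-span (h∈J i))

      rows-↑ˡ : ∀ i j → rows (i ↑ˡ suc dim) j ≡ G i j
      rows-↑ˡ i j = ≡.cong (λ z → [ G , coordinates ]′ z j) (Fin.splitAt-↑ˡ N i (suc dim))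
      rows-↑ʳ : ∀ i j → rows (N ↑ʳ i) j ≡ coordinates i j
      rows-↑ʳ i j = ≡.cong (λ z → [ G , coordinates ]′ z j) (Fin.splitAt-↑ʳ N (suc dim) i)

      εG εU : Fin m → K.Carrier
      εG j = a 𝐊.∙ (λ i → ε.⟦ G i j ⟧)
      εU j = b 𝐊.∙ (λ i → ε.⟦ coordinates i j ⟧)

      balance : ∀ j → εG j K.+ εU j K.≈ K.0#
      balance j = K.trans (K.sym (K.trans (∑-↑ scalars N (λ i → s i K.* ε.⟦ rows i j ⟧))
        (K.+-cong (𝐊.∙-cong {u = a} (λ _ → K.refl) (λ i → ε.cong (reflexive (rows-↑ˡ i j))))
                  (𝐊.∙-cong {u = b} (λ _ → K.refl) (λ i → ε.cong (reflexive (rows-↑ʳ i j)))))))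
        (proj₂ (proj₂ dep) j)

      nonzero-a : ∃ λ p → ¬ a p K.≈ K.0#
      nonzero-a = [ impossible , id ]′ (∀⊎∃ (λ i → isZero? (a i)))
        where
        i₀ = proj₁ (proj₁ (proj₂ dep))
        s≉0 = proj₂ (proj₁ (proj₂ dep))
        impossible : (∀ i → a i K.≈ K.0#) → ∃ λ p → ¬ a p K.≈ K.0#
        impossible a≈0 = contradiction (s≈0 (Fin.splitAt N i₀) ≡.refl) s≉0
          where
          εU≈0 : ∀ j → εU j K.≈ K.0#
          εU≈0 j = K.trans (K.sym (K.trans (K.+-congʳ (𝐊.∙-zeroˡ (λ i → ε.⟦ G i j ⟧) a≈0)) (K.+-identityˡ _))) (balance j)
          b≈0 : ∀ i → b i K.≈ K.0#
          b≈0 zero    = independent-zero b εU≈0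
          b≈0 (suc t) = independent-suc b εU≈0 t
          s≈0 : ∀ z → Fin.splitAt N i₀ ≡ z → s i₀ K.≈ K.0#
          s≈0 (inj₁ i) e = ≡.subst (λ x → s x K.≈ K.0#) (Fin.splitAt⁻¹-↑ˡ e) (a≈0 i)
          s≈0 (inj₂ i) e = ≡.subst (λ x → s x K.≈ K.0#) (Fin.splitAt⁻¹-↑ʳ e) (b≈0 i)

      W = Generated+𝔪J {0} λ ()
      W-ideal : IsIdeal W
      W-ideal = ⟨⟩-isIdeal

      H∣⇒W : ∀ {x} → toPoly H ∣ x → x ∈ W
      H∣⇒W (q , e) = IsIdeal.I-resp W-ideal (sym e) (I-mulʳ W-ideal q (Ideals.gen (inj₁ (inj₂ refl))))

      μ : Fin m → Carrier
      μ j = (κ ∘ a) ∙ (λ i → G i j) + (κ ∘ b) ∙ (λ i → coordinates i j)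

      ε-combination : ∀ {n} (c : Fin n → K.Carrier) (x : Fin n → Carrier) → ε.⟦ (κ ∘ c) ∙ x ⟧ K.≈ c 𝐊.∙ (λ i → ε.⟦ x i ⟧)
      ε-combination c x = K.trans (ε.∙-homo (κ ∘ c) x) (𝐊.∙-cong {v = λ i → ε.⟦ x i ⟧} (λ i → ε-κ (c i)) (λ _ → K.refl))

      μ-irrelevant : ∀ j → ε.⟦ μ j ⟧ K.≈ K.0#
      μ-irrelevant j = K.trans (ε.+-homo ((κ ∘ a) ∙ (λ i → G i j)) ((κ ∘ b) ∙ (λ i → coordinates i j)))
        (K.trans (K.+-cong (ε-combination a (λ i → G i j)) (ε-combination b (λ i → coordinates i j))) (balance j))

      combination∈W : (κ ∘ a) ∙ h ∈ W
      combination∈W = I-shift W-ideal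
        (H∣⇒W (𝐇.I-resp eq (I-sub 𝐇
          (I-∑ 𝐇 {f = λ i → κ (a i) * (h i - G i ∙ residue)} (λ i → 𝐇.I-mul (κ (a i)) (proj₂ (residues-span (h∈J i)))))
          (I-∑ 𝐇 {f = λ i → κ (b i) * coordinates i ∙ residue} (λ i → 𝐇.I-mul (κ (b i)) (coordinates-residue i))))))
        (I-∑ W-ideal {f = λ j → μ j * residue j} (λ j → Ideals.gen (inj₂ (μ j , residue j , μ-irrelevant j , residue∈J j , refl))))
        where
        eq : ∑ (λ i → κ (a i) * (h i - G i ∙ residue)) - ∑ (λ i → κ (b i) * coordinates i ∙ residue) ≈ (κ ∘ a) ∙ h - μ ∙ residue
        eq = trans (+-congʳ (trans (∙-+ʳ (κ ∘ a) h (λ i → - (G i ∙ residue))) (+-congˡ (∙-negʳ (κ ∘ a) (λ i → G i ∙ residue)))))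
          (trans (solve 3 (λ x p q → (x :- p) :- q := x :- (p :+ q)) refl ((κ ∘ a) ∙ h) _ _)
            (+-congˡ (-‿cong (sym (trans
              (∙-+ˡ (λ j → (κ ∘ a) ∙ (λ i → G i j)) (λ j → (κ ∘ b) ∙ (λ i → coordinates i j)) residue)
              (+-cong (∙-∑ (κ ∘ a) G residue) (∙-∑ (κ ∘ b) coordinates residue)))))))

module CompleteIntersection (em : ∀ {a} → ExcludedMiddle a) {c ℓ₁ ℓ₂} (F : HeytingField c ℓ₁ ℓ₂) (ℓ : ℕ) where

  open Arrangements F ℓ
  open Residues em
  open LinearForms em F ℓ
  open RestrictionToSubspace em F ℓ
  open ResidueIdeals em F ℓ
  open Localization em F ℓ
  open ResiduePrimes em F ℓ
  open Grading em F ℓ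
  open Generators em F ℓ
  open FilterDeduplicate
  private
    module κ = Hom (MvPolyKit.constHom scalars ℓ)
  open CommutativeRing S hiding (zero)
  open RingKit S
  open Ideals S using (IsIdeal; IsPrime)
  open IdealKit S

  residueIdeal-cong : ∀ {A A′ H} → forms A ≡ forms A′ → residueIdeal A H ⊆ residueIdeal A′ H
  residueIdeal-cong {A} {record { forms = .(forms A) }} ≡.refl h = h

  -- The form dα_H / α_H has residue 1.
  onlyHyperplane : ∀ A {H} → H ∈ˡ forms A → (∀ {L} → L ∈ˡ forms A → ker L ≐ ker H) → 1# ∈ residueIdeal A H
  onlyHyperplane A {H} H∈A same = J-intro A H∈A {1#} {κ ∘ H} v Hv≈1
    (minor⇒Log A λ {L} L∈A i j → 0# , trans (minor≈0 L∈A i j) (sym (zeroʳ _)))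
    (IsIdeal.I-resp (∣-isIdeal (toPoly H)) (sym eq) (IsIdeal.I-zero (∣-isIdeal (toPoly H))))
    where
    v = proj₁ (normalize (nonzero′ A H∈A))
    Hv≈1 = proj₂ (normalize (nonzero′ A H∈A))
    minor≈0 : ∀ {L} → L ∈ˡ forms A → ∀ i j → minor (κ ∘ H) L i j ≈ 0#
    minor≈0 {L} L∈A i j =
      let a , H≈aL = Span₁ (Span-of-vanishing {L ∷ []} {H} (λ h → proj₁ (same L∈A) (h (here ≡.refl))))
          κH≈ = λ i → trans (κ.cong (H≈aL i)) (κ.*-homo a (L i))
      in trans (+-cong (*-congʳ (κH≈ i)) (-‿cong (*-congʳ (κH≈ j))))
           (solve 3 (λ a x y → (a :* x) :* y :- (a :* y) :* x := :0) refl (κ a) (κ (L i)) (κ (L j)))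
    empty : restriction A H ≡ []
    empty = ≡.cong (deduplicate (SameTrace? H)) (List.filter-none (λ L → ¬? (em {P = ker L ≐ ker H}))
      (All.tabulate λ L∈A L≠H → L≠H (same L∈A)))
    eq : product (restriction A H) * 1# - (κ ∘ H) ⌟ v ≈ 0#
    eq = x≈y⇒x-y≈0 (trans (trans (*-identityʳ _) (reflexive (≡.cong product empty)))
      (sym (trans (form-⌟ H v) (trans (κ.cong Hv≈1) κ.1-homo))))

  anotherHyperplane : ∀ A {H} → H ∈ˡ forms A → 1# ∉ residueIdeal A H → ∃ λ L → L ∈ˡ forms A × ¬ (ker L ≐ ker H)
  anotherHyperplane A {H} H∈A 1∉ = byCases λ none → contradiction
    (onlyHyperplane A H∈A (λ {L} L∈A → byCases λ L≠H → ⊥-elim (none (L , L∈A , L≠H)))) 1∉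

  module _ (A : Arrangement) {H} (H∈A : H ∈ˡ forms A) (X : Pred V (c ⊔ ℓ₁)) (X∈Ξmax : X ∈ Ξmax A H) where

    private
      X-flat = proj₁ (proj₁ X∈Ξmax)
      X-proper = proj₂ (proj₁ X∈Ξmax)
      maximal = proj₂ X∈Ξmax
    open Flat A H∈A X X-flat

    private
      J-ideal = J-isIdeal Aₓ H∈Aₓ′
      module 𝐒̄ = Ideals (S̄ H)

    -- Any prime P over J is centred, within A_X, on a flat Y ⊇ X with
    -- Y ∈ Ξ(A, H); maximality of X forces Y = X.
    Kernel⊆primes : ∀ (P : Pred Carrier (c ⊔ ℓ₁)) → 𝐒̄.IsPrime P → Jₓ ⊆ P → Kernel ⊆ P
    Kernel⊆primes P P-prime̅ J⊆P k = Kernel⊆P Aₓ H∈Aₓ′ P P-prime̅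
      (Kernel⊆ Y.Kernel-isIdeal (λ {β} p → Y.⊇⇒Kernel {β} (λ y → X⇒Vanishing (Y⊆X y) p)) k)
      where
      Y = centre Aₓ H∈Aₓ′ P P-prime̅
      Y-flat = centre-flat Aₓ H∈Aₓ′ P P-prime̅
      module Y = Flat Aₓ H∈Aₓ′ Y Y-flat
      R⊆ : ∀ {L} → L ∈ˡ restriction Aₓ H → L ∈ˡ restriction A H × X ⊆ ker L
      R⊆ {L} p = ∈ˡ.∈-filter⁻ (X⊆? A H∈A X X⊆H) {xs = restriction A H}
        (≡.subst (L ∈ˡ_) (restriction-localization A H∈A X X⊆H) p)
      X⊆Y : X ⊆ Y
      X⊆Y x = X⊆H x , All.tabulate λ p → proj₂ (R⊆ (proj₁ (proj₂ Y-flat) p)) x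
      same-forms : forms (localization Aₓ Y) ≡ forms (localization A Y)
      same-forms = filter-filter (λ L → em {P = Y ⊆ ker L}) (λ L → em {P = X ⊆ ker L}) (λ Y⊆L x → Y⊆L (X⊆Y x)) (forms A)
      Y∈Ξ : Y ∈ Ξ A H
      Y∈Ξ = (proj₁ Y-flat , (λ p → proj₁ (R⊆ (proj₁ (proj₂ Y-flat) p))) , proj₂ (proj₂ Y-flat)) ,
        λ { (_ , U⊆) → proj₂ (centre∈Ξ Aₓ H∈Aₓ′ P P-prime̅ J⊆P)
              ((λ _ → _) , λ {r} u → residueIdeal-cong {localization A Y} {localization Aₓ Y} {H} (≡.sym same-forms) {r} (U⊆ {r} u)) }
      Y⊆X : Y ⊆ X
      Y⊆X = maximal Y Y∈Ξ X⊆Y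

    private
      S̄/J : CommutativeRing c (c ⊔ ℓ₁)
      S̄/J = 𝐒̄._/⟨_⟩ Jₓ

      ≈⇒∈J : ∀ {x y} → CommutativeRing._≈_ S̄/J x y → x - y ∈ Jₓ
      ≈⇒∈J (Ideals.mod d) = J-closed Aₓ H∈Aₓ′ d

      ∈J⇒≈ : ∀ {x y} → x - y ∈ Jₓ → CommutativeRing._≈_ S̄/J x y
      ∈J⇒≈ d = Ideals.mod (Ideals.gen d)

      ≈⇒≈/J : ∀ {x y} → x ≈ y → CommutativeRing._≈_ S̄/J x y
      ≈⇒≈/J e = ∈J⇒≈ (IsIdeal.I-resp J-ideal (sym (x≈y⇒x-y≈0 e)) (IsIdeal.I-zero J-ideal))

    krullDimension : HasKrullDim S̄/J dim
    krullDimension = KrullDimension.hasKrullDim em scalars inverses 1≉0 {S̄/J} dim toQuotient restrict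
      ρ-const (λ p → σ.⟦ p ⟧ , ρσ p) kernel
      where
      module E = CommutativeRing Sᵉ
      toQuotient : Hom scalars S̄/J
      toQuotient = record
        { ⟦_⟧ = κ ; cong = λ e → ≈⇒≈/J (κ.cong e) ; +-homo = λ a b → ≈⇒≈/J (κ.+-homo a b)
        ; *-homo = λ a b → ≈⇒≈/J (κ.*-homo a b) ; 0-homo = ≈⇒≈/J κ.0-homo ; 1-homo = ≈⇒≈/J κ.1-homo }
      restrict : Hom S̄/J Sᵉ
      restrict = record
        { ⟦_⟧ = ρ.⟦_⟧
        ; cong = λ {x} {y} e → RingKit.x-y≈0⇒x≈y Sᵉ (E.trans (E.sym (ρ.sub-homo x y)) (Jₓ⊆Kernel X-proper (≈⇒∈J e)))
        ; +-homo = ρ.+-homo ; *-homo = ρ.*-homo ; 0-homo = ρ.0-homo ; 1-homo = ρ.1-homo }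
      kernel : ∀ (P : Pred Carrier (c ⊔ ℓ₁)) → Ideals.IsPrime S̄/J P → Kernel ⊆ P
      kernel P P-prime = Kernel⊆primes P P-prime̅ J⊆P
        where
        open Ideals.IsPrime P-prime
        open Ideals.IsIdeal isIdeal
        J⊆P : Jₓ ⊆ P
        J⊆P {x} x∈J = I-resp (∈J⇒≈ (IsIdeal.I-resp J-ideal (solve 1 (λ x → :- x := :0 :- x) refl x) (I-neg J-ideal x∈J))) I-zero
        P-prime̅ : 𝐒̄.IsPrime P
        P-prime̅ = record
          { isIdeal = record
            { I-resp = λ e → I-resp (∈J⇒≈ (J-H Aₓ H∈Aₓ′ (≈̄⇒∣ {H} e)))
            ; I-zero = I-zero ; I-add = I-add ; I-mul = I-mul }
          ; proper = proper ; prime = prime }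

    codimension : ℕ
    codimension = ℓ ℕ.∸ suc dim

    ℓ≡ : codimension ℕ.+ suc dim ≡ ℓ
    ℓ≡ = ℕ.m∸n+n≡m dim<ℓ

    completeIntersection : IsFree S (Log Aₓ) → IsCompleteIntersection H Jₓ
    completeIntersection free = codimension , (proj₁ generating , J⇒ , ⇒J) , dim , krullDimension ,
      ≡.trans (≡.sym ℓ≡) (ℕ.+-suc codimension dim)
      where
      finite = FiniteGeneration.free⇒generated em S integral-S 1≉0-S free
      m≤ℓ = proj₁ (proj₂ finite)
      g = proj₁ (proj₂ (proj₂ finite))
      g∈ = proj₁ (proj₂ (proj₂ (proj₂ finite)))
      g-spans = proj₂ (proj₂ (proj₂ (proj₂ finite)))
      another = anotherHyperplane Aₓ H∈Aₓ′ (λ 1∈J → X-proper (1∈J⇒U 1∈J))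
      L∈A = proj₁ (proj₂ another)
      L≠H = proj₂ (proj₂ another)
      open Nakayama {Jₓ} J-ideal (λ d → residueIdeal-graded Aₓ H∈Aₓ′ d) H using (Generated; generators; ⟨⟩-least)
      generating : ∃ λ (a : Fin codimension → Carrier) → (∀ j → a j ∈ Jₓ) × Jₓ ⊆ Generated a
      generating = generators
        (relation Aₓ H∈Aₓ′ {proj₁ another} L∈A L≠H X-frame localForms⊆ g g∈ g-spans (≡.subst (proj₁ finite ℕ.≤_) (≡.sym ℓ≡) m≤ℓ))
        (residue Aₓ H∈Aₓ′ {proj₁ another} L∈A L≠H X-frame localForms⊆ g g∈ g-spans)
        (residue∈J Aₓ H∈Aₓ′ {proj₁ another} L∈A L≠H X-frame localForms⊆ g g∈ g-spans)
        (residues-span Aₓ H∈Aₓ′ {proj₁ another} L∈A L≠H X-frame localForms⊆ g g∈ g-spans)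
      a = proj₁ generating
      a∈J = proj₁ (proj₂ generating)

      J′ : Pred Carrier (c ⊔ ℓ₁)
      J′ = 𝐒̄.⟨_⟩ (λ s → ∃ λ i → CommutativeRing._≈_ (S̄ H) s (a i))

      ≈⇒≈̄ : ∀ {x y} → x ≈ y → CommutativeRing._≈_ (S̄ H) x y
      ≈⇒≈̄ e = ∣⇒≈̄ {H} (0# , trans (x≈y⇒x-y≈0 e) (sym (zeroʳ _)))

      J⇒ : Jₓ ⊆ J′
      J⇒ x∈J = ⟨⟩-least ideal
        (λ { (inj₁ (i , e)) → Ideals.gen (i , ≈⇒≈̄ e)
           ; (inj₂ e)       → Ideals.resp (∣⇒≈̄ {H} (- 1# , trans (+-congˡ (-‿cong e)) (solve 1 (λ h → :0 :- h := h :* (:- :1)) refl (toPoly H)))) Ideals.zer })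
        (proj₂ (proj₂ generating) x∈J)
        where
        ideal : IsIdeal J′
        ideal = record { I-resp = λ e → Ideals.resp (≈⇒≈̄ e) ; I-zero = Ideals.zer ; I-add = Ideals.add ; I-mul = Ideals.mul }

      ⇒J : J′ ⊆ Jₓ
      ⇒J (Ideals.gen (i , e)) = J-resp̄ Aₓ H∈Aₓ′ (CommutativeRing.sym (S̄ H) e) (a∈J i)
      ⇒J Ideals.zer           = IsIdeal.I-zero J-ideal
      ⇒J (Ideals.add p q)     = IsIdeal.I-add J-ideal (⇒J p) (⇒J q)
      ⇒J (Ideals.mul r p)     = IsIdeal.I-mul J-ideal r (⇒J p)
      ⇒J (Ideals.resp e p)    = J-resp̄ Aₓ H∈Aₓ′ e (⇒J p)

lemma5p1 : (em : ∀ {a} → ExcludedMiddle a) →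
    ∀ {c ℓ₁ ℓ₂} (K : HeytingField c ℓ₁ ℓ₂) (ℓ : ℕ) →
    let open Arrangements K ℓ
        open Residues em in
    (A : Arrangement) (H : Form) → H ∈ˡ forms A →
    let open Ideals (S̄ H) in
      (∀ (P : Pred (CommutativeRing.Carrier (S̄ H)) (c ⊔ ℓ₁)) →
         IsMinimalPrimeOver (residueIdeal A H) P ⇔ (∃ λ X → X ∈ Ξmax A H × P ≐ definingIdeal H X))
    × (∀ (P : Pred (CommutativeRing.Carrier (S̄ H)) (c ⊔ ℓ₁)) →
         IsAssociatedPrime (residueIdeal A H) P → ∃ λ X → X ∈ Ξ A H × P ≐ definingIdeal H X)
    × (∀ X → X ∈ Ξmax A H → IsFree S (Log (localization A X)) →
         IsCompleteIntersection H (residueIdeal (localization A X) H))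
lemma5p1 em K ℓ A H H∈A =
    (λ P → mk⇔ (minimalPrimes⇒ A H∈A P) (minimalPrimes⇐ A H∈A P))
  , associatedPrimes A H∈A
  , λ X X∈Ξmax → completeIntersection A H∈A X X∈Ξmax
  where
  open ResiduePrimes em K ℓ
  open CompleteIntersection em K ℓ
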